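{- Let $k\geq 1$ be an integer. There exists $N=N(k)$ such that for every $n\geq N$ and every partition $\mu'\vdash k$, setting $\mu=[n-k,\mu']\vdash n$ (the partition whose largest part is $n-k$ and whose remaining parts are those of $\mu'$), the eigenvalue $\phi^{[n-1,1]}_\mu$ is the second largest eigenvalue of $X_\mu$ in absolute value; that is, $|\phi^{\lambda}_\mu|<|\phi^{[n-1,1]}_\mu|$ for every partition $\lambda\vdash n$ with $\lambda\notin\{[n],[n-1,1]\}$.
   Context: For $n\geq1$ let $\mathcal{M}_{2n}$ be the set of perfect matchings of the complete graph $K_{2n}$ on $\{1,\dots,2n\}$. For $P,Q\in\mathcal{M}_{2n}$ the union $P\cup Q$ is a vertex-disjoint union of even cycles (an edge common to $P$ and $Q$ counts as a cycle of length $2$); if their lengths are $2\mu_1\geq\dots\geq2\mu_k$, then $\mu=[\mu_1,\dots,\mu_k]$ is a partition of $n$ and $P,Q$ are called $\mu$-related. For $\mu\vdash n$, $A_\mu$ is the $0/1$ matrix indexed by $\mathcal{M}_{2n}$ whose $(P,Q)$-entry is $1$ iff $P,Q$ are $\mu$-related, and $X_\mu$ is the graph with adjacency matrix $A_\mu$. These matrices commute and are simultaneously diagonalizable; their common eigenspaces are indexed by partitions $\lambda\vdash n$: the $\lambda$-eigenspace is the isotypic component of the permutation representation of $S_{2n}$ on $\mathcal{M}_{2n}$ affording the irreducible Specht module $S^{2\lambda}$, where $2\lambda=[2\lambda_1,2\lambda_2,\dots]$ (each such module occurs exactly once). $\phi^\lambda_\mu$ denotes the eigenvalue of $A_\mu$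 on the $\lambda$-eigenspace; $\phi^{[n]}_\mu=v_\mu$ is the valency of $X_\mu$. -}

module Defs where

open import Data.Bool using (Bool; true; false; _∧_; _∨_; not; if_then_else_)
open import Data.Nat using (ℕ; zero; suc; _+_; _*_; _∸_; _≤_; _<_; _≤ᵇ_; _<ᵇ_)
open import Data.Nat.Properties using () renaming (_≟_ to _≟ℕ_)
open import Data.Fin using (Fin; toℕ) renaming (_≟_ to _≟F_)
open import Data.Fin.Properties using ()
open import Data.Vec using (Vec; []; _∷_; lookup; tabulate)
open import Data.List using (List; []; _∷_; map; filterᵇ; concatMap; allFin; foldr; length; upTo)
open import Data.Nat.ListAction using (sum)
open import Data.Bool.ListAction using (and; or)
open import Data.List.Relation.Unary.All using (All)
open import Data.List.Relation.Unary.Linked using (Linked)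
open import Data.List.Properties using (≡-dec)
open import Data.Product using (Σ; _×_; _,_; ∃; proj₁)
open import Data.Rational using (ℚ; 0ℚ; 1ℚ; -_) renaming (_+_ to _+ℚ_; _*_ to _*ℚ_)
open import Relation.Nullary using (does; ¬_)
open import Relation.Binary.PropositionalEquality using (_≡_)

record Partition (n : ℕ) : Set where
  constructor mkPartition
  field
    parts    : List ℕ
    positive : All (λ p → 1 ≤ p) parts
    decr     : Linked (λ a b → b ≤ a) parts
    total    : sum parts ≡ n
open Partition public

Tab : ℕ → Set
Tab m = Vec (Fin m) m

_==F_ : ∀ {m} → Fin m → Fin m → Bool
x ==F y = does (x ≟F y)

_==ℕ_ : ℕ → ℕ → Bool
a ==ℕ b = does (a ≟ℕ b)

infixr 9 _$_
infix 4 _==F_ _==ℕ_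

_$_ : ∀ {m} → Tab m → Fin m → Fin m
f $ x = lookup f x

_∘T_ : ∀ {m} → Tab m → Tab m → Tab m
g ∘T h = tabulate (λ x → g $ (h $ x))

iterT : ∀ {m} → ℕ → Tab m → Fin m → Fin m
iterT zero    f x = x
iterT (suc t) f x = f $ iterT t f x

allVecs : (m k : ℕ) → List (Vec (Fin m) k)
allVecs m zero    = [] ∷ []
allVecs m (suc k) = concatMap (λ v → map (λ x → x ∷ v) (allFin m)) (allVecs m k)

allB : ∀ {m} → (Fin m → Bool) → Bool
allB {m} p = and (map p (allFin m))

anyB : ∀ {m} → (Fin m → Bool) → Bool
anyB {m} p = or (map p (allFin m))

isPerm : ∀ {m} → Tab m → Bool
isPerm f = allB (λ i → allB (λ j → not (f $ i ==F f $ j) ∨ (i ==F j)))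

perms : (m : ℕ) → List (Tab m)
perms m = filterᵇ isPerm (allVecs m m)

inversions : ∀ {m} → Tab m → ℕ
inversions {m} f =
  sum (map (λ i → length (filterᵇ (λ j → (toℕ i <ᵇ toℕ j) ∧ (toℕ (f $ j) <ᵇ toℕ (f $ i))) (allFin m)))
           (allFin m))

even : ℕ → Bool
even zero          = true
even (suc zero)    = false
even (suc (suc k)) = even k

sgn : ∀ {m} → Tab m → ℚ
sgn f = if even (inversions f) then 1ℚ else - 1ℚ

-- Perfect matchings of K_{2n}, stored as fixed-point-free involutions
-- (P $ x is the partner of x in the matching P).

isMatching : ∀ {m} → Tab m → Bool
isMatching P = allB (λ x → (P $ (P $ x) ==F x) ∧ not (P $ x ==F x))

matchings : (n : ℕ) → List (Tab (2 * n))
matchings n = filterᵇ isMatching (allVecs (2 * n) (2 * n))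

IsMatching : ∀ {m} → Tab m → Set
IsMatching P = isMatching P ≡ true

-- Cycles of P ∪ Q.  Walking from x alternately along a P-edge and a
-- Q-edge, i.e. applying QP = Q ∘ P, the cycle of P ∪ Q through x has
-- length 2l where l is the least t ≥ 1 with (QP)^t x = x.

module _ {m : ℕ} (P Q : Tab m) where

  QP : Tab m
  QP = Q ∘T P

  halfLen : Fin m → ℕ
  halfLen x = go m 1 (QP $ x)
    where
    go : ℕ → ℕ → Fin m → ℕ
    go zero    t y = t
    go (suc f) t y = if y ==F x then t else go f (suc t) (QP $ y)

  sameCycle : Fin m → Fin m → Bool
  sameCycle x y = or (map (λ t → (iterT t QP x ==F y) ∨ (P $ iterT t QP x ==F y)) (upTo m))

  isRep : Fin m → Bool
  isRep x = allB (λ y → not (sameCycle x y) ∨ (toℕ x ≤ᵇ toℕ y))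

  cycleHalfLengths : List ℕ
  cycleHalfLengths = map halfLen (filterᵇ isRep (allFin m))

insertD : ℕ → List ℕ → List ℕ
insertD a []       = a ∷ []
insertD a (b ∷ bs) = if b ≤ᵇ a then a ∷ b ∷ bs else b ∷ insertD a bs

sortD : List ℕ → List ℕ
sortD = foldr insertD []

related : ∀ {m} → List ℕ → Tab m → Tab m → Bool
related μ P Q = does (≡-dec _≟ℕ_ (sortD (cycleHalfLengths P Q)) (sortD μ))

-- Vectors in ℚ^{M_{2n}} (only their values on matchings matter) and
-- the adjacency matrix A_μ.

sumℚ : List ℚ → ℚ
sumℚ = foldr _+ℚ_ 0ℚ

QVec : ℕ → Set
QVec n = Tab (2 * n) → ℚ

applyA : ∀ {n} → List ℕ → QVec n → QVec n
applyA {n} μ v P = sumℚ (map v (filterᵇ (related μ P) (matchings n)))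

-- The λ-eigenspace: the S^{2λ}-isotypic component of ℚ^{M_{2n}}.
-- For the tableau t₀ of shape ν = 2λ filled row by row, with row group
-- R and column group C, and the Young symmetrizer c = Σ_{β∈C} Σ_{α∈R}
-- sgn(β) β α, the S^ν-isotypic component of a ℚ[S_m]-module M is
-- Σ_t c_t M = Σ_{σ ∈ S_m} σ c M, i.e. the span of σ c δ_P.

double : List ℕ → List ℕ
double = map (λ p → 2 * p)

rowCol : List ℕ → ℕ → ℕ × ℕ
rowCol []       i = (0 , i)
rowCol (p ∷ ps) i with i <ᵇ p
... | true  = (0 , i)
... | false with rowCol ps (i ∸ p)
...   | (r , c) = (suc r , c)

rowOf colOf : List ℕ → ℕ → ℕ
rowOf ps i = proj₁ (rowCol ps i)
colOf ps i = Data.Product.proj₂ (rowCol ps i)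

rowGroup colGroup : (m : ℕ) → List ℕ → List (Tab m)
rowGroup m ν = filterᵇ (λ g → allB (λ x → rowOf ν (toℕ (g $ x)) ==ℕ rowOf ν (toℕ x))) (perms m)
colGroup m ν = filterᵇ (λ g → allB (λ x → colOf ν (toℕ (g $ x)) ==ℕ colOf ν (toℕ x))) (perms m)

-- g · P = Q  for a permutation g and matchings P, Q  ({i,j} ↦ {g i, g j})
actsTo : ∀ {m} → Tab m → Tab m → Tab m → Bool
actsTo g P Q = allB (λ x → Q $ (g $ x) ==F g $ (P $ x))

indic : Bool → ℚ
indic b = if b then 1ℚ else 0ℚ

youngVec : ∀ {n} → List ℕ → Tab (2 * n) → Tab (2 * n) → QVec n
youngVec {n} λs σ P Q =
  sumℚ (map (λ β → sumℚ (map (λ α → sgn β *ℚ indic (actsTo (σ ∘T (β ∘T α)) P Q))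
                             (rowGroup (2 * n) (double λs))))
            (colGroup (2 * n) (double λs)))

record Generator (n : ℕ) : Set where
  constructor gen
  field
    coeff : ℚ
    perm  : Tab (2 * n)
    isP   : isPerm perm ≡ true
    match : Tab (2 * n)
    isM   : IsMatching match

evalGens : ∀ {n} → List ℕ → List (Generator n) → QVec n
evalGens {n} λs gs Q = sumℚ (map (λ g → Generator.coeff g *ℚ youngVec {n} λs (Generator.perm g) (Generator.match g) Q) gs)

InEigenspace : (n : ℕ) → Partition n → QVec n → Set
InEigenspace n λp v =
  Σ (List (Generator n)) λ gs → ∀ Q → IsMatching Q → v Q ≡ evalGens {n} (parts λp) gs Q

-- v is a nonzero vector of the λ-eigenspace with A_μ v = a v;
-- a is then the eigenvalue φ^λ_μ
IsEigenpair : (n : ℕ) → List ℕ → Partition n → QVec n → ℚ → Set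
IsEigenpair n μ λp v a =
  InEigenspace n λp v
  × (Σ (Tab (2 * n)) λ P → IsMatching P × ¬ (v P ≡ 0ℚ))
  × (∀ P → IsMatching P → applyA {n} μ v P ≡ a *ℚ v P)

{-# OPTIONS --safe #-}

-- Let V be the valency of X_μ and N the number of matchings of K_{2n}.
--
-- Symmetrizing a vector of the [n-1,1]-eigenspace over the row group of [2n-2,2] gives an
-- eigenfunction whose value at P depends only on whether P contains one fixed edge {s,t}.
-- Its eigenvalue b is therefore α₁ - α₂, where α₁ and α₂ count the matchings containing {s,t}
-- that are μ-related to a matching with, respectively without, this edge; double counting
-- gives V ≤ 2n |b|.
--
-- If λ is neither [n] nor [n-1,1], the column group of 2λ contains four disjoint transpositions
-- or S₃ × S₃, and in both cases the λ-eigenspace yields an eigenfunction y ≠ 0 antisymmetric in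
-- four disjoint transpositions.  Symmetrizing y over further edges of a matching Q with y(Q) ≠ 0
-- does not change y(Q) up to a power of 2.  Permuting these transpositions then produces about
-- (n/4)⁴ eigenfunctions with distinct characters of an elementary abelian 2-group, hence pairwise
-- orthogonal, and Bessel's inequality for the rows of A_μ gives (n/4)⁴ a² ≤ N V, roughly.
--
-- Finally N² ≤ (2n)!, and the stabilizer of a pair of μ-related matchings has at most
-- 2n (2k)^(2k) elements, so (2n)! ≤ 2n (2k)^(2k) N V and N ≤ 2n (2k)^(2k) V.  Hence a² is of
-- order V²/n³ at most, while b² ≥ V²/(4n²).

module Submission where

open import Defs
open import Data.Bool using (Bool; true; false; _∧_; _∨_; not; if_then_else_; _xor_; T; T?)
open import Data.Bool.Properties using (∧-zeroʳ; ∨-zeroʳ; xor-∧-commutativeRing; T-≡; ¬-not; not-involutive)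
open import Data.Bool.ListAction using (and; or)
open import Data.Nat using (ℕ; zero; suc; _+_; _*_; _∸_; _≤_; _<_; _≤ᵇ_; _<ᵇ_; z≤n; s≤s; s≤s⁻¹; _^_; _<?_; pred; NonZero)
import Data.Nat.Properties as ℕₚ
import Data.Nat.Tactic.RingSolver as ℕ-Ring
open import Data.Nat.DivMod using (_%_; _/_; m≡m%n+[m/n]*n; m%n<n)
open import Data.Nat.ListAction using (sum)
open import Data.Fin using (Fin; toℕ; zero; suc; fromℕ<; fromℕ; inject₁; _↑ˡ_; _↑ʳ_; splitAt; combine; remQuot; punchIn; punchOut)
open import Data.Fin.Properties using (any?; pigeonhole; injective⇒≤; toℕ-injective; toℕ-fromℕ<; toℕ<n; ¬∀⟶∃¬-smallest; toℕ-↑ˡ; toℕ-↑ʳ; remQuot-combine; combine-remQuot; combine-injective)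
import Data.Fin.Properties as Finₚ
open import Data.Fin.Permutation using (Permutation′; permutation; _⟨$⟩ʳ_; _⟨$⟩ˡ_; inverseˡ; inverseʳ; flip; _∘ₚ_; transpose)
import Data.Fin.Permutation as Perm
open import Data.Vec using (Vec; []; _∷_; lookup; tabulate)
open import Data.Vec.Properties using (lookup∘tabulate; tabulate∘lookup; tabulate-cong)
open import Data.List using (List; []; _∷_; _++_; map; filterᵇ; concatMap; allFin; length; upTo; cartesianProduct)
import Data.List.Properties as Listₚ
open import Data.List.Membership.Propositional using (_∈_; _∉_)
open import Data.List.Membership.Propositional.Properties using (∈-map⁺; ∈-map⁻; ∈-filter⁺; ∈-filter⁻; ∈-allFin; ∈-concat⁺′; ∈-++⁺ˡ; ∈-++⁺ʳ; ∈-++⁻; ∈-upTo⁺; ∈-∃++; ∈-lookup; ∈-length; ∈-cartesianProduct⁺; ∈-cartesianProduct⁻)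
open import Data.List.Membership.Propositional.Properties.WithK using (unique∧set⇒bag)
open import Data.List.Relation.Binary.BagAndSetEquality using (∼bag⇒↭)
open import Data.List.Relation.Binary.Permutation.Propositional using (_↭_; ↭-sym; ↭-trans; ↭-refl; prep; swap)
import Data.List.Relation.Binary.Permutation.Propositional as ↭
open import Data.List.Relation.Binary.Permutation.Propositional.Properties using (∈-resp-↭; map⁺)
open import Data.List.Relation.Unary.All using (All; []; _∷_)
import Data.List.Relation.Unary.All as All
open import Data.List.Relation.Unary.AllPairs using (AllPairs; []; _∷_)
import Data.List.Relation.Unary.AllPairs as AllPairs
import Data.List.Relation.Unary.AllPairs.Properties as AllPairsₚ
open import Data.List.Relation.Unary.Any using (here; there)
open import Data.List.Relation.Unary.Linked using (Linked; []; _∷_)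
open import Data.List.Relation.Unary.Unique.Propositional using (Unique)
open import Data.List.Relation.Unary.Unique.Propositional.Properties using (allFin⁺; concat⁺; filter⁺)
import Data.List.Relation.Unary.Unique.Propositional.Properties as Uniqueₚ
open import Data.Product using (∃-syntax; _×_; _,_; proj₁; proj₂)
open import Data.Sum using (_⊎_; inj₁; inj₂; [_,_]′)
open import Data.Empty using (⊥; ⊥-elim)
open import Data.Rational using (ℚ; 0ℚ; 1ℚ; -_; ∣_∣) renaming (_+_ to _+ℚ_; _*_ to _*ℚ_; _-_ to _-ℚ_; _≤_ to _≤ℚ_; _<_ to _<ℚ_; 1/_ to 1/ℚ_)
import Data.Rational as ℚ
import Data.Rational.Properties as ℚₚ
import Data.Integer as ℤ
open import Data.Rational.Solver using (module +-*-Solver)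
open +-*-Solver using (solve; con; _:=_; _:+_; _:*_; _:-_; :-_)
open import Function using (_∘_; case_of_; mk⇔; Equivalence)
open import Relation.Nullary using (¬_; Dec; yes; no; does)
open import Relation.Nullary.Decidable using (dec-true; dec-false)
open import Relation.Binary.PropositionalEquality using (_≡_; _≢_; refl; sym; trans; cong; cong₂; subst; subst₂; module ≡-Reasoning)
open import Algebra using (CommutativeRing)
import Algebra.Properties.CommutativeMonoid.Sum (CommutativeRing.+-commutativeMonoid xor-∧-commutativeRing) as ⊕
import Data.List.Membership.DecPropositional as DecMembership

-- Bessel's inequality stands in for dimension formulas: summed over all rows of A_μ, it says that r
-- pairwise orthogonal non-zero eigenfunctions give r a² ≤ tr(A_μ A_μᵀ) = N V. The exponent of n in
-- r decides the proof. The comparison loses n³: one factor n from the symmetries of the long cycle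
-- in the stabilizer, two from squaring V ≤ 2n |b|. Hence four independently movable transpositions
-- are required. The shape [2n-2,2] has only two columns of height 2 and escapes the estimate; every
-- other non-trivial 2λ has four columns of height at least 2 or two of height at least 3, and in
-- the second case each triple yields one more transposition with the help of an outside point. The
-- sign of b depends on μ: α₁ = 0 if 1 is not a part of μ, and α₁ ≥ 2 α₂ otherwise; so |b| is what
-- is estimated. Membership in the λ-eigenspace enters through one consequence: a non-zero v in it
-- has non-zero inner product with some generator, which makes row and column symmetrizations of v
-- available as non-zero test functions.

not-both : ∀ {b} → b ≡ true → b ≡ false → ⊥
not-both refl ()

≡-from-⇔ : ∀ {a b : Bool} → (a ≡ true → b ≡ true) → (b ≡ true → a ≡ true) → a ≡ b
≡-from-⇔ {true}  {b}     f g = sym (f refl)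
≡-from-⇔ {false} {false} f g = refl
≡-from-⇔ {false} {true}  f g = g refl

∧-true : ∀ {a b} → a ∧ b ≡ true → a ≡ true × b ≡ true
∧-true {true} {true} _ = refl , refl

∨-true : ∀ {a b} → a ∨ b ≡ true → a ≡ true ⊎ b ≡ true
∨-true {true}  _ = inj₁ refl
∨-true {false} e = inj₂ e

not-true : ∀ {a} → not a ≡ true → a ≡ false
not-true {false} _ = refl

==F⇒≡ : ∀ {m} {x y : Fin m} → (x ==F y) ≡ true → x ≡ y
==F⇒≡ {x = x} {y} e with x Finₚ.≟ y
... | yes p = p

≡⇒==F : ∀ {m} {x y : Fin m} → x ≡ y → (x ==F y) ≡ true
≡⇒==F {x = x} {y} = dec-true (x Finₚ.≟ y)

≢⇒==F : ∀ {m} {x y : Fin m} → x ≢ y → (x ==F y) ≡ false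
≢⇒==F {x = x} {y} = dec-false (x Finₚ.≟ y)

==F⇒≢ : ∀ {m} {x y : Fin m} → (x ==F y) ≡ false → x ≢ y
==F⇒≢ e p = not-both (≡⇒==F p) e

≤ᵇ⁻ : ∀ {a b} → (a ≤ᵇ b) ≡ true → a ≤ b
≤ᵇ⁻ {a} {b} e = ℕₚ.≤ᵇ⇒≤ a b (Equivalence.from T-≡ e)

≤ᵇ⁺ : ∀ {a b} → a ≤ b → (a ≤ᵇ b) ≡ true
≤ᵇ⁺ l = Equivalence.to T-≡ (ℕₚ.≤⇒≤ᵇ l)

-- Boolean quantifiers over lists, duplicate-free lists and counting by injections

and-map⁻ : ∀ {A : Set} (p : A → Bool) xs → and (map p xs) ≡ true → ∀ {x} → x ∈ xs → p x ≡ true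
and-map⁻ p (y ∷ ys) e (here refl) = proj₁ (∧-true e)
and-map⁻ p (y ∷ ys) e (there i)   = and-map⁻ p ys (proj₂ (∧-true {p y} e)) i

and-map⁺ : ∀ {A : Set} (p : A → Bool) xs → (∀ {x} → x ∈ xs → p x ≡ true) → and (map p xs) ≡ true
and-map⁺ p []       f = refl
and-map⁺ p (x ∷ xs) f rewrite f (here refl) = and-map⁺ p xs (f ∘ there)

or-map⁻ : ∀ {A : Set} (p : A → Bool) xs → or (map p xs) ≡ true → ∃[ x ] x ∈ xs × p x ≡ true
or-map⁻ p (x ∷ xs) e with p x in eq
... | true  = x , here refl , eq
... | false with or-map⁻ p xs e
...   | y , i , r = y , there i , r

or-map⁺ : ∀ {A : Set} (p : A → Bool) {xs x} → x ∈ xs → p x ≡ true → or (map p xs) ≡ true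
or-map⁺ p (here refl) e rewrite e = refl
or-map⁺ p {y ∷ _} (there i) e rewrite or-map⁺ p i e = ∨-zeroʳ (p y)

allB⁻ : ∀ {m} {p : Fin m → Bool} → allB p ≡ true → ∀ x → p x ≡ true
allB⁻ {m} {p} e x = and-map⁻ p (allFin m) e (∈-allFin x)

allB⁺ : ∀ {m} {p : Fin m → Bool} → (∀ x → p x ≡ true) → allB p ≡ true
allB⁺ {m} {p} f = and-map⁺ p (allFin m) (λ {x} _ → f x)

Tab-ext : ∀ {A : Set} {k} {u v : Vec A k} → (∀ x → lookup u x ≡ lookup v x) → u ≡ v
Tab-ext {u = u} {v} e = trans (sym (tabulate∘lookup u)) (trans (tabulate-cong e) (tabulate∘lookup v))

module _ {A : Set} where

  ∈-filterᵇ⁺ : ∀ (p : A → Bool) {x xs} → x ∈ xs → p x ≡ true → x ∈ filterᵇ p xs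
  ∈-filterᵇ⁺ p i e = ∈-filter⁺ (T? ∘ p) i (Equivalence.from T-≡ e)

  ∈-filterᵇ⁻ : ∀ (p : A → Bool) {x xs} → x ∈ filterᵇ p xs → x ∈ xs × p x ≡ true
  ∈-filterᵇ⁻ p {xs = xs} i with ∈-filter⁻ (T? ∘ p) {xs = xs} i
  ... | j , t = j , Equivalence.to T-≡ t

  filterᵇ-unique : ∀ (p : A → Bool) {xs} → Unique xs → Unique (filterᵇ p xs)
  filterᵇ-unique p = filter⁺ (T? ∘ p)

map-unique : ∀ {A B : Set} (f : A → B) {xs} → Unique xs →
             (∀ {x y} → x ∈ xs → y ∈ xs → f x ≡ f y → x ≡ y) → Unique (map f xs)
map-unique f {[]}     []       inj = []
map-unique f {x ∷ xs} (u ∷ us) inj =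
  All.tabulate (λ i e → case ∈-map⁻ f i of λ where
    (y , j , refl) → All.lookup u j (inj (here refl) (there j) e))
  ∷ map-unique f us (λ i j → inj (there i) (there j))

-- Both lists are duplicate-free, so equality as sets is equality as bags. The inverse laws are
-- asked only on members, which is all that holds for cycle representatives.
map-↭ : ∀ {A B : Set} {xs : List A} {ys : List B} → Unique xs → Unique ys → (f : A → B) (g : B → A) →
        (∀ {x} → x ∈ xs → f x ∈ ys) → (∀ {y} → y ∈ ys → g y ∈ xs) →
        (∀ {x} → x ∈ xs → g (f x) ≡ x) → (∀ {y} → y ∈ ys → f (g y) ≡ y) → map f xs ↭ ys
map-↭ {xs = xs} {ys} uxs uys f g f∈ g∈ gf fg = ∼bag⇒↭ (unique∧set⇒bag (map-unique f uxs inj) uys (mk⇔ to from))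
  where
  inj : ∀ {x y} → x ∈ xs → y ∈ xs → f x ≡ f y → x ≡ y
  inj i j e = trans (sym (gf i)) (trans (cong g e) (gf j))
  to : ∀ {z} → z ∈ map f xs → z ∈ ys
  to i with ∈-map⁻ f i
  ... | x , j , refl = f∈ j
  from : ∀ {z} → z ∈ ys → z ∈ map f xs
  from i = subst (_∈ map f xs) (fg i) (∈-map⁺ f (g∈ i))

⊆-length : ∀ {A : Set} {xs ys : List A} → Unique xs → (∀ {x} → x ∈ xs → x ∈ ys) → length xs ≤ length ys
⊆-length {xs = []}     _        _   = z≤n
⊆-length {xs = x ∷ xs} (u ∷ us) sub with ∈-∃++ (sub (here refl))
... | as , bs , refl = begin
    suc (length xs) ≤⟨ s≤s (⊆-length us sub′) ⟩
    suc (length (as ++ bs)) ≡⟨ cong suc (Listₚ.length-++ as) ⟩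
    suc (length as + length bs) ≡⟨ ℕₚ.+-suc (length as) (length bs) ⟨
    length as + length (x ∷ bs) ≡⟨ Listₚ.length-++ as ⟨
    length (as ++ x ∷ bs) ∎
  where
  open ℕₚ.≤-Reasoning
  sub′ : ∀ {y} → y ∈ xs → y ∈ as ++ bs
  sub′ {y} i with ∈-++⁻ as (sub (there i))
  ... | inj₁ j           = ∈-++⁺ˡ j
  ... | inj₂ (here refl) = ⊥-elim (All.lookup u i refl)
  ... | inj₂ (there j)   = ∈-++⁺ʳ as j

inj-length : ∀ {A B : Set} {xs : List A} {ys : List B} → Unique xs → (f : A → B) →
             (∀ {x} → x ∈ xs → f x ∈ ys) → (∀ {x y} → x ∈ xs → y ∈ xs → f x ≡ f y → x ≡ y) →
             length xs ≤ length ys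
inj-length {xs = xs} {ys} u f f∈ inj = subst (_≤ length ys) (Listₚ.length-map f xs)
  (⊆-length (map-unique f u inj) λ i → case ∈-map⁻ f i of λ where (x , j , refl) → f∈ j)

∈-allVecs : ∀ {m k} (v : Vec (Fin m) k) → v ∈ allVecs m k
∈-allVecs []      = here refl
∈-allVecs (x ∷ v) = ∈-concat⁺′ (∈-map⁺ (_∷ v) (∈-allFin x)) (∈-map⁺ _ (∈-allVecs v))

allVecs-unique : ∀ m k → Unique (allVecs m k)
allVecs-unique m zero    = [] ∷ []
allVecs-unique m (suc k) = concat⁺
  (All.tabulate λ i → case ∈-map⁻ _ i of λ where
    (v , _ , refl) → map-unique (_∷ v) (allFin⁺ m) λ where _ _ refl → refl)
  (AllPairsₚ.map⁺ (AllPairs.map (λ v≢w {_} (i , j) → disj v≢w i j) (allVecs-unique m k)))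
  where
  disj : ∀ {v w : Vec (Fin m) k} → v ≢ w → ∀ {z} →
         z ∈ map (_∷ v) (allFin m) → z ∈ map (_∷ w) (allFin m) → ⊥
  disj v≢w i j with ∈-map⁻ _ i | ∈-map⁻ _ j
  ... | _ , _ , refl | _ , _ , refl = v≢w refl

length-allFin : ∀ m → length (allFin m) ≡ m
length-allFin m = Listₚ.length-tabulate _

length-allVecs : ∀ m k → length (allVecs m k) ≡ m ^ k
length-allVecs m zero    = refl
length-allVecs m (suc k) = trans (go (allVecs m k)) (trans (cong (_* m) (length-allVecs m k)) (ℕₚ.*-comm (m ^ k) m))
  where
  go : ∀ vs → length (concatMap (λ v → map (λ x → x ∷ v) (allFin m)) vs) ≡ length vs * m
  go []       = refl
  go (v ∷ vs) = trans (Listₚ.length-++ (map (_∷ v) (allFin m)))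
    (cong₂ _+_ (trans (Listₚ.length-map _ (allFin m)) (length-allFin m)) (go vs))

-- The embedding of ℕ in ℚ and finite sums

ι : ℕ → ℚ
ι zero    = 0ℚ
ι (suc n) = 1ℚ +ℚ ι n

ι-+ : ∀ a b → ι (a + b) ≡ ι a +ℚ ι b
ι-+ zero    b = sym (ℚₚ.+-identityˡ (ι b))
ι-+ (suc a) b = trans (cong (1ℚ +ℚ_) (ι-+ a b)) (sym (ℚₚ.+-assoc 1ℚ (ι a) (ι b)))

ι-* : ∀ a b → ι (a * b) ≡ ι a *ℚ ι b
ι-* zero    b = sym (ℚₚ.*-zeroˡ (ι b))
ι-* (suc a) b = begin
  ι (b + a * b) ≡⟨ ι-+ b (a * b) ⟩
  ι b +ℚ ι (a * b) ≡⟨ cong (ι b +ℚ_) (ι-* a b) ⟩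
  ι b +ℚ ι a *ℚ ι b ≡⟨ cong (_+ℚ ι a *ℚ ι b) (ℚₚ.*-identityˡ (ι b)) ⟨
  1ℚ *ℚ ι b +ℚ ι a *ℚ ι b ≡⟨ ℚₚ.*-distribʳ-+ (ι b) 1ℚ (ι a) ⟨
  (1ℚ +ℚ ι a) *ℚ ι b ∎
  where open ≡-Reasoning

0≤1 : 0ℚ ≤ℚ 1ℚ
0≤1 = ℚ.*≤* (ℤ.+≤+ z≤n)

0<1 : 0ℚ <ℚ 1ℚ
0<1 = ℚ.*<* (ℤ.+<+ (s≤s z≤n))

0≤ι : ∀ n → 0ℚ ≤ℚ ι n
0≤ι zero    = ℚₚ.≤-refl
0≤ι (suc n) = ℚₚ.+-mono-≤ 0≤1 (0≤ι n)

0<ι : ∀ n → 0ℚ <ℚ ι (suc n)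
0<ι n = ℚₚ.+-mono-<-≤ 0<1 (0≤ι n)

ι-mono-≤ : ∀ {a b} → a ≤ b → ι a ≤ℚ ι b
ι-mono-≤ {b = b} z≤n = 0≤ι b
ι-mono-≤ (s≤s p)     = ℚₚ.+-monoʳ-≤ 1ℚ (ι-mono-≤ p)

ι-mono-< : ∀ {a b} → a < b → ι a <ℚ ι b
ι-mono-< {a} {b} p = ℚₚ.<-≤-trans (subst (_<ℚ ι (suc a)) (ℚₚ.+-identityˡ (ι a)) (ℚₚ.+-monoˡ-< (ι a) 0<1)) (ι-mono-≤ p)

*-cancel-zero : ∀ c {x} → c ≢ 0ℚ → c *ℚ x ≡ 0ℚ → x ≡ 0ℚ
*-cancel-zero c {x} c≢0 e = begin
  x                  ≡⟨ ℚₚ.*-identityˡ x ⟨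
  1ℚ *ℚ x            ≡⟨ cong (_*ℚ x) (ℚₚ.*-inverseˡ c) ⟨
  1/ℚ c *ℚ c *ℚ x    ≡⟨ ℚₚ.*-assoc (1/ℚ c) c x ⟩
  1/ℚ c *ℚ (c *ℚ x)  ≡⟨ cong (1/ℚ c *ℚ_) e ⟩
  1/ℚ c *ℚ 0ℚ        ≡⟨ ℚₚ.*-zeroʳ (1/ℚ c) ⟩
  0ℚ                 ∎
  where
  open ≡-Reasoning
  instance
    nonZero : ℚ.NonZero c
    nonZero = ℚ.≢-nonZero c≢0

0<⇒≢0 : ∀ {x} → 0ℚ <ℚ x → x ≢ 0ℚ
0<⇒≢0 p e = ℚₚ.<-irrefl refl (subst (0ℚ <ℚ_) e p)

∑ : ∀ {A : Set} → List A → (A → ℚ) → ℚ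
∑ xs f = sumℚ (map f xs)

module _ {A : Set} where

  ∑-cong : ∀ {f g : A → ℚ} xs → (∀ {x} → x ∈ xs → f x ≡ g x) → ∑ xs f ≡ ∑ xs g
  ∑-cong []       e = refl
  ∑-cong (x ∷ xs) e = cong₂ _+ℚ_ (e (here refl)) (∑-cong xs (e ∘ there))

  ∑-+ : ∀ (f g : A → ℚ) xs → ∑ xs (λ x → f x +ℚ g x) ≡ ∑ xs f +ℚ ∑ xs g
  ∑-+ f g []       = refl
  ∑-+ f g (x ∷ xs) rewrite ∑-+ f g xs =
    solve 4 (λ a b c d → (a :+ b) :+ (c :+ d) := (a :+ c) :+ (b :+ d)) refl (f x) (g x) (∑ xs f) (∑ xs g)

  ∑-* : ∀ c (f : A → ℚ) xs → ∑ xs (λ x → c *ℚ f x) ≡ c *ℚ ∑ xs f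
  ∑-* c f []       = sym (ℚₚ.*-zeroʳ c)
  ∑-* c f (x ∷ xs) = trans (cong (c *ℚ f x +ℚ_) (∑-* c f xs)) (sym (ℚₚ.*-distribˡ-+ c (f x) (∑ xs f)))

  ∑-0 : ∀ xs → ∑ xs (λ (_ : A) → 0ℚ) ≡ 0ℚ
  ∑-0 []       = refl
  ∑-0 (x ∷ xs) = trans (ℚₚ.+-identityˡ _) (∑-0 xs)

  ∑-≡0 : ∀ {f : A → ℚ} xs → (∀ {x} → x ∈ xs → f x ≡ 0ℚ) → ∑ xs f ≡ 0ℚ
  ∑-≡0 xs e = trans (∑-cong xs e) (∑-0 xs)

  ∑-swap : ∀ {B : Set} (f : A → B → ℚ) xs ys → ∑ xs (λ x → ∑ ys (f x)) ≡ ∑ ys (λ y → ∑ xs (λ x → f x y))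
  ∑-swap f []       ys = sym (go ys)
    where
    go : ∀ ys → ∑ ys (λ _ → 0ℚ) ≡ 0ℚ
    go []       = refl
    go (y ∷ ys) = trans (ℚₚ.+-identityˡ _) (go ys)
  ∑-swap f (x ∷ xs) ys = trans (cong (∑ ys (f x) +ℚ_) (∑-swap f xs ys)) (sym (go ys))
    where
    go : ∀ ys → ∑ ys (λ y → f x y +ℚ ∑ xs (λ z → f z y)) ≡ ∑ ys (f x) +ℚ ∑ ys (λ y → ∑ xs (λ z → f z y))
    go []       = refl
    go (y ∷ ys) rewrite go ys =
      solve 4 (λ a b c d → (a :+ b) :+ (c :+ d) := (a :+ c) :+ (b :+ d)) refl (f x y) (∑ xs (λ z → f z y)) (∑ ys (f x)) (∑ ys (λ y → ∑ xs (λ z → f z y)))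

  ∑-↭ : ∀ (f : A → ℚ) {xs ys} → xs ↭ ys → ∑ xs f ≡ ∑ ys f
  ∑-↭ f ↭.refl         = refl
  ∑-↭ f (prep x p)     = cong (f x +ℚ_) (∑-↭ f p)
  ∑-↭ f (swap {xs} {ys} x y p) rewrite ∑-↭ f p =
    solve 3 (λ a b c → a :+ (b :+ c) := b :+ (a :+ c)) refl (f x) (f y) (∑ ys f)
  ∑-↭ f (↭.trans p q)  = trans (∑-↭ f p) (∑-↭ f q)

  ∑-filterᵇ : ∀ (p : A → Bool) (f : A → ℚ) xs → ∑ (filterᵇ p xs) f ≡ ∑ xs (λ x → indic (p x) *ℚ f x)
  ∑-filterᵇ p f []       = refl
  ∑-filterᵇ p f (x ∷ xs) with p x
  ... | true  = cong₂ _+ℚ_ (sym (ℚₚ.*-identityˡ (f x))) (∑-filterᵇ p f xs)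
  ... | false = trans (∑-filterᵇ p f xs) (trans (sym (ℚₚ.+-identityˡ _)) (cong (_+ℚ _) (sym (ℚₚ.*-zeroˡ (f x)))))

  ∑-const : ∀ c (xs : List A) → ∑ xs (λ _ → c) ≡ ι (length xs) *ℚ c
  ∑-const c []       = sym (ℚₚ.*-zeroˡ c)
  ∑-const c (x ∷ xs) = begin
    c +ℚ ∑ xs (λ _ → c) ≡⟨ cong₂ _+ℚ_ (sym (ℚₚ.*-identityˡ c)) (∑-const c xs) ⟩
    1ℚ *ℚ c +ℚ ι (length xs) *ℚ c ≡⟨ ℚₚ.*-distribʳ-+ c 1ℚ (ι (length xs)) ⟨
    (1ℚ +ℚ ι (length xs)) *ℚ c ∎
    where open ≡-Reasoning

  ∑-≢0 : ∀ {f : A → ℚ} xs → ∑ xs f ≢ 0ℚ → ∃[ x ] x ∈ xs × f x ≢ 0ℚ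
  ∑-≢0     []       n = ⊥-elim (n refl)
  ∑-≢0 {f} (x ∷ xs) n with f x ℚₚ.≟ 0ℚ
  ... | no  q = x , here refl , q
  ... | yes q with ∑-≢0 xs (λ e → n (trans (cong₂ _+ℚ_ q e) (ℚₚ.+-identityˡ 0ℚ)))
  ...   | y , i , r = y , there i , r

  ∑-mono-≤ : ∀ {f g : A → ℚ} xs → (∀ {x} → x ∈ xs → f x ≤ℚ g x) → ∑ xs f ≤ℚ ∑ xs g
  ∑-mono-≤ []       e = ℚₚ.≤-refl
  ∑-mono-≤ (x ∷ xs) e = ℚₚ.+-mono-≤ (e (here refl)) (∑-mono-≤ xs (e ∘ there))

  ∑-reindex : ∀ {xs : List A} → Unique xs → (φ ψ : A → A) →
              (∀ {x} → x ∈ xs → φ x ∈ xs) → (∀ {x} → x ∈ xs → ψ x ∈ xs) →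
              (∀ {x} → x ∈ xs → ψ (φ x) ≡ x) → (∀ {x} → x ∈ xs → φ (ψ x) ≡ x) →
              ∀ (f : A → ℚ) → ∑ xs (f ∘ φ) ≡ ∑ xs f
  ∑-reindex {xs} u φ ψ φ∈ ψ∈ ψφ φψ f = trans (cong sumℚ (Listₚ.map-∘ xs)) (∑-↭ f (map-↭ u u φ ψ φ∈ ψ∈ ψφ φψ))

-- Permutations acting on matchings

-- `matchings n` is `mats (2 * n)` by definition. A free number of points lets matchings be put side
-- by side on `a + b` points and be shrunk from `suc (suc m)` points to `m`.
mats : ∀ m → List (Tab m)
mats m = filterᵇ isMatching (allVecs m m)

mats-unique : ∀ m → Unique (mats m)
mats-unique m = filterᵇ-unique isMatching (allVecs-unique m m)

record Matching {m} (P : Tab m) : Set where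
  field
    involutive  : ∀ x → P $ (P $ x) ≡ x
    irreflexive : ∀ x → P $ x ≢ x

open Matching public

isMatching⁻ : ∀ {m} (P : Tab m) → isMatching P ≡ true → Matching P
isMatching⁻ P e .involutive  x = ==F⇒≡ (proj₁ (∧-true (allB⁻ e x)))
isMatching⁻ P e .irreflexive x = ==F⇒≢ (not-true (proj₂ (∧-true {P $ (P $ x) ==F x} (allB⁻ e x))))

isMatching⁺ : ∀ {m} {P : Tab m} → Matching P → isMatching P ≡ true
isMatching⁺ M = allB⁺ λ x → cong₂ _∧_ (≡⇒==F (involutive M x)) (cong not (≢⇒==F (irreflexive M x)))

matching-injective : ∀ {m} {P : Tab m} → Matching P → ∀ {x y} → P $ x ≡ P $ y → x ≡ y
matching-injective {P = P} M {x} {y} e = trans (sym (involutive M x)) (trans (cong (P $_) e) (involutive M y))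

∈-mats : ∀ {m} {P : Tab m} → Matching P → P ∈ mats m
∈-mats {P = P} M = ∈-filterᵇ⁺ isMatching (∈-allVecs P) (isMatching⁺ M)

mats⇒matching : ∀ {m} {P : Tab m} → P ∈ mats m → Matching P
mats⇒matching {m} {P} i = isMatching⁻ P (proj₂ (∈-filterᵇ⁻ isMatching {xs = allVecs m m} i))

isPerm⁻ : ∀ {m} (g : Tab m) → isPerm g ≡ true → ∀ {x y} → g $ x ≡ g $ y → x ≡ y
isPerm⁻ g e {x} {y} q with ∨-true (allB⁻ (allB⁻ e x) y)
... | inj₁ r = ⊥-elim (not-both (≡⇒==F q) (not-true r))
... | inj₂ r = ==F⇒≡ r

isPerm⁺ : ∀ {m} (g : Tab m) → (∀ {x y} → g $ x ≡ g $ y → x ≡ y) → isPerm g ≡ true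
isPerm⁺ g inj = allB⁺ λ x → allB⁺ λ y → go x y
  where
  go : ∀ x y → not (g $ x ==F g $ y) ∨ (x ==F y) ≡ true
  go x y with (g $ x ==F g $ y) in e
  ... | true  = ≡⇒==F (inj (==F⇒≡ e))
  ... | false = refl

∈-perms : ∀ {m} {g : Tab m} → isPerm g ≡ true → g ∈ perms m
∈-perms {g = g} e = ∈-filterᵇ⁺ isPerm (∈-allVecs g) e

perms-isPerm : ∀ {m} {g : Tab m} → g ∈ perms m → isPerm g ≡ true
perms-isPerm {m} i = proj₂ (∈-filterᵇ⁻ isPerm {xs = allVecs m m} i)

perms-unique : ∀ m → Unique (perms m)
perms-unique m = filterᵇ-unique isPerm (allVecs-unique m m)

module _ {m : ℕ} (π : Permutation′ m) where

  perm-injective : ∀ {x y} → π ⟨$⟩ʳ x ≡ π ⟨$⟩ʳ y → x ≡ y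
  perm-injective {x} {y} e = trans (sym (inverseˡ π)) (trans (cong (π ⟨$⟩ˡ_) e) (inverseˡ π))

  tabOf : Tab m
  tabOf = tabulate (π ⟨$⟩ʳ_)

  tabOf-$ : ∀ x → tabOf $ x ≡ π ⟨$⟩ʳ x
  tabOf-$ = lookup∘tabulate (π ⟨$⟩ʳ_)

  tabOf-isPerm : isPerm tabOf ≡ true
  tabOf-isPerm = isPerm⁺ tabOf λ {x} {y} e → perm-injective (trans (sym (tabOf-$ x)) (trans e (tabOf-$ y)))

injective⇒surjective : ∀ {m} (f : Fin m → Fin m) → (∀ {x y} → f x ≡ f y → x ≡ y) → ∀ y → ∃[ x ] f x ≡ y
injective⇒surjective {suc m} f inj y with any? (λ x → f x Finₚ.≟ y)
... | yes p = p
... | no  n = ⊥-elim (ℕₚ.1+n≰n (injective⇒≤ {f = λ x → punchOut {i = y} {f x} (λ e → n (x , sym e))}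
                (λ {x} {z} e → inj (Finₚ.punchOut-injective (λ e → n (x , sym e)) (λ e → n (z , sym e)) e))))

ofInjection : ∀ {m} (f : Fin m → Fin m) → (∀ {x y} → f x ≡ f y → x ≡ y) → Permutation′ m
ofInjection f inj = permutation f (λ y → proj₁ (injective⇒surjective f inj y))
  (λ y → proj₂ (injective⇒surjective f inj y)) (λ x → inj (proj₂ (injective⇒surjective f inj (f x))))

ofTab : ∀ {m} (g : Tab m) → isPerm g ≡ true → Permutation′ m
ofTab g e = ofInjection (g $_) (isPerm⁻ g e)

module _ {m : ℕ} (a b : Fin m) where

  transpose-left : transpose a b ⟨$⟩ʳ a ≡ b
  transpose-left rewrite dec-true (a Finₚ.≟ a) refl = refl

  transpose-right : transpose a b ⟨$⟩ʳ b ≡ a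
  transpose-right with b Finₚ.≟ a
  ... | yes e = e
  ... | no  _ rewrite dec-true (b Finₚ.≟ b) refl = refl

  transpose-other : ∀ {c} → c ≢ a → c ≢ b → transpose a b ⟨$⟩ʳ c ≡ c
  transpose-other {c} p q rewrite dec-false (c Finₚ.≟ a) p | dec-false (c Finₚ.≟ b) q = refl

data Transposed {m} (a b c d : Fin m) : Set where
  left  : c ≡ a → d ≡ b → Transposed a b c d
  right : c ≡ b → d ≡ a → Transposed a b c d
  other : c ≢ a → c ≢ b → d ≡ c → Transposed a b c d

transposed : ∀ {m} (a b c : Fin m) → Transposed a b c (transpose a b ⟨$⟩ʳ c)
transposed a b c with c Finₚ.≟ a
... | yes e = left e refl
... | no  p with c Finₚ.≟ b
...   | yes e = right e refl
...   | no  q = other p q refl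

transpose-involutive : ∀ {m} (a b c : Fin m) → transpose a b ⟨$⟩ʳ (transpose a b ⟨$⟩ʳ c) ≡ c
transpose-involutive a b c with transpose a b ⟨$⟩ʳ c | transposed a b c
... | d | left  p q   = trans (cong (transpose a b ⟨$⟩ʳ_) q) (trans (transpose-right a b) (sym p))
... | d | right p q   = trans (cong (transpose a b ⟨$⟩ʳ_) q) (trans (transpose-left a b) (sym p))
... | d | other p q r = trans (cong (transpose a b ⟨$⟩ʳ_) r) (transpose-other a b p q)

-- A matching is stored as an involution, so moving its edges by π is conjugation by π.
act : ∀ {m} → Permutation′ m → Tab m → Tab m
act π P = tabulate (λ x → π ⟨$⟩ʳ (P $ (π ⟨$⟩ˡ x)))

module _ {m : ℕ} where

  act-$ : ∀ (π : Permutation′ m) P x → act π P $ x ≡ π ⟨$⟩ʳ (P $ (π ⟨$⟩ˡ x))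
  act-$ π P = lookup∘tabulate _

  act-$-ʳ : ∀ (π : Permutation′ m) P x → act π P $ (π ⟨$⟩ʳ x) ≡ π ⟨$⟩ʳ (P $ x)
  act-$-ʳ π P x = trans (act-$ π P _) (cong (λ y → π ⟨$⟩ʳ (P $ y)) (inverseˡ π))

  act-unique : ∀ (π : Permutation′ m) P Q → (∀ x → Q $ (π ⟨$⟩ʳ x) ≡ π ⟨$⟩ʳ (P $ x)) → Q ≡ act π P
  act-unique π P Q h = Tab-ext λ x →
    trans (cong (Q $_) (sym (inverseʳ π))) (trans (h (π ⟨$⟩ˡ x)) (sym (act-$ π P x)))

  act-∘ : ∀ (π ρ : Permutation′ m) P → act ρ (act π P) ≡ act (π ∘ₚ ρ) P
  act-∘ π ρ P = act-unique (π ∘ₚ ρ) P _ λ x → trans (act-$-ʳ ρ (act π P) _) (cong (ρ ⟨$⟩ʳ_) (act-$-ʳ π P x))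

  act-cong : ∀ (π ρ : Permutation′ m) P → (∀ x → π ⟨$⟩ʳ x ≡ ρ ⟨$⟩ʳ x) → act π P ≡ act ρ P
  act-cong π ρ P e = act-unique ρ P _ λ x →
    trans (cong (act π P $_) (sym (e x))) (trans (act-$-ʳ π P x) (e (P $ x)))

  act-id : ∀ (π : Permutation′ m) P → (∀ x → π ⟨$⟩ʳ x ≡ x) → act π P ≡ P
  act-id π P e = sym (act-unique π P P λ x → trans (cong (P $_) (e x)) (sym (e (P $ x))))

  act-flip : ∀ (π : Permutation′ m) P → act (flip π) (act π P) ≡ P
  act-flip π P = trans (act-∘ π (flip π) P) (act-id (π ∘ₚ flip π) P λ _ → inverseˡ π)

  act-flip′ : ∀ (π : Permutation′ m) P → act π (act (flip π) P) ≡ P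
  act-flip′ π P = trans (act-∘ (flip π) π P) (act-id (flip π ∘ₚ π) P λ _ → inverseʳ π)

  act-matching : ∀ (π : Permutation′ m) {P} → Matching P → Matching (act π P)
  act-matching π {P} M = record { involutive = inv ; irreflexive = fix }
    where
    inv : ∀ x → act π P $ (act π P $ x) ≡ x
    inv x = trans (cong (act π P $_) (act-$ π P x)) (trans (act-$-ʳ π P _)
      (trans (cong (π ⟨$⟩ʳ_) (involutive M _)) (inverseʳ π)))
    fix : ∀ x → act π P $ x ≢ x
    fix x e = irreflexive M (π ⟨$⟩ˡ x) (trans (sym (inverseˡ π)) (cong (π ⟨$⟩ˡ_) (trans (sym (act-$ π P x)) e)))

  -- Exchanging the ends of an edge leaves the set of edges unchanged. This is why symmetrizing over
  -- edges of Q cannot destroy the value of a function at Q.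
  act-transpose-edge : ∀ {P : Tab m} → Matching P → ∀ a → act (transpose a (P $ a)) P ≡ P
  act-transpose-edge {P} M a = sym (act-unique τ P P go)
    where
    b = P $ a
    τ = transpose a b
    go : ∀ x → P $ (τ ⟨$⟩ʳ x) ≡ τ ⟨$⟩ʳ (P $ x)
    go x with τ ⟨$⟩ʳ x | transposed a b x
    ... | d | left refl refl  = trans (involutive M a) (sym (transpose-right a b))
    ... | d | right refl refl = sym (trans (cong (τ ⟨$⟩ʳ_) (involutive M a)) (transpose-left a b))
    ... | d | other p q refl  = sym (transpose-other a b
              (λ e → q (trans (sym (involutive M x)) (cong (P $_) e))) (λ e → p (matching-injective M e)))

  transpose-conj : ∀ (π : Permutation′ m) a b x →
                   π ⟨$⟩ʳ (transpose a b ⟨$⟩ʳ x) ≡ transpose (π ⟨$⟩ʳ a) (π ⟨$⟩ʳ b) ⟨$⟩ʳ (π ⟨$⟩ʳ x)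
  transpose-conj π a b x with transpose a b ⟨$⟩ʳ x | transposed a b x
  ... | d | left refl refl  = sym (transpose-left (π ⟨$⟩ʳ a) (π ⟨$⟩ʳ b))
  ... | d | right refl refl = sym (transpose-right (π ⟨$⟩ʳ a) (π ⟨$⟩ʳ b))
  ... | d | other p q refl  = sym (transpose-other _ _ (p ∘ perm-injective π) (q ∘ perm-injective π))

  act-transpose-conj : ∀ (π : Permutation′ m) a b P →
                       act π (act (transpose a b) P) ≡ act (transpose (π ⟨$⟩ʳ a) (π ⟨$⟩ʳ b)) (act π P)
  act-transpose-conj π a b P =
    trans (act-∘ (transpose a b) π P)
      (trans (act-cong (transpose a b ∘ₚ π) (π ∘ₚ transpose (π ⟨$⟩ʳ a) (π ⟨$⟩ʳ b)) P (transpose-conj π a b))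
        (sym (act-∘ π (transpose (π ⟨$⟩ʳ a) (π ⟨$⟩ʳ b)) P)))

  ∑-act : ∀ (π : Permutation′ m) (f : Tab m → ℚ) → ∑ (mats m) (f ∘ act π) ≡ ∑ (mats m) f
  ∑-act π f = ∑-reindex (mats-unique m) (act π) (act (flip π))
    (λ i → ∈-mats (act-matching π (mats⇒matching i))) (λ i → ∈-mats (act-matching (flip π) (mats⇒matching i)))
    (λ {P} _ → act-flip π P) (λ {P} _ → act-flip′ π P) f

  abstract
    -- Induction over the list: if π sends `p a` to the wrong place, it is followed by the
    -- transposition of that place with `p′ a`. Injectivity of p and p′ keeps the images of earlier
    -- points away from both places unless the earlier point is a itself, where π was already right.
    extend : ∀ {A : Set} (p p′ : A → Fin m) → (∀ {x y} → p x ≡ p y → x ≡ y) → (∀ {x y} → p′ x ≡ p′ y → x ≡ y) →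
             ∀ xs → ∃[ π ] ∀ {x} → x ∈ xs → π ⟨$⟩ʳ p x ≡ p′ x
    extend p p′ inj inj′ []       = Perm.id , λ ()
    extend p p′ inj inj′ (a ∷ xs) with extend p p′ inj inj′ xs
    ... | π , h with π ⟨$⟩ʳ p a Finₚ.≟ p′ a
    ...   | yes e = π , λ where (here refl) → e
                                (there i)   → h i
    ...   | no  n = π ∘ₚ transpose (π ⟨$⟩ʳ p a) (p′ a) , λ where
      (here refl) → transpose-left (π ⟨$⟩ʳ p a) (p′ a)
      (there i)   → trans (cong (transpose (π ⟨$⟩ʳ p a) (p′ a) ⟨$⟩ʳ_) (h i))
        (transpose-other _ _
          (λ e → n (subst (λ y → π ⟨$⟩ʳ p y ≡ p′ y) (inj (perm-injective π (trans (h i) e))) (h i)))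
          (λ e → n (subst (λ y → π ⟨$⟩ʳ p y ≡ p′ y) (inj′ e) (h i))))

-- Cycle types

Loop : Set
Loop = (m : ℕ) (P Q : Tab m) (x : Fin m) → ℕ → ℕ → Fin m → ℕ

search : Loop
search m P Q x zero    t y = t
search m P Q x (suc f) t y = if y ==F x then t else search m P Q x f (suc t) (QP P Q $ y)

-- Induction on the fuel: the two equations determine the loop. `g` is a parameter so that the lemma
-- applies to a function known only through its equations.
search-unique : (g : Loop) → (∀ m P Q x t y → g m P Q x zero t y ≡ t) →
  (∀ m P Q x f t y → g m P Q x (suc f) t y ≡ (if y ==F x then t else g m P Q x f (suc t) (QP P Q $ y))) →
  ∀ m P Q x f t y → g m P Q x f t y ≡ search m P Q x f t y
search-unique g g0 g+ m P Q x zero    t y = g0 m P Q x t y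
search-unique g g0 g+ m P Q x (suc f) t y rewrite g+ m P Q x f t y with y ==F x
... | true  = refl
... | false = search-unique g g0 g+ m P Q x f (suc t) (QP P Q $ y)

-- The search loop of halfLen is local to its definition and cannot be named here.
-- Abstracting the size suc f of the vertex set separates it from the remaining
-- fuel f, after which unification identifies the loop with halfLenLoop.
mutual
  halfLenLoop : Loop
  halfLenLoop = _

  halfLen-search : ∀ f (P Q : Tab (suc f)) x → halfLen P Q x ≡ search (suc f) P Q x (suc f) 1 (QP P Q $ x)
  halfLen-search f P Q x with (QP P Q $ x) ==F x
  ... | true  = refl
  ... | false with QP P Q $ (QP P Q $ x) | 2
  ...   | y | t with suc f
  ...     | w = search-unique halfLenLoop (λ _ _ _ _ _ _ → refl) (λ _ _ _ _ _ _ _ → refl) w P Q x f t y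

module _ {m : ℕ} {f : Tab m} where

  iterT-+ : ∀ a b x → iterT (a + b) f x ≡ iterT a f (iterT b f x)
  iterT-+ zero    b x = refl
  iterT-+ (suc a) b x = cong (f $_) (iterT-+ a b x)

  iterT-comm : ∀ a b x → iterT a f (iterT b f x) ≡ iterT b f (iterT a f x)
  iterT-comm a b x = trans (sym (iterT-+ a b x)) (trans (cong (λ k → iterT k f x) (ℕₚ.+-comm a b)) (iterT-+ b a x))

  iterT-* : ∀ h x → iterT h f x ≡ x → ∀ k → iterT (k * h) f x ≡ x
  iterT-* h x e zero    = refl
  iterT-* h x e (suc k) = trans (iterT-+ h (k * h) x) (trans (cong (iterT h f) (iterT-* h x e k)) e)

  iterT-injective : (∀ {x y} → f $ x ≡ f $ y → x ≡ y) → ∀ t {x y} → iterT t f x ≡ iterT t f y → x ≡ y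
  iterT-injective inj zero    e = e
  iterT-injective inj (suc t) e = iterT-injective inj t (inj e)

  -- The search has reached time t with fuel k left. A known return time s with t ≤ s < t + k
  -- guarantees that it stops at a genuine return and never reports the value for exhausted fuel.
  search-spec : ∀ {P Q : Tab m} → QP P Q ≡ f → ∀ x k t s → t ≤ s → s < t + k → iterT s f x ≡ x →
    let h = search m P Q x k t (iterT t f x) in
    t ≤ h × h ≤ s × iterT h f x ≡ x × (∀ r → t ≤ r → r < h → iterT r f x ≢ x)
  search-spec e x zero t s t≤s s<t _ = ⊥-elim (ℕₚ.<-irrefl refl (ℕₚ.≤-<-trans t≤s (subst (s <_) (ℕₚ.+-identityʳ t) s<t)))
  search-spec {P} {Q} refl x (suc k) t s t≤s s<t+k ret with (iterT t f x ==F x) in eq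
  ... | true  = ℕₚ.≤-refl , t≤s , ==F⇒≡ eq , λ r t≤r r<t → ⊥-elim (ℕₚ.<⇒≱ r<t t≤r)
  ... | false with search-spec {P} {Q} refl x k (suc t) s
                     (ℕₚ.≤∧≢⇒< t≤s λ where refl → ==F⇒≢ eq ret) (subst (s <_) (ℕₚ.+-suc t k) s<t+k) ret
  ...   | a , b , c , d = ℕₚ.<⇒≤ a , b , c , least
    where
    least : ∀ r → t ≤ r → _ → iterT r f x ≢ x
    least r t≤r r<h with t Data.Nat.≟ r
    ... | yes refl = ==F⇒≢ eq
    ... | no  n    = d r (ℕₚ.≤∧≢⇒< t≤r n) r<h

  -- Among the m + 1 iterates at times 0, ..., m two coincide, and injectivity cancels their common
  -- initial stretch. The bound s ≤ m is what makes the fuel of `halfLen` sufficient.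
  return-time : (∀ {x y} → f $ x ≡ f $ y → x ≡ y) → ∀ x → ∃[ s ] 1 ≤ s × s ≤ m × iterT s f x ≡ x
  return-time inj x with pigeonhole (ℕₚ.n<1+n m) (λ (i : Fin (suc m)) → iterT (toℕ i) f x)
  ... | i , j , i<j , e = toℕ j ∸ toℕ i , ℕₚ.m<n⇒0<n∸m i<j
    , ℕₚ.≤-trans (ℕₚ.m∸n≤m (toℕ j) (toℕ i)) (s≤s⁻¹ (toℕ<n j))
    , iterT-injective inj (toℕ i) (trans (sym (iterT-+ (toℕ i) (toℕ j ∸ toℕ i) x))
        (trans (cong (λ k → iterT k f x) (ℕₚ.m+[n∸m]≡n (ℕₚ.<⇒≤ i<j))) (sym e)))

record Period {m} (f : Tab m) (x : Fin m) (h : ℕ) : Set where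
  field
    positive : 1 ≤ h
    returns  : iterT h f x ≡ x
    least    : ∀ r → 1 ≤ r → r < h → iterT r f x ≢ x

-- The least positive return time depends only on the set of return times, so half-lengths can be
-- compared between different points, matchings and vertex sets.
period-unique : ∀ {m m′} {f : Tab m} {g : Tab m′} {x y a b} → Period f x a → Period g y b →
                (∀ s → iterT s f x ≡ x → iterT s g y ≡ y) → (∀ s → iterT s g y ≡ y → iterT s f x ≡ x) → a ≡ b
period-unique {a = a} {b} p q fg gf = ℕₚ.≤-antisym
  (ℕₚ.≮⇒≥ λ b<a → Period.least p b (Period.positive q) b<a (gf b (Period.returns q)))
  (ℕₚ.≮⇒≥ λ a<b → Period.least q a (Period.positive p) a<b (fg a (Period.returns p)))

module Cycles {m : ℕ} {P Q : Tab m} (MP : Matching P) (MQ : Matching Q) where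

  f : Tab m
  f = QP P Q

  f-$ : ∀ x → f $ x ≡ Q $ (P $ x)
  f-$ = lookup∘tabulate _

  f-injective : ∀ {x y} → f $ x ≡ f $ y → x ≡ y
  f-injective {x} {y} e = matching-injective MP (matching-injective MQ (trans (sym (f-$ x)) (trans e (f-$ y))))

  halfLen-period×≤ : ∀ x → Period f x (halfLen P Q x) × halfLen P Q x ≤ m
  halfLen-period×≤ x with return-time f-injective x
  halfLen-period×≤ x | s , 1≤s , s≤m , e = go P Q refl x e s≤m
    where
    go : ∀ {k} (P Q : Tab k) {f} → QP P Q ≡ f → ∀ x → iterT s f x ≡ x → s ≤ k → Period f x (halfLen P Q x) × halfLen P Q x ≤ k
    go {suc k} P Q refl x e s≤k rewrite halfLen-search k P Q x with search-spec {P = P} {Q} refl x (suc k) 1 s 1≤s (s≤s s≤k) e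
    ... | a , b , c , d = record { positive = a ; returns = c ; least = d } , ℕₚ.≤-trans b s≤k

  halfLen-period : ∀ x → Period f x (halfLen P Q x)
  halfLen-period x = proj₁ (halfLen-period×≤ x)

  halfLen≤ : ∀ x → halfLen P Q x ≤ m
  halfLen≤ x = proj₂ (halfLen-period×≤ x)

  -- P and Q are involutions, so P conjugates f = QP to its inverse PQ; hence f^t P f^t = P.
  fPf : ∀ t x → iterT t f (P $ iterT t f x) ≡ P $ x
  fPf zero    x = refl
  fPf (suc t) x = begin
    iterT (suc t) f (P $ (f $ y)) ≡⟨ iterT-comm 1 t _ ⟩
    iterT t f (f $ (P $ (f $ y))) ≡⟨ cong (iterT t f) step ⟩
    iterT t f (P $ y) ≡⟨ fPf t x ⟩
    P $ x ∎
    where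
    open ≡-Reasoning
    y = iterT t f x
    step : f $ (P $ (f $ y)) ≡ P $ y
    step = trans (f-$ _) (trans (cong (Q $_) (trans (involutive MP _) (f-$ y))) (involutive MQ _))

  -- The orbit of x under the dihedral group generated by P and Q: its elements are the powers of QP
  -- and P times such powers. Non-negative exponents reach them all because QP has finite order.
  Cyc : Fin m → Fin m → Set
  Cyc x y = ∃[ t ] (iterT t f x ≡ y ⊎ P $ iterT t f x ≡ y)

  -- With period h + 1, going t h steps further completes t (h + 1) steps, which is t full turns.
  back : ∀ t x → ∃[ s ] iterT t f (iterT s f x) ≡ x
  back t x with halfLen P Q x | halfLen-period x
  ... | zero  | p = ⊥-elim (ℕₚ.n≮0 (Period.positive p))
  ... | suc h | p = t * h , trans (sym (iterT-+ t (t * h) x))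
    (trans (cong (λ k → iterT k f x) (sym (ℕₚ.*-suc t h))) (iterT-* (suc h) x (Period.returns p) t))

  Cyc-refl : ∀ {x} → Cyc x x
  Cyc-refl = 0 , inj₁ refl

  Cyc-sym : ∀ {x y} → Cyc x y → Cyc y x
  Cyc-sym {x} (t , inj₁ refl) with back t x
  ... | s , e = s , inj₁ (trans (iterT-comm s t x) e)
  Cyc-sym {x} (t , inj₂ refl) = t , inj₂ (trans (cong (P $_) (fPf t x)) (involutive MP x))

  Cyc-P : ∀ t w → ∃[ s ] iterT t f (P $ w) ≡ P $ iterT s f w
  Cyc-P t w with back t w
  ... | s , e = s , trans (cong (λ v → iterT t f (P $ v)) (sym e)) (fPf t _)

  Cyc-trans : ∀ {x y z} → Cyc x y → Cyc y z → Cyc x z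
  Cyc-trans {x} (t , inj₁ refl) (s , inj₁ refl) = s + t , inj₁ (iterT-+ s t x)
  Cyc-trans {x} (t , inj₁ refl) (s , inj₂ refl) = s + t , inj₂ (cong (P $_) (iterT-+ s t x))
  Cyc-trans {x} (t , inj₂ refl) (s , inj₁ refl) with Cyc-P s (iterT t f x)
  ... | u , e = u + t , inj₂ (trans (cong (P $_) (iterT-+ u t x)) (sym e))
  Cyc-trans {x} (t , inj₂ refl) (s , inj₂ refl) with Cyc-P s (iterT t f x)
  ... | u , e = u + t , inj₁ (trans (iterT-+ u t x) (trans (sym (involutive MP _)) (cong (P $_) (sym e))))

  sameCycle⁻ : ∀ x y → sameCycle P Q x y ≡ true → Cyc x y
  sameCycle⁻ x y e with or-map⁻ _ (upTo m) e
  ... | t , _ , r with ∨-true r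
  ...   | inj₁ q = t , inj₁ (==F⇒≡ q)
  ...   | inj₂ q = t , inj₂ (==F⇒≡ q)

  -- `sameCycle` tests only times below m. Since the period is at most m, reducing t modulo the
  -- period brings it into that range.
  sameCycle⁺ : ∀ x y → Cyc x y → sameCycle P Q x y ≡ true
  sameCycle⁺ x y (t , c) with halfLen P Q x | halfLen-period x | halfLen≤ x
  ... | zero  | p | _  = ⊥-elim (ℕₚ.n≮0 (Period.positive p))
  ... | suc h | p | h≤ = or-map⁺ _ (∈-upTo⁺ (ℕₚ.<-≤-trans (m%n<n t (suc h)) h≤)) (hit c)
    where
    u = t % suc h
    reduce : iterT u f x ≡ iterT t f x
    reduce = sym (trans (cong (λ k → iterT k f x) (m≡m%n+[m/n]*n t (suc h)))
      (trans (iterT-+ u (t / suc h * suc h) x) (cong (iterT u f) (iterT-* (suc h) x (Period.returns p) (t / suc h)))))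
    hit : iterT t f x ≡ y ⊎ P $ iterT t f x ≡ y → (iterT u f x ==F y) ∨ (P $ iterT u f x ==F y) ≡ true
    hit (inj₁ e) rewrite ≡⇒==F (trans reduce e) = refl
    hit (inj₂ e) rewrite ≡⇒==F (trans (cong (P $_) reduce) e) = ∨-zeroʳ _

  halfLen-f : ∀ x → halfLen P Q (f $ x) ≡ halfLen P Q x
  halfLen-f x = period-unique (halfLen-period (f $ x)) (halfLen-period x)
    (λ s e → f-injective (trans (iterT-comm 1 s x) e)) (λ s e → trans (iterT-comm s 1 x) (cong (f $_) e))

  halfLen-P : ∀ x → halfLen P Q (P $ x) ≡ halfLen P Q x
  halfLen-P x = period-unique (halfLen-period (P $ x)) (halfLen-period x)
    (λ s e → trans (cong (iterT s f) (sym (involutive MP x))) (trans (to s (P $ x) e) (involutive MP x))) (λ s e → to s x e)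
    where
    to : ∀ s z → iterT s f z ≡ z → iterT s f (P $ z) ≡ P $ z
    to s z e = trans (cong (λ v → iterT s f (P $ v)) (sym e)) (fPf s z)

  halfLen-Cyc : ∀ {x y} → Cyc x y → halfLen P Q y ≡ halfLen P Q x
  halfLen-Cyc {x} (t , c) = go c
    where
    it : ∀ t → halfLen P Q (iterT t f x) ≡ halfLen P Q x
    it zero    = refl
    it (suc t) = trans (halfLen-f _) (it t)
    go : ∀ {y} → iterT t f x ≡ y ⊎ P $ iterT t f x ≡ y → halfLen P Q y ≡ halfLen P Q x
    go (inj₁ refl) = it t
    go (inj₂ refl) = trans (halfLen-P _) (it t)

  isRep⁻ : ∀ {x y} → isRep P Q x ≡ true → Cyc x y → toℕ x ≤ toℕ y
  isRep⁻ {x} {y} e c with ∨-true (allB⁻ e y)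
  ... | inj₁ r = ⊥-elim (not-both (sameCycle⁺ x y c) (not-true r))
  ... | inj₂ r = ≤ᵇ⁻ r

  isRep⁺ : ∀ {x} → (∀ y → Cyc x y → toℕ x ≤ toℕ y) → isRep P Q x ≡ true
  isRep⁺ {x} h = allB⁺ go
    where
    go : ∀ y → not (sameCycle P Q x y) ∨ (toℕ x ≤ᵇ toℕ y) ≡ true
    go y with sameCycle P Q x y in e
    ... | true  = ≤ᵇ⁺ (h y (sameCycle⁻ x y e))
    ... | false = refl

  isRep-unique : ∀ {x y} → isRep P Q x ≡ true → isRep P Q y ≡ true → Cyc x y → x ≡ y
  isRep-unique rx ry c = toℕ-injective (ℕₚ.≤-antisym (isRep⁻ rx c) (isRep⁻ ry (Cyc-sym c)))

  findRep : ∀ z → ∃[ r ] Cyc z r × isRep P Q r ≡ true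
  findRep z with ¬∀⟶∃¬-smallest m (λ y → sameCycle P Q z y ≡ false) (λ y → sameCycle P Q z y Data.Bool.≟ false)
                   (λ h → not-both (sameCycle⁺ z z Cyc-refl) (h z))
  ... | r , ¬f , below = r , cyc , isRep⁺ λ y c → ℕₚ.≮⇒≥ λ y<r →
        not-both (sameCycle⁺ z y (Cyc-trans cyc c)) (subst (λ w → sameCycle P Q z w ≡ false) (toℕ-injective
          (trans (Finₚ.toℕ-inject (fromℕ< y<r)) (toℕ-fromℕ< y<r))) (below (fromℕ< y<r)))
    where
    cyc : Cyc z r
    cyc = sameCycle⁻ z r (¬-not ¬f)

  rep : Fin m → Fin m
  rep z = proj₁ (findRep z)

  reps : List (Fin m)
  reps = filterᵇ (isRep P Q) (allFin m)

  ∈-reps : ∀ {x} → isRep P Q x ≡ true → x ∈ reps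
  ∈-reps = ∈-filterᵇ⁺ (isRep P Q) (∈-allFin _)

  reps-isRep : ∀ {x} → x ∈ reps → isRep P Q x ≡ true
  reps-isRep i = proj₂ (∈-filterᵇ⁻ (isRep P Q) {xs = allFin m} i)

  1∈lengths⇒common-edge : 1 ∈ cycleHalfLengths P Q → ∃[ x ] Q $ x ≡ P $ x
  1∈lengths⇒common-edge i with ∈-map⁻ (halfLen P Q) i
  ... | x , _ , e with halfLen P Q x | halfLen-period x
  1∈lengths⇒common-edge i | x , _ , refl | _ | p = x , trans (cong (Q $_) (trans (sym (Period.returns p)) (f-$ x)))
    (involutive MQ _)

  common-edge⇒1∈lengths : ∀ x → Q $ x ≡ P $ x → 1 ∈ cycleHalfLengths P Q
  common-edge⇒1∈lengths x e with findRep x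
  ... | r , c , ir = subst (_∈ cycleHalfLengths P Q) (trans (halfLen-Cyc c) one) (∈-map⁺ (halfLen P Q) (∈-reps ir))
    where
    fixed : f $ x ≡ x
    fixed = trans (f-$ x) (trans (cong (Q $_) (sym e)) (involutive MQ x))
    one : halfLen P Q x ≡ 1
    one = ℕₚ.≤-antisym (ℕₚ.≮⇒≥ λ 1<h → Period.least (halfLen-period x) 1 (s≤s z≤n) 1<h fixed) (Period.positive (halfLen-period x))

module _ {m m′} {P Q : Tab m} {P′ Q′ : Tab m′} (MP : Matching P) (MQ : Matching Q) (MP′ : Matching P′) (MQ′ : Matching Q′) where

  private
    module C  = Cycles MP MQ
    module C′ = Cycles MP′ MQ′

  -- Representatives are the least vertices of their cycles and are not preserved by a relabelling.
  -- They are matched by applying φ and then passing to the representative of the cycle reached,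
  -- which does not change the half-length.
  cycleHalfLengths-↭ : (φ : Fin m → Fin m′) (ψ : Fin m′ → Fin m) →
    (∀ {x y} → C.Cyc x y → C′.Cyc (φ x) (φ y)) → (∀ {x y} → C′.Cyc x y → C.Cyc (ψ x) (ψ y)) →
    (∀ x → ψ (φ x) ≡ x) → (∀ x → φ (ψ x) ≡ x) → (∀ x → halfLen P′ Q′ (φ x) ≡ halfLen P Q x) →
    cycleHalfLengths P Q ↭ cycleHalfLengths P′ Q′
  cycleHalfLengths-↭ φ ψ φ-Cyc ψ-Cyc ψφ φψ h =
    subst (_↭ cycleHalfLengths P′ Q′) lengths (map⁺ (halfLen P′ Q′) bij)
    where
    bij : map (C′.rep ∘ φ) C.reps ↭ C′.reps
    bij = map-↭ (filterᵇ-unique _ (allFin⁺ m)) (filterᵇ-unique _ (allFin⁺ m′)) (C′.rep ∘ φ) (C.rep ∘ ψ)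
      (λ {x} _ → C′.∈-reps (proj₂ (proj₂ (C′.findRep (φ x))))) (λ {y} _ → C.∈-reps (proj₂ (proj₂ (C.findRep (ψ y)))))
      (λ {x} i → C.isRep-unique (proj₂ (proj₂ (C.findRep (ψ (C′.rep (φ x)))))) (C.reps-isRep i)
        (C.Cyc-sym (C.Cyc-trans (subst (λ z → C.Cyc z (ψ (C′.rep (φ x)))) (ψφ x) (ψ-Cyc (proj₁ (proj₂ (C′.findRep (φ x))))))
          (proj₁ (proj₂ (C.findRep (ψ (C′.rep (φ x)))))))))
      (λ {y} i → C′.isRep-unique (proj₂ (proj₂ (C′.findRep (φ (C.rep (ψ y)))))) (C′.reps-isRep i)
        (C′.Cyc-sym (C′.Cyc-trans (subst (λ z → C′.Cyc z (φ (C.rep (ψ y)))) (φψ y) (φ-Cyc (proj₁ (proj₂ (C.findRep (ψ y))))))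
          (proj₁ (proj₂ (C′.findRep (φ (C.rep (ψ y)))))))))
    lengths : map (halfLen P′ Q′) (map (C′.rep ∘ φ) C.reps) ≡ cycleHalfLengths P Q
    lengths = trans (sym (Listₚ.map-∘ C.reps)) (Listₚ.map-cong (λ x →
      trans (C′.halfLen-Cyc (proj₁ (proj₂ (C′.findRep (φ x))))) (h x)) C.reps)

-- Commuting insertions make `sortD` a function of the multiset, so that `related` can be handled
-- through permutations of lists.
insertD-comm : ∀ a b xs → insertD a (insertD b xs) ≡ insertD b (insertD a xs)
insertD-comm a b [] with b ≤ᵇ a in p | a ≤ᵇ b in q
... | true  | true  rewrite ℕₚ.≤-antisym (≤ᵇ⁻ {a} q) (≤ᵇ⁻ {b} p) = refl
... | true  | false = refl
... | false | true  = refl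
... | false | false = ⊥-elim ([ (λ l → not-both (≤ᵇ⁺ l) q) , (λ l → not-both (≤ᵇ⁺ l) p) ]′ (ℕₚ.≤-total a b))
insertD-comm a b (c ∷ xs) with c ≤ᵇ b in cb | c ≤ᵇ a in ca
insertD-comm a b (c ∷ xs) | true | true with b ≤ᵇ a in p | a ≤ᵇ b in q
... | true  | true  rewrite ℕₚ.≤-antisym (≤ᵇ⁻ {a} q) (≤ᵇ⁻ {b} p) = refl
... | true  | false rewrite cb = refl
... | false | true  rewrite ca = refl
... | false | false = ⊥-elim ([ (λ l → not-both (≤ᵇ⁺ l) q) , (λ l → not-both (≤ᵇ⁺ l) p) ]′ (ℕₚ.≤-total a b))
insertD-comm a b (c ∷ xs) | true | false with b ≤ᵇ a in p
... | true  = ⊥-elim (not-both (≤ᵇ⁺ (ℕₚ.≤-trans (≤ᵇ⁻ {c} cb) (≤ᵇ⁻ {b} p))) ca)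
... | false rewrite ca | cb = refl
insertD-comm a b (c ∷ xs) | false | true with a ≤ᵇ b in p
... | true  = ⊥-elim (not-both (≤ᵇ⁺ (ℕₚ.≤-trans (≤ᵇ⁻ {c} ca) (≤ᵇ⁻ {a} p))) cb)
... | false rewrite ca | cb = refl
insertD-comm a b (c ∷ xs) | false | false rewrite ca | cb = cong (c ∷_) (insertD-comm a b xs)

insertD-↭ : ∀ a xs → insertD a xs ↭ a ∷ xs
insertD-↭ a []       = ↭-refl
insertD-↭ a (b ∷ xs) with b ≤ᵇ a
... | true  = ↭-refl
... | false = ↭-trans (prep b (insertD-↭ a xs)) (swap b a ↭-refl)

sortD-↭ : ∀ xs → sortD xs ↭ xs
sortD-↭ []       = ↭-refl
sortD-↭ (x ∷ xs) = ↭-trans (insertD-↭ x (sortD xs)) (prep x (sortD-↭ xs))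

sortD-cong : ∀ {xs ys} → xs ↭ ys → sortD xs ≡ sortD ys
sortD-cong ↭.refl             = refl
sortD-cong (prep x p)         = cong (insertD x) (sortD-cong p)
sortD-cong (swap {xs} x y p)  = trans (insertD-comm x y (sortD xs)) (cong (λ zs → insertD y (insertD x zs)) (sortD-cong p))
sortD-cong (↭.trans p q)      = trans (sortD-cong p) (sortD-cong q)

related⁻ : ∀ {m} μ (P Q : Tab m) → related μ P Q ≡ true → cycleHalfLengths P Q ↭ μ
related⁻ μ P Q e with Listₚ.≡-dec Data.Nat._≟_ (sortD (cycleHalfLengths P Q)) (sortD μ)
... | yes p = ↭-trans (↭-sym (sortD-↭ _)) (subst (_↭ μ) (sym p) (sortD-↭ μ))

related⁺ : ∀ {m} μ (P Q : Tab m) → cycleHalfLengths P Q ≡ μ → related μ P Q ≡ true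
related⁺ μ P Q e = dec-true (Listₚ.≡-dec Data.Nat._≟_ (sortD (cycleHalfLengths P Q)) (sortD μ)) (cong sortD e)

module _ {m : ℕ} (π : Permutation′ m) {P Q : Tab m} (MP : Matching P) (MQ : Matching Q) where

  private
    module C  = Cycles MP MQ
    module C′ = Cycles (act-matching π MP) (act-matching π MQ)

  iterT-act : ∀ t x → iterT t C′.f (π ⟨$⟩ʳ x) ≡ π ⟨$⟩ʳ iterT t C.f x
  iterT-act zero    x = refl
  iterT-act (suc t) x = begin
    C′.f $ iterT t C′.f (π ⟨$⟩ʳ x) ≡⟨ cong (C′.f $_) (iterT-act t x) ⟩
    C′.f $ (π ⟨$⟩ʳ y) ≡⟨ C′.f-$ _ ⟩
    act π Q $ (act π P $ (π ⟨$⟩ʳ y)) ≡⟨ cong (act π Q $_) (act-$-ʳ π P y) ⟩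
    act π Q $ (π ⟨$⟩ʳ (P $ y)) ≡⟨ act-$-ʳ π Q _ ⟩
    π ⟨$⟩ʳ (Q $ (P $ y)) ≡⟨ cong (π ⟨$⟩ʳ_) (C.f-$ y) ⟨
    π ⟨$⟩ʳ (C.f $ y) ∎
    where
    open ≡-Reasoning
    y = iterT t C.f x

  Cyc-act : ∀ {x y} → C.Cyc x y → C′.Cyc (π ⟨$⟩ʳ x) (π ⟨$⟩ʳ y)
  Cyc-act {x} (t , inj₁ refl) = t , inj₁ (iterT-act t x)
  Cyc-act {x} (t , inj₂ refl) = t , inj₂ (trans (cong (act π P $_) (iterT-act t x)) (act-$-ʳ π P _))

  Cyc-act⁻ : ∀ {x y} → C′.Cyc x y → C.Cyc (π ⟨$⟩ˡ x) (π ⟨$⟩ˡ y)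
  Cyc-act⁻ {x} (t , c) = t , go c
    where
    e : iterT t C′.f x ≡ π ⟨$⟩ʳ iterT t C.f (π ⟨$⟩ˡ x)
    e = trans (cong (iterT t C′.f) (sym (inverseʳ π))) (iterT-act t _)
    go : ∀ {y} → iterT t C′.f x ≡ y ⊎ act π P $ iterT t C′.f x ≡ y →
         iterT t C.f (π ⟨$⟩ˡ x) ≡ π ⟨$⟩ˡ y ⊎ P $ iterT t C.f (π ⟨$⟩ˡ x) ≡ π ⟨$⟩ˡ y
    go (inj₁ refl) = inj₁ (sym (trans (cong (π ⟨$⟩ˡ_) e) (inverseˡ π)))
    go (inj₂ refl) = inj₂ (sym (trans (cong (λ z → π ⟨$⟩ˡ (act π P $ z)) e) (trans (cong (π ⟨$⟩ˡ_) (act-$-ʳ π P _)) (inverseˡ π))))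

  halfLen-act : ∀ x → halfLen (act π P) (act π Q) (π ⟨$⟩ʳ x) ≡ halfLen P Q x
  halfLen-act x = period-unique (C′.halfLen-period (π ⟨$⟩ʳ x)) (C.halfLen-period x)
    (λ s e → perm-injective π (trans (sym (iterT-act s x)) e)) (λ s e → trans (iterT-act s x) (cong (π ⟨$⟩ʳ_) e))

  -- The spectral modules below work with an abstract `rel` having this invariance; the shape of μ
  -- re-enters only through `CommonEdges` and the count of related pairs.
  related-act : ∀ μ → related μ (act π P) (act π Q) ≡ related μ P Q
  related-act μ = cong (λ xs → does (Listₚ.≡-dec Data.Nat._≟_ xs (sortD μ))) (sym (sortD-cong
    (cycleHalfLengths-↭ MP MQ (act-matching π MP) (act-matching π MQ) (π ⟨$⟩ʳ_) (π ⟨$⟩ˡ_) Cyc-act Cyc-act⁻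
      (λ _ → inverseˡ π) (λ _ → inverseʳ π) halfLen-act)))

-- The sign of a permutation

⊕Σ : ∀ {m} → (Fin m → Bool) → Bool
⊕Σ = ⊕.sum

⊕Σ-false : ∀ {m} {f : Fin m → Bool} → (∀ x → f x ≡ false) → ⊕Σ f ≡ false
⊕Σ-false {zero}  e = refl
⊕Σ-false {suc m} e rewrite e zero = ⊕Σ-false (e ∘ suc)

⊕Σ²-cong : ∀ {m} {f g : Fin m → Fin m → Bool} → (∀ x y → f x y ≡ g x y) → ⊕Σ (λ x → ⊕Σ (f x)) ≡ ⊕Σ (λ x → ⊕Σ (g x))
⊕Σ²-cong e = ⊕.sum-cong-≗ (λ x → ⊕.sum-cong-≗ (e x))

⊕Σ²-+ : ∀ {m} (f g : Fin m → Fin m → Bool) →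
        ⊕Σ (λ x → ⊕Σ (λ y → f x y xor g x y)) ≡ ⊕Σ (λ x → ⊕Σ (f x)) xor ⊕Σ (λ x → ⊕Σ (g x))
⊕Σ²-+ f g = trans (⊕.sum-cong-≗ (λ x → ⊕.∑-distrib-+ (f x) (g x))) (⊕.∑-distrib-+ (λ x → ⊕Σ (f x)) (λ x → ⊕Σ (g x)))

odd : ℕ → Bool
odd n = not (even n)

odd-suc : ∀ n → odd (suc n) ≡ not (odd n)
odd-suc zero          = refl
odd-suc (suc zero)    = refl
odd-suc (suc (suc n)) = odd-suc n

xor-notˡ : ∀ a b → not a xor b ≡ not (a xor b)
xor-notˡ true  b = sym (not-involutive b)
xor-notˡ false b = refl

odd-+ : ∀ a b → odd (a + b) ≡ odd a xor odd b
odd-+ zero    b = refl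
odd-+ (suc a) b = begin
  odd (suc (a + b)) ≡⟨ odd-suc (a + b) ⟩
  not (odd (a + b)) ≡⟨ cong not (odd-+ a b) ⟩
  not (odd a xor odd b) ≡⟨ xor-notˡ (odd a) (odd b) ⟨
  not (odd a) xor odd b ≡⟨ cong (_xor odd b) (odd-suc a) ⟨
  odd (suc a) xor odd b ∎
  where open ≡-Reasoning

odd-sum : ∀ {A : Set} {k} (g : A → ℕ) (h : Fin k → A) → odd (sum (map g (Data.List.tabulate h))) ≡ ⊕Σ (λ i → odd (g (h i)))
odd-sum {k = zero}  g h = refl
odd-sum {k = suc k} g h = trans (odd-+ (g (h zero)) _) (cong (odd (g (h zero)) xor_) (odd-sum g (h ∘ suc)))

odd-filter : ∀ {A : Set} {k} (p : A → Bool) (h : Fin k → A) → odd (length (filterᵇ p (Data.List.tabulate h))) ≡ ⊕Σ (p ∘ h)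
odd-filter {k = zero}  p h = refl
odd-filter {k = suc k} p h with p (h zero)
... | true  = trans (odd-suc (length (filterᵇ p (Data.List.tabulate (h ∘ suc))))) (cong not (odd-filter p (h ∘ suc)))
... | false = odd-filter p (h ∘ suc)

lt : ∀ {m} → Fin m → Fin m → Bool
lt x y = toℕ x <ᵇ toℕ y

parity : ∀ {m} → (Fin m → Fin m) → Bool
parity f = ⊕Σ (λ x → ⊕Σ (λ y → lt x y ∧ lt (f y) (f x)))

odd-inversions : ∀ {m} (f : Tab m) → odd (inversions f) ≡ parity (f $_)
odd-inversions {m} f = trans (odd-sum (λ i → length (filterᵇ (b i) (allFin m))) (λ i → i)) (⊕.sum-cong-≗ {m} (λ i → odd-filter (b i) (λ j → j)))
  where
  b : Fin m → Fin m → Bool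
  b i j = lt i j ∧ lt (f $ j) (f $ i)

<ᵇ-irrefl : ∀ n → (n <ᵇ n) ≡ false
<ᵇ-irrefl zero    = refl
<ᵇ-irrefl (suc n) = <ᵇ-irrefl n

<ᵇ-flip : ∀ {a b} → a ≢ b → (b <ᵇ a) ≡ not (a <ᵇ b)
<ᵇ-flip {zero}  {zero}  n = ⊥-elim (n refl)
<ᵇ-flip {zero}  {suc b} n = refl
<ᵇ-flip {suc a} {zero}  n = refl
<ᵇ-flip {suc a} {suc b} n = <ᵇ-flip (n ∘ cong suc)

lt-irrefl : ∀ {m} (x : Fin m) → lt x x ≡ false
lt-irrefl x = <ᵇ-irrefl (toℕ x)

lt-flip : ∀ {m} {x y : Fin m} → x ≢ y → lt y x ≡ not (lt x y)
lt-flip n = <ᵇ-flip (n ∘ toℕ-injective)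

-- The terms at (x, y) and (y, x) are collected at the one of the two pairs that is increasing; the
-- diagonal contributes nothing.
⊕Σ-ordered : ∀ {m} (h : Fin m → Fin m → Bool) → (∀ x → h x x ≡ false) →
             ⊕Σ (λ x → ⊕Σ (h x)) ≡ ⊕Σ (λ x → ⊕Σ (λ y → lt x y ∧ (h x y xor h y x)))
⊕Σ-ordered {m} h diag = begin
  ⊕Σ (λ x → ⊕Σ (h x)) ≡⟨ ⊕Σ²-cong split ⟩
  ⊕Σ (λ x → ⊕Σ (λ y → (lt x y ∧ h x y) xor (lt y x ∧ h x y))) ≡⟨ ⊕Σ²-+ (λ x y → lt x y ∧ h x y) (λ x y → lt y x ∧ h x y) ⟩
  A xor ⊕Σ (λ x → ⊕Σ (λ y → lt y x ∧ h x y)) ≡⟨ cong (A xor_) (⊕.∑-comm (λ x y → lt y x ∧ h x y)) ⟩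
  A xor ⊕Σ (λ x → ⊕Σ (λ y → lt x y ∧ h y x)) ≡⟨ ⊕Σ²-+ (λ x y → lt x y ∧ h x y) (λ x y → lt x y ∧ h y x) ⟨
  ⊕Σ (λ x → ⊕Σ (λ y → (lt x y ∧ h x y) xor (lt x y ∧ h y x))) ≡⟨ ⊕Σ²-cong {m} (λ x y → distrib (lt x y) {h x y} {h y x}) ⟩
  ⊕Σ (λ x → ⊕Σ (λ y → lt x y ∧ (h x y xor h y x))) ∎
  where
  open ≡-Reasoning
  A = ⊕Σ (λ x → ⊕Σ (λ y → lt x y ∧ h x y))
  distrib : ∀ a {b c} → (a ∧ b) xor (a ∧ c) ≡ a ∧ (b xor c)
  distrib true  = refl
  distrib false = refl
  split : ∀ x y → h x y ≡ (lt x y ∧ h x y) xor (lt y x ∧ h x y)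
  split x y with x Finₚ.≟ y
  ... | yes refl rewrite diag x | lt-irrefl x = refl
  ... | no  n rewrite lt-flip n with lt x y | h x y
  ...   | true  | true  = refl
  ...   | true  | false = refl
  ...   | false | true  = refl
  ...   | false | false = refl

-- The pairs x, y whose relative order is changed by π contribute c x y, which is symmetric
-- in x and y, while e x y ⊕ e y x = true; hence the sum does not depend on f.
module _ {m : ℕ} (f : Fin m → Fin m) (inj : ∀ {x y} → f x ≡ f y → x ≡ y) (π : Permutation′ m) where

  private
    e c : Fin m → Fin m → Bool
    e x y = lt (f y) (f x)
    c x y = lt x y xor lt (π ⟨$⟩ˡ x) (π ⟨$⟩ˡ y)

  parity-∘ˡ : parity f xor parity (f ∘ (π ⟨$⟩ʳ_)) ≡ parity (π ⟨$⟩ˡ_)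
  parity-∘ˡ = begin
    parity f xor parity (f ∘ (π ⟨$⟩ʳ_)) ≡⟨ cong (parity f xor_) (sym moved) ⟩
    parity f xor ⊕Σ (λ x → ⊕Σ (g x)) ≡⟨ ⊕Σ²-+ (λ x y → lt x y ∧ e x y) g ⟨
    ⊕Σ (λ x → ⊕Σ (λ y → (lt x y ∧ e x y) xor g x y)) ≡⟨ ⊕Σ²-cong {m} (λ x y → distrib (lt x y) {lt (π ⟨$⟩ˡ x) (π ⟨$⟩ˡ y)} {e x y}) ⟩
    ⊕Σ (λ x → ⊕Σ (λ y → c x y ∧ e x y)) ≡⟨ ⊕Σ-ordered (λ x y → c x y ∧ e x y) diag ⟩
    ⊕Σ (λ x → ⊕Σ (λ y → lt x y ∧ ((c x y ∧ e x y) xor (c y x ∧ e y x)))) ≡⟨ ⊕Σ²-cong pairs ⟩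
    parity (π ⟨$⟩ˡ_) ∎
    where
    open ≡-Reasoning
    g : Fin m → Fin m → Bool
    g x y = lt (π ⟨$⟩ˡ x) (π ⟨$⟩ˡ y) ∧ e x y
    moved : ⊕Σ (λ x → ⊕Σ (g x)) ≡ parity (f ∘ (π ⟨$⟩ʳ_))
    moved = trans (⊕.sum-permute (λ x → ⊕Σ (g x)) π)
      (⊕.sum-cong-≗ {m} λ x → trans (⊕.sum-permute (g (π ⟨$⟩ʳ x)) π)
        (⊕.sum-cong-≗ {m} λ y → cong₂ (λ a b → lt a b ∧ e (π ⟨$⟩ʳ x) (π ⟨$⟩ʳ y)) (inverseˡ π) (inverseˡ π)))
    distrib : ∀ a {b d} → (a ∧ d) xor (b ∧ d) ≡ (a xor b) ∧ d
    distrib true  {true}  {true}  = refl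
    distrib true  {true}  {false} = refl
    distrib true  {false} {true}  = refl
    distrib true  {false} {false} = refl
    distrib false = refl
    diag : ∀ x → c x x ∧ e x x ≡ false
    diag x rewrite lt-irrefl (f x) = ∧-zeroʳ (c x x)
    pairs : ∀ x y → lt x y ∧ ((c x y ∧ e x y) xor (c y x ∧ e y x)) ≡ lt x y ∧ lt (π ⟨$⟩ˡ y) (π ⟨$⟩ˡ x)
    pairs x y with x Finₚ.≟ y
    ... | yes refl rewrite lt-irrefl x = refl
    ... | no  n rewrite lt-flip n | lt-flip (n ∘ inj) | lt-flip {x = π ⟨$⟩ˡ x} (n ∘ perm-injective (flip π))
      with lt x y | lt (π ⟨$⟩ˡ x) (π ⟨$⟩ˡ y) | lt (f x) (f y)
    ...   | true  | true  | _     = refl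
    ...   | true  | false | true  = refl
    ...   | true  | false | false = refl
    ...   | false | _     | _     = refl

lt-asym : ∀ {m} (x y : Fin m) → lt x y ∧ lt y x ≡ false
lt-asym x y with x Finₚ.≟ y
... | yes refl rewrite lt-irrefl x = refl
... | no  n rewrite lt-flip n with lt x y
...   | true  = refl
...   | false = refl

parity-id : ∀ {m} → parity {m} (λ x → x) ≡ false
parity-id {m} = ⊕Σ-false {m} λ x → ⊕Σ-false (lt-asym x)

-- `parity-∘ˡ` involves the parity of the inverse of π. Its case f = id shows that π and its inverse
-- have equal parity, which turns it into multiplicativity of the sign.
parity-∘ : ∀ {m} (f : Fin m → Fin m) → (∀ {x y} → f x ≡ f y → x ≡ y) → (π : Permutation′ m) →
           parity (f ∘ (π ⟨$⟩ʳ_)) ≡ parity f xor parity (π ⟨$⟩ʳ_)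
parity-∘ {m} f inj π = cancel {parity f} (trans (parity-∘ˡ f inj π) (sym symmetric))
  where
  symmetric : parity (π ⟨$⟩ʳ_) ≡ parity (π ⟨$⟩ˡ_)
  symmetric = trans (cong (_xor parity (π ⟨$⟩ʳ_)) (sym (parity-id {m}))) (parity-∘ˡ (λ x → x) (λ e → e) π)
  cancel : ∀ {a b c} → a xor b ≡ c → b ≡ a xor c
  cancel {true}  {b} refl = sym (not-involutive b)
  cancel {false} refl = refl

parity-cong : ∀ {m} {f g : Fin m → Fin m} → (∀ x → f x ≡ g x) → parity f ≡ parity g
parity-cong e = ⊕Σ²-cong λ x y → cong₂ (λ a b → lt x y ∧ lt a b) (e y) (e x)

parity-swap01 : ∀ m → parity (transpose {suc (suc m)} zero (suc zero) ⟨$⟩ʳ_) ≡ true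
parity-swap01 m rewrite ⊕Σ-false {m} {λ _ → false} (λ _ → refl)
  | ⊕Σ-false {m} {λ x → ⊕Σ {m} (λ y → lt x y ∧ lt y x)} (λ x → ⊕Σ-false (lt-asym x)) = refl

pair : ∀ {A : Set} → A → A → Bool → A
pair a b false = a
pair a b true  = b

pair-injective : ∀ {A : Set} {a b : A} → a ≢ b → ∀ {x y} → pair a b x ≡ pair a b y → x ≡ y
pair-injective n {false} {false} _ = refl
pair-injective n {false} {true}  e = ⊥-elim (n e)
pair-injective n {true}  {false} e = ⊥-elim (n (sym e))
pair-injective n {true}  {true}  _ = refl

-- (a b) is conjugate to (0 1) by a permutation g taking 0, 1 to a, b, and the two copies of the
-- parity of g cancel. Only (0 1) is computed directly.
parity-transpose : ∀ {m} (a b : Fin m) → a ≢ b → parity (transpose a b ⟨$⟩ʳ_) ≡ true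
parity-transpose {suc zero} zero zero n = ⊥-elim (n refl)
parity-transpose {suc (suc m)} a b n with extend (pair zero (suc zero)) (pair a b) (pair-injective λ ()) (pair-injective n) (false ∷ true ∷ [])
... | g , h = begin
    parity (transpose a b ⟨$⟩ʳ_) ≡⟨ cancel (sym (parity-∘ _ (perm-injective (transpose a b)) g)) ⟩
    parity ((transpose a b ⟨$⟩ʳ_) ∘ (g ⟨$⟩ʳ_)) xor parity (g ⟨$⟩ʳ_) ≡⟨ cong (_xor parity (g ⟨$⟩ʳ_)) (parity-cong conj) ⟩
    parity ((g ⟨$⟩ʳ_) ∘ (s ⟨$⟩ʳ_)) xor parity (g ⟨$⟩ʳ_) ≡⟨ cong (_xor parity (g ⟨$⟩ʳ_)) (parity-∘ _ (perm-injective g) s) ⟩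
    (parity (g ⟨$⟩ʳ_) xor parity (s ⟨$⟩ʳ_)) xor parity (g ⟨$⟩ʳ_) ≡⟨ cong (λ z → (parity (g ⟨$⟩ʳ_) xor z) xor parity (g ⟨$⟩ʳ_)) (parity-swap01 m) ⟩
    (parity (g ⟨$⟩ʳ_) xor true) xor parity (g ⟨$⟩ʳ_) ≡⟨ three (parity (g ⟨$⟩ʳ_)) ⟩
    true ∎
  where
  open ≡-Reasoning
  s = transpose {suc (suc m)} zero (suc zero)
  conj : ∀ x → transpose a b ⟨$⟩ʳ (g ⟨$⟩ʳ x) ≡ g ⟨$⟩ʳ (s ⟨$⟩ʳ x)
  conj x = sym (trans (transpose-conj g zero (suc zero) x)
    (cong₂ (λ u v → transpose u v ⟨$⟩ʳ (g ⟨$⟩ʳ x)) (h {false} (here refl)) (h {true} (there (here refl)))))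
  cancel : ∀ {a b c} → a xor b ≡ c → a ≡ c xor b
  cancel {true}  {true}  refl = refl
  cancel {true}  {false} refl = refl
  cancel {false} {true}  refl = refl
  cancel {false} {false} refl = refl
  three : ∀ a → (a xor true) xor a ≡ true
  three true  = refl
  three false = refl

∘T-$ : ∀ {m} (g h : Tab m) x → (g ∘T h) $ x ≡ g $ (h $ x)
∘T-$ g h = lookup∘tabulate _

sgn-transpose : ∀ {m} (β : Tab m) → isPerm β ≡ true → ∀ a b → a ≢ b → sgn (β ∘T tabOf (transpose a b)) ≡ - sgn β
sgn-transpose {m} β e a b n = go (trans (cong not flipped) (not-involutive _))
  where
  τ = transpose a b
  flipped : odd (inversions (β ∘T tabOf τ)) ≡ not (odd (inversions β))
  flipped = begin
    odd (inversions (β ∘T tabOf τ)) ≡⟨ odd-inversions (β ∘T tabOf τ) ⟩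
    parity ((β ∘T tabOf τ) $_) ≡⟨ parity-cong (λ x → trans (∘T-$ β (tabOf τ) x) (cong (β $_) (tabOf-$ τ x))) ⟩
    parity ((β $_) ∘ (τ ⟨$⟩ʳ_)) ≡⟨ parity-∘ (β $_) (isPerm⁻ β e) τ ⟩
    parity (β $_) xor parity (τ ⟨$⟩ʳ_) ≡⟨ cong₂ _xor_ (sym (odd-inversions β)) (parity-transpose a b n) ⟩
    odd (inversions β) xor true ≡⟨ xor-true (odd (inversions β)) ⟩
    not (odd (inversions β)) ∎
    where
    open ≡-Reasoning
    xor-true : ∀ a → a xor true ≡ not a
    xor-true true  = refl
    xor-true false = refl
  go : ∀ {x y} → not (not x) ≡ not y → (if x then 1ℚ else - 1ℚ) ≡ - (if y then 1ℚ else - 1ℚ)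
  go {true}  {false} _ = refl
  go {false} {true}  _ = refl

-- Eigenfunctions and Bessel's inequality

0≤x² : ∀ x → 0ℚ ≤ℚ x *ℚ x
0≤x² x with ℚₚ.≤-total 0ℚ x
... | inj₁ p = subst (_≤ℚ x *ℚ x) (ℚₚ.*-zeroˡ x) (ℚₚ.*-monoʳ-≤-nonNeg x {{ℚ.nonNegative p}} p)
... | inj₂ p = subst (_≤ℚ x *ℚ x) (ℚₚ.*-zeroˡ x) (ℚₚ.*-monoʳ-≤-nonPos x {{ℚ.nonPositive p}} p)

x≡-x⇒x≡0 : ∀ x → x ≡ - x → x ≡ 0ℚ
x≡-x⇒x≡0 x e = trans (solve 1 (λ a → a := con ℚ.½ :* (a :+ a)) refl x)
  (trans (cong (λ y → ℚ.½ *ℚ (x +ℚ y)) e) (trans (cong (ℚ.½ *ℚ_) (ℚₚ.+-inverseʳ x)) (ℚₚ.*-zeroʳ ℚ.½)))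

∑-≥term : ∀ {A : Set} {f : A → ℚ} {x xs} → (∀ x → 0ℚ ≤ℚ f x) → x ∈ xs → f x ≤ℚ ∑ xs f
∑-≥term {f = f} {x} {.x ∷ xs} pos (here refl) =
  subst (_≤ℚ f x +ℚ ∑ xs f) (ℚₚ.+-identityʳ (f x)) (ℚₚ.+-monoʳ-≤ (f x) (subst (_≤ℚ ∑ xs f) (∑-0 xs) (∑-mono-≤ xs (λ {y} _ → pos y))))
∑-≥term {f = f} {x} {y ∷ xs} pos (there i) =
  subst (_≤ℚ f y +ℚ ∑ xs f) (ℚₚ.+-identityˡ (f x)) (ℚₚ.+-mono-≤ (pos y) (∑-≥term pos i))

indic-idem : ∀ b → indic b *ℚ indic b ≡ indic b
indic-idem true  = refl
indic-idem false = refl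

module _ {m : ℕ} where

  infix 5 ⟪_,_⟫

  ⟪_,_⟫ : (Tab m → ℚ) → (Tab m → ℚ) → ℚ
  ⟪ f , g ⟫ = ∑ (mats m) (λ P → f P *ℚ g P)

  ⟪⟫-comm : ∀ f g → ⟪ f , g ⟫ ≡ ⟪ g , f ⟫
  ⟪⟫-comm f g = ∑-cong (mats m) (λ {P} _ → ℚₚ.*-comm (f P) (g P))

  ⟪⟫-linear : ∀ f c y g → ⟪ (λ P → f P +ℚ c *ℚ y P) , g ⟫ ≡ ⟪ f , g ⟫ +ℚ c *ℚ ⟪ y , g ⟫
  ⟪⟫-linear f c y g = trans
    (∑-cong (mats m) (λ {P} _ → solve 4 (λ a c b d → (a :+ c :* b) :* d := a :* d :+ c :* (b :* d)) refl (f P) c (y P) (g P)))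
    (trans (∑-+ (λ P → f P *ℚ g P) (λ P → c *ℚ (y P *ℚ g P)) (mats m)) (cong (⟪ f , g ⟫ +ℚ_) (∑-* c (λ P → y P *ℚ g P) (mats m))))

  0≤⟪⟫ : ∀ f → 0ℚ ≤ℚ ⟪ f , f ⟫
  0≤⟪⟫ f = subst (_≤ℚ ⟪ f , f ⟫) (∑-0 (mats m)) (∑-mono-≤ (mats m) (λ {P} _ → 0≤x² (f P)))

  ⟪⟫≢0 : ∀ {f Q} → Matching Q → f Q ≢ 0ℚ → ⟪ f , f ⟫ ≢ 0ℚ
  ⟪⟫≢0 {f} {Q} MQ n e = n (square-zero (f Q) (ℚₚ.≤-antisym
    (subst (f Q *ℚ f Q ≤ℚ_) e (∑-≥term {f = λ P → f P *ℚ f P} (λ P → 0≤x² (f P)) (∈-mats MQ))) (0≤x² (f Q))))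
    where
    square-zero : ∀ x → x *ℚ x ≡ 0ℚ → x ≡ 0ℚ
    square-zero x e with x ℚₚ.≟ 0ℚ
    ... | yes p = p
    ... | no p = *-cancel-zero x p e

  -- Induction on L: f is replaced by f minus its projection onto `y s`, which by orthogonality has
  -- the same inner products with the remaining members. The reciprocal squared norms `t s` take the
  -- place of a normalization, which would need square roots.
  bessel : ∀ {S : Set} (y : S → Tab m → ℚ) (t : S → ℚ) L → AllPairs (λ s s′ → ⟪ y s , y s′ ⟫ ≡ 0ℚ) L →
           (∀ s → t s *ℚ ⟪ y s , y s ⟫ ≡ 1ℚ) → ∀ f → ∑ L (λ s → t s *ℚ (⟪ f , y s ⟫ *ℚ ⟪ f , y s ⟫)) ≤ℚ ⟪ f , f ⟫
  bessel y t []      []       norm f = 0≤⟪⟫ f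
  bessel y t (s ∷ L) (o ∷ os) norm f = subst (∑ (s ∷ L) (λ s → t s *ℚ (⟪ f , y s ⟫ *ℚ ⟪ f , y s ⟫)) ≤ℚ_) totals
    (ℚₚ.+-monoʳ-≤ (t s *ℚ (F *ℚ F)) (subst (_≤ℚ ⟪ f′ , f′ ⟫) same (bessel y t L os norm f′)))
    where
    F c : ℚ
    F = ⟪ f , y s ⟫
    c = - (t s *ℚ F)
    f′ : Tab m → ℚ
    f′ P = f P +ℚ c *ℚ y s P
    coeff : ∀ {s′} → s′ ∈ L → ⟪ f′ , y s′ ⟫ ≡ ⟪ f , y s′ ⟫
    coeff {s′} i = trans (⟪⟫-linear f c (y s) (y s′)) (trans (cong (λ z → ⟪ f , y s′ ⟫ +ℚ c *ℚ z) (All.lookup o i))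
      (trans (cong (⟪ f , y s′ ⟫ +ℚ_) (ℚₚ.*-zeroʳ c)) (ℚₚ.+-identityʳ _)))
    same : ∑ L (λ s → t s *ℚ (⟪ f′ , y s ⟫ *ℚ ⟪ f′ , y s ⟫)) ≡ ∑ L (λ s → t s *ℚ (⟪ f , y s ⟫ *ℚ ⟪ f , y s ⟫))
    same = ∑-cong L (λ {s′} i → cong (λ z → t s′ *ℚ (z *ℚ z)) (coeff i))
    totals : t s *ℚ (F *ℚ F) +ℚ ⟪ f′ , f′ ⟫ ≡ ⟪ f , f ⟫
    totals = begin
      t s *ℚ (F *ℚ F) +ℚ ⟪ f′ , f′ ⟫ ≡⟨ cong (t s *ℚ (F *ℚ F) +ℚ_) (⟪⟫-linear f c (y s) f′) ⟩
      t s *ℚ (F *ℚ F) +ℚ (⟪ f , f′ ⟫ +ℚ c *ℚ ⟪ y s , f′ ⟫) ≡⟨ cong₂ (λ u v → t s *ℚ (F *ℚ F) +ℚ (u +ℚ c *ℚ v))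
                                                                                      (trans (⟪⟫-comm f f′) (⟪⟫-linear f c (y s) f)) (trans (⟪⟫-comm (y s) f′) (⟪⟫-linear f c (y s) (y s))) ⟩
      t s *ℚ (F *ℚ F) +ℚ ((⟪ f , f ⟫ +ℚ c *ℚ ⟪ y s , f ⟫) +ℚ c *ℚ (F +ℚ c *ℚ Y)) ≡⟨ cong (λ u → t s *ℚ (F *ℚ F) +ℚ ((⟪ f , f ⟫ +ℚ c *ℚ u) +ℚ c *ℚ (F +ℚ c *ℚ Y))) (⟪⟫-comm (y s) f) ⟩
      t s *ℚ (F *ℚ F) +ℚ ((⟪ f , f ⟫ +ℚ c *ℚ F) +ℚ c *ℚ (F +ℚ c *ℚ Y)) ≡⟨ solve 4 (λ t F n Y → t :* (F :* F) :+ ((n :+ (:- (t :* F)) :* F) :+ (:- (t :* F)) :* (F :+ (:- (t :* F)) :* Y))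
                                                                                      := n :+ (t :* (F :* F)) :* (t :* Y :- con 1ℚ)) refl (t s) F ⟪ f , f ⟫ Y ⟩
      ⟪ f , f ⟫ +ℚ (t s *ℚ (F *ℚ F)) *ℚ (t s *ℚ Y -ℚ 1ℚ) ≡⟨ cong (λ u → ⟪ f , f ⟫ +ℚ (t s *ℚ (F *ℚ F)) *ℚ (u -ℚ 1ℚ)) (norm s) ⟩
      ⟪ f , f ⟫ +ℚ (t s *ℚ (F *ℚ F)) *ℚ 0ℚ ≡⟨ cong (⟪ f , f ⟫ +ℚ_) (ℚₚ.*-zeroʳ (t s *ℚ (F *ℚ F))) ⟩
      ⟪ f , f ⟫ +ℚ 0ℚ ≡⟨ ℚₚ.+-identityʳ _ ⟩
      ⟪ f , f ⟫ ∎
      where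
      open ≡-Reasoning
      Y = ⟪ y s , y s ⟫

  -- In all uses ε is 1 or -1, the value of a character at the transposition (a b). Only matchings
  -- are tested, since eigenfunctions are unconstrained on other tables.
  record Signed (ε : ℚ) (a b : Fin m) (y : Tab m → ℚ) : Set where
    constructor signed
    field
      sign : ∀ {P} → Matching P → y (act (transpose a b) P) ≡ ε *ℚ y P

  open Signed public

  -- Applying (a b) permutes the matchings and reverses the sign of every term of the inner product.
  orthogonal : ∀ {a b y y′} → Signed (- 1ℚ) a b y → Signed 1ℚ a b y′ → ⟪ y , y′ ⟫ ≡ 0ℚ
  orthogonal {a} {b} {y} {y′} anti symm = x≡-x⇒x≡0 _ (trans (sym (∑-act (transpose a b) (λ P → y P *ℚ y′ P)))
    (trans (∑-cong (mats m) (λ {P} i → trans (cong₂ _*ℚ_ (sign anti (mats⇒matching i)) (sign symm (mats⇒matching i)))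
        (solve 2 (λ u v → ((:- con 1ℚ) :* u) :* (con 1ℚ :* v) := (:- con 1ℚ) :* (u :* v)) refl (y P) (y′ P))))
      (trans (∑-* (- 1ℚ) (λ P → y P *ℚ y′ P) (mats m)) (solve 1 (λ u → (:- con 1ℚ) :* u := :- u) refl ⟪ y , y′ ⟫))))

  module Scheme (rel : Tab m → Tab m → Bool)
                (rel-act : ∀ π {P Q} → Matching P → Matching Q → rel (act π P) (act π Q) ≡ rel P Q) where

    record Eig (a : ℚ) (y : Tab m → ℚ) : Set where
      constructor eig
      field
        eigen : ∀ {P} → Matching P → ∑ (filterᵇ (rel P) (mats m)) y ≡ a *ℚ y P

    open Eig public

    row : Tab m → Tab m → ℚ
    row P Q = indic (rel P Q)

    Eig-row : ∀ {a y} → Eig a y → ∀ {P} → Matching P → ⟪ row P , y ⟫ ≡ a *ℚ y P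
    Eig-row {y = y} E {P} M = trans (sym (∑-filterᵇ (rel P) y (mats m))) (eigen E M)

    Eig-cong : ∀ {a y y′} → (∀ P → y P ≡ y′ P) → Eig a y → Eig a y′
    Eig-cong {a} e E .eigen {P} M = trans (∑-cong (filterᵇ (rel P) (mats m)) (λ {Q} _ → sym (e Q))) (trans (eigen E M) (cong (a *ℚ_) (e P)))

    Eig-act : ∀ {a y} → Eig a y → ∀ π → Eig a (y ∘ act π)
    Eig-act {a} {y} E π .eigen {P} M = begin
      ∑ (filterᵇ (rel P) (mats m)) (y ∘ act π) ≡⟨ ∑-filterᵇ (rel P) (y ∘ act π) (mats m) ⟩
      ∑ (mats m) (λ Q → indic (rel P Q) *ℚ y (act π Q)) ≡⟨ ∑-cong (mats m) (λ {Q} i → cong (λ b → indic b *ℚ y (act π Q)) (sym (rel-act π M (mats⇒matching i)))) ⟩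
      ∑ (mats m) (λ Q → indic (rel (act π P) (act π Q)) *ℚ y (act π Q)) ≡⟨ ∑-act π (λ Q → indic (rel (act π P) Q) *ℚ y Q) ⟩
      ∑ (mats m) (λ Q → indic (rel (act π P) Q) *ℚ y Q) ≡⟨ ∑-filterᵇ (rel (act π P)) y (mats m) ⟨
      ∑ (filterᵇ (rel (act π P)) (mats m)) y ≡⟨ eigen E (act-matching π M) ⟩
      a *ℚ y (act π P) ∎
      where open ≡-Reasoning

    Eig-∑ : ∀ {a} {A : Set} (L : List A) (c : A → ℚ) (y : A → Tab m → ℚ) → (∀ {i} → i ∈ L → Eig a (y i)) →
            Eig a (λ P → ∑ L (λ i → c i *ℚ y i P))
    Eig-∑ {a} L c y E .eigen {P} M = begin
      ∑ R (λ Q → ∑ L (λ i → c i *ℚ y i Q)) ≡⟨ ∑-swap (λ Q i → c i *ℚ y i Q) R L ⟩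
      ∑ L (λ i → ∑ R (λ Q → c i *ℚ y i Q)) ≡⟨ ∑-cong L (λ {i} j → trans (∑-* (c i) (y i) R) (cong (c i *ℚ_) (eigen (E j) M))) ⟩
      ∑ L (λ i → c i *ℚ (a *ℚ y i P)) ≡⟨ ∑-cong L (λ {i} _ → solve 3 (λ c a y → c :* (a :* y) := a :* (c :* y)) refl (c i) a (y i P)) ⟩
      ∑ L (λ i → a *ℚ (c i *ℚ y i P)) ≡⟨ ∑-* a (λ i → c i *ℚ y i P) L ⟩
      a *ℚ ∑ L (λ i → c i *ℚ y i P) ∎
      where
      open ≡-Reasoning
      R = filterᵇ (rel P) (mats m)

    Eig-+ : ∀ {a y y′} → Eig a y → Eig a y′ → ∀ c → Eig a (λ P → y P +ℚ c *ℚ y′ P)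
    Eig-+ {a} {y} {y′} E E′ c .eigen {P} M = begin
      ∑ R (λ Q → y Q +ℚ c *ℚ y′ Q) ≡⟨ ∑-+ y (λ Q → c *ℚ y′ Q) R ⟩
      ∑ R y +ℚ ∑ R (λ Q → c *ℚ y′ Q) ≡⟨ cong₂ _+ℚ_ (eigen E M) (trans (∑-* c y′ R) (cong (c *ℚ_) (eigen E′ M))) ⟩
      a *ℚ y P +ℚ c *ℚ (a *ℚ y′ P) ≡⟨ solve 4 (λ a y c y′ → a :* y :+ c :* (a :* y′) := a :* (y :+ c :* y′)) refl a (y P) c (y′ P) ⟩
      a *ℚ (y P +ℚ c *ℚ y′ P) ∎
      where
      open ≡-Reasoning
      R = filterᵇ (rel P) (mats m)

    relatedPairs : ℚ
    relatedPairs = ∑ (mats m) (λ P → ∑ (mats m) (row P))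

    -- Row P has inner product a y(P) with an eigenfunction y, and its squared norm is the valency
    -- of P. Summing Bessel's inequality over all P turns the terms y(P)² / `⟪ y , y ⟫` into 1 and
    -- leaves a² once for each member of L.
    orthogonal-bound : ∀ {S : Set} {a} (y : S → Tab m → ℚ) L → AllPairs (λ s s′ → ⟪ y s , y s′ ⟫ ≡ 0ℚ) L →
      (∀ s → Eig a (y s)) → (∀ s → ∃[ Q ] Matching Q × y s Q ≢ 0ℚ) → ι (length L) *ℚ (a *ℚ a) ≤ℚ relatedPairs
    orthogonal-bound {S} {a} y L os E nz = subst (_≤ℚ relatedPairs) totals (∑-mono-≤ (mats m) (λ {P} i →
        subst₂ _≤ℚ_ (∑-cong L (λ {s} _ → cong (λ z → t s *ℚ (z *ℚ z)) (Eig-row {a} (E s) (mats⇒matching i))))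
          (∑-cong (mats m) (λ {Q} _ → indic-idem (rel P Q))) (bessel y t L os norm (row P))))
      where
      N : S → ℚ
      N s = ⟪ y s , y s ⟫
      N≢0 : ∀ s → N s ≢ 0ℚ
      N≢0 s = ⟪⟫≢0 {y s} (proj₁ (proj₂ (nz s))) (proj₂ (proj₂ (nz s)))
      t : S → ℚ
      t s = ℚ.1/_ (N s) {{ℚ.≢-nonZero (N≢0 s)}}
      norm : ∀ s → t s *ℚ N s ≡ 1ℚ
      norm s = ℚₚ.*-inverseˡ (N s) {{ℚ.≢-nonZero (N≢0 s)}}
      totals : ∑ (mats m) (λ P → ∑ L (λ s → t s *ℚ ((a *ℚ y s P) *ℚ (a *ℚ y s P)))) ≡ ι (length L) *ℚ (a *ℚ a)
      totals = begin
        ∑ (mats m) (λ P → ∑ L (λ s → t s *ℚ ((a *ℚ y s P) *ℚ (a *ℚ y s P)))) ≡⟨ ∑-swap (λ P s → t s *ℚ ((a *ℚ y s P) *ℚ (a *ℚ y s P))) (mats m) L ⟩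
        ∑ L (λ s → ∑ (mats m) (λ P → t s *ℚ ((a *ℚ y s P) *ℚ (a *ℚ y s P)))) ≡⟨ ∑-cong L (λ {s} _ → each s) ⟩
        ∑ L (λ s → a *ℚ a) ≡⟨ ∑-const (a *ℚ a) L ⟩
        ι (length L) *ℚ (a *ℚ a) ∎
        where
        open ≡-Reasoning
        each : ∀ s → ∑ (mats m) (λ P → t s *ℚ ((a *ℚ y s P) *ℚ (a *ℚ y s P))) ≡ a *ℚ a
        each s = trans (∑-cong (mats m) (λ {P} _ → solve 3 (λ t a y → t :* ((a :* y) :* (a :* y)) := (a :* a :* t) :* (y :* y)) refl (t s) a (y s P)))
          (trans (∑-* (a *ℚ a *ℚ t s) (λ P → y s P *ℚ y s P) (mats m))
            (trans (ℚₚ.*-assoc (a *ℚ a) (t s) (N s)) (trans (cong (a *ℚ a *ℚ_) (norm s)) (ℚₚ.*-identityʳ (a *ℚ a)))))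

-- Orthogonal families of eigenfunctions

fresh : ∀ {m} (U : List (Fin m)) → length U < m → ∃[ x ] x ∉ U
fresh {m} U l with Finₚ.all? (λ x → DecMembership._∈?_ Finₚ._≟_ x U)
... | yes h = ⊥-elim (ℕₚ.<⇒≱ l (subst (_≤ length U) (length-allFin m) (⊆-length (allFin⁺ m) (λ {x} _ → h x))))
... | no ¬h = let x , n = Finₚ.¬∀⟶∃¬ m (_∈ U) (λ x → DecMembership._∈?_ Finₚ._≟_ x U) ¬h in x , n

transpose-comm : ∀ {m} (a b c d : Fin m) → a ≢ c → a ≢ d → b ≢ c → b ≢ d → ∀ P →
                 act (transpose a b) (act (transpose c d) P) ≡ act (transpose c d) (act (transpose a b) P)
transpose-comm a b c d ac ad bc bd P = trans (act-transpose-conj (transpose a b) c d P)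
  (cong₂ (λ u v → act (transpose u v) (act (transpose a b) P))
    (transpose-other a b (ac ∘ sym) (bc ∘ sym)) (transpose-other a b (ad ∘ sym) (bd ∘ sym)))

act-transpose² : ∀ {m} (a b : Fin m) P → act (transpose a b) (act (transpose a b) P) ≡ P
act-transpose² a b P = trans (act-∘ (transpose a b) (transpose a b) P) (act-id (transpose a b ∘ₚ transpose a b) P (transpose-involutive a b))

record FreshEdges {m} (Q : Tab m) (U : List (Fin m)) (k : ℕ) : Set where
  field
    vertex    : Fin k → Fin m
    vertex∉   : ∀ i → vertex i ∉ U
    partner∉  : ∀ i → Q $ vertex i ∉ U
    injective : ∀ {i j} → vertex i ≡ vertex j → i ≡ j
    separate  : ∀ i j → vertex i ≢ Q $ vertex j

-- A vertex outside `W`, which consists of the points `V` used so far and their partners, has both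
-- ends of its edge outside `V`. Since `V` has |U| + k entries, such a vertex exists once 2 (|U| +
-- k) < m.
freshEdges : ∀ {m} {Q : Tab m} → Matching Q → ∀ U k → 2 * (length U + k) ≤ m → FreshEdges Q U k
freshEdges MQ U zero    l = record { vertex = λ () ; vertex∉ = λ () ; partner∉ = λ () ; injective = λ {} ; separate = λ () }
freshEdges {m} {Q} MQ U (suc k) l = record
  { vertex = vertex ; vertex∉ = vertex∉ ; partner∉ = partner∉ ; injective = λ {i} {j} → injective i j ; separate = separate }
  where
  F : FreshEdges Q U k
  F = freshEdges MQ U k (ℕₚ.≤-trans (ℕₚ.*-monoʳ-≤ 2 (ℕₚ.+-monoʳ-≤ (length U) (ℕₚ.n≤1+n k))) l)
  module F = FreshEdges F
  V : List (Fin m)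
  V = U ++ map F.vertex (allFin k)
  W : List (Fin m)
  W = V ++ map (Q $_) V
  lengthW : length W ≡ 2 * (length U + k)
  lengthW = trans (Listₚ.length-++ V) (cong₂ _+_ lengthV (trans (Listₚ.length-map (Q $_) V) (trans lengthV (sym (ℕₚ.+-identityʳ _)))))
    where
    lengthV : length V ≡ length U + k
    lengthV = trans (Listₚ.length-++ U) (cong (length U +_) (trans (Listₚ.length-map F.vertex (allFin k)) (length-allFin k)))
  new : ∃[ x ] x ∉ W
  new = fresh W (subst (_< m) (sym lengthW) (ℕₚ.<-≤-trans (ℕₚ.*-monoʳ-< 2 (ℕₚ.+-monoʳ-< (length U) (ℕₚ.n<1+n k))) l))
  x = proj₁ new
  x∉V : x ∉ V
  x∉V i = proj₂ new (∈-++⁺ˡ i)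
  Qx∉V : Q $ x ∉ V
  Qx∉V i = proj₂ new (∈-++⁺ʳ V (subst (_∈ map (Q $_) V) (involutive MQ x) (∈-map⁺ (Q $_) i)))
  old : ∀ i → F.vertex i ∈ V
  old i = ∈-++⁺ʳ U (∈-map⁺ F.vertex (∈-allFin i))
  vertex : Fin (suc k) → Fin m
  vertex zero    = x
  vertex (suc i) = F.vertex i
  vertex∉ : ∀ i → vertex i ∉ U
  vertex∉ zero    i = x∉V (∈-++⁺ˡ i)
  vertex∉ (suc i) = F.vertex∉ i
  partner∉ : ∀ i → Q $ vertex i ∉ U
  partner∉ zero    i = Qx∉V (∈-++⁺ˡ i)
  partner∉ (suc i) = F.partner∉ i
  injective : ∀ i j → vertex i ≡ vertex j → i ≡ j
  injective zero    zero    e = refl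
  injective zero    (suc j) e = ⊥-elim (x∉V (subst (_∈ V) (sym e) (old j)))
  injective (suc i) zero    e = ⊥-elim (x∉V (subst (_∈ V) e (old i)))
  injective (suc i) (suc j) e = cong suc (F.injective e)
  separate : ∀ i j → vertex i ≢ Q $ vertex j
  separate zero    zero    e = irreflexive MQ x (sym e)
  separate zero    (suc j) e = Qx∉V (subst (_∈ V) (trans (sym (involutive MQ _)) (cong (Q $_) (sym e))) (old j))
  separate (suc i) zero    e = Qx∉V (subst (_∈ V) e (old i))
  separate (suc i) (suc j) e = F.separate i j e

-- A block consists of four pairs of points, and the Boolean picks an end of a pair. Block 0 will
-- carry the antisymmetric pairs, the other blocks the symmetric ones.
Blocks : ℕ → ℕ → Set
Blocks q m = Fin q × Fin 4 × Bool → Fin m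

module Spread {m : ℕ} (rel : Tab m → Tab m → Bool)
              (rel-act : ∀ π {P Q} → Matching P → Matching Q → rel (act π P) (act π Q) ≡ rel P Q) where

  open Scheme rel rel-act

  module Symmetrize {a} {y : Tab m → ℚ} (E : Eig a y) {Q : Tab m} (MQ : Matching Q) (y≢0 : y Q ≢ 0ℚ)
                    {U k} (F : FreshEdges Q U k) where

    open FreshEdges F

    τ : Fin k → Permutation′ m
    τ i = transpose (vertex i) (Q $ vertex i)

    -- The product of the commuting operators 1 + τ i over the list; the factor 1ℚ fits the form of
    -- `Eig-+`.
    sym-over : List (Fin k) → Tab m → ℚ
    sym-over []      P = y P
    sym-over (i ∷ L) P = sym-over L P +ℚ 1ℚ *ℚ sym-over L (act (τ i) P)

    sym-over-Eig : ∀ L → Eig a (sym-over L)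
    sym-over-Eig []      = E
    sym-over-Eig (i ∷ L) = Eig-+ (sym-over-Eig L) (Eig-act (sym-over-Eig L) (τ i)) 1ℚ

    -- Every `τ i` exchanges the ends of an edge of Q and so fixes Q; each factor doubles the value.
    sym-over-Q : ∀ L → sym-over L Q ≡ ι (2 ^ length L) *ℚ y Q
    sym-over-Q []      = trans (sym (ℚₚ.*-identityˡ (y Q))) (cong (_*ℚ y Q) (sym (ℚₚ.+-identityʳ 1ℚ)))
    sym-over-Q (i ∷ L) = begin
      sym-over L Q +ℚ 1ℚ *ℚ sym-over L (act (τ i) Q) ≡⟨ cong (λ R → sym-over L Q +ℚ 1ℚ *ℚ sym-over L R) (act-transpose-edge MQ (vertex i)) ⟩
      sym-over L Q +ℚ 1ℚ *ℚ sym-over L Q ≡⟨ cong (λ z → z +ℚ 1ℚ *ℚ z) (sym-over-Q L) ⟩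
      c *ℚ y Q +ℚ 1ℚ *ℚ (c *ℚ y Q) ≡⟨ solve 2 (λ c y → c :* y :+ con 1ℚ :* (c :* y) := (c :+ (c :+ con 0ℚ)) :* y) refl c (y Q) ⟩
      (c +ℚ (c +ℚ ι 0)) *ℚ y Q ≡⟨ cong (_*ℚ y Q) (trans (cong (c +ℚ_) (sym (ι-+ (2 ^ length L) 0))) (sym (ι-+ (2 ^ length L) (2 ^ length L + 0)))) ⟩
      ι (2 ^ length (i ∷ L)) *ℚ y Q ∎
      where
      open ≡-Reasoning
      c = ι (2 ^ length L)

    sym-over-Q≢0 : ∀ L → sym-over L Q ≢ 0ℚ
    sym-over-Q≢0 L e = y≢0 (*-cancel-zero (ι (2 ^ length L))
      (0<⇒≢0 (ℚₚ.<-≤-trans (0<ι 0) (ι-mono-≤ (ℕₚ.m^n>0 2 (length L))))) (trans (sym (sym-over-Q L)) e))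

    sym-over-Signed : ∀ {ε a b} L → (∀ {i} → i ∈ L → a ≢ vertex i × b ≢ vertex i × a ≢ Q $ vertex i × b ≢ Q $ vertex i) →
                      Signed ε a b y → Signed ε a b (sym-over L)
    sym-over-Signed []      d s = s
    sym-over-Signed {ε} {a} {b} (i ∷ L) d s .sign {P} M with d (here refl)
    ... | av , bv , aq , bq = begin
      sym-over L (act τab P) +ℚ 1ℚ *ℚ sym-over L (act (τ i) (act τab P)) ≡⟨ cong (λ R → sym-over L (act τab P) +ℚ 1ℚ *ℚ sym-over L R)
                                                                                  (sym (transpose-comm a b (vertex i) (Q $ vertex i) av aq bv bq P)) ⟩
      sym-over L (act τab P) +ℚ 1ℚ *ℚ sym-over L (act τab (act (τ i) P)) ≡⟨ cong₂ (λ u v → u +ℚ 1ℚ *ℚ v) (sign IH M) (sign IH (act-matching (τ i) M)) ⟩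
      ε *ℚ sym-over L P +ℚ 1ℚ *ℚ (ε *ℚ sym-over L (act (τ i) P)) ≡⟨ solve 3 (λ e u v → e :* u :+ con 1ℚ :* (e :* v) := e :* (u :+ con 1ℚ :* v)) refl ε (sym-over L P) (sym-over L (act (τ i) P)) ⟩
      ε *ℚ sym-over (i ∷ L) P ∎
      where
      open ≡-Reasoning
      τab = transpose a b
      IH : Signed ε a b (sym-over L)
      IH = sym-over-Signed L (d ∘ there) s

    -- The factor 1 + τ j absorbs τ j, and the other factors commute with τ j because the fresh
    -- edges are disjoint.
    sym-over-symmetric : ∀ L {j} → j ∈ L → Signed 1ℚ (vertex j) (Q $ vertex j) (sym-over L)
    sym-over-symmetric (i ∷ L) {j} p .sign {P} M with i Finₚ.≟ j
    ... | yes refl = begin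
      sym-over L (act (τ i) P) +ℚ 1ℚ *ℚ sym-over L (act (τ i) (act (τ i) P)) ≡⟨ cong (λ R → sym-over L (act (τ i) P) +ℚ 1ℚ *ℚ sym-over L R) (act-transpose² (vertex i) (Q $ vertex i) P) ⟩
      sym-over L (act (τ i) P) +ℚ 1ℚ *ℚ sym-over L P ≡⟨ solve 2 (λ u v → v :+ con 1ℚ :* u := con 1ℚ :* (u :+ con 1ℚ :* v)) refl (sym-over L P) (sym-over L (act (τ i) P)) ⟩
      1ℚ *ℚ sym-over (i ∷ L) P ∎
      where
      open ≡-Reasoning
    ... | no n = trans (cong₂ (λ u v → u +ℚ 1ℚ *ℚ v) (sign IH M)
            (trans (cong (sym-over L) (sym (transpose-comm (vertex j) (Q $ vertex j) (vertex i) (Q $ vertex i)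
              (n ∘ sym ∘ injective) (separate j i) (λ e → separate i j (sym e)) (λ e → n (sym (injective (matching-injective MQ e)))) P)))
              (sign IH (act-matching (τ i) M))))
            (solve 2 (λ u v → con 1ℚ :* u :+ con 1ℚ :* (con 1ℚ :* v) := con 1ℚ :* (u :+ con 1ℚ :* v)) refl (sym-over L P) (sym-over L (act (τ i) P)))
      where
      tail : j ∈ i ∷ L → j ∈ L
      tail (here e)  = ⊥-elim (n (sym e))
      tail (there q) = q
      IH : Signed 1ℚ (vertex j) (Q $ vertex j) (sym-over L)
      IH = sym-over-symmetric L (tail p)

  module Family {a} {y : Tab m → ℚ} (E : Eig a y) {Q : Tab m} (MQ : Matching Q) (y≢0 : y Q ≢ 0ℚ) {q}
                (z : Blocks (suc q) m) (z-injective : ∀ {u v} → z u ≡ z v → u ≡ v)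
                (anti : ∀ j → Signed (- 1ℚ) (z (zero , j , false)) (z (zero , j , true)) y)
                (symm : ∀ i j → Signed 1ℚ (z (suc i , j , false)) (z (suc i , j , true)) y) where

    Index : Set
    Index = Vec (Fin (suc q)) 4

    -- member s is antisymmetric in block (i , j) exactly for i = lookup s j, so distinct
    -- members are separated by the sign of one transposition.
    κ : Index → Fin (suc q) × Fin 4 × Bool → Fin (suc q) × Fin 4 × Bool
    κ s (i , j , b) = transpose zero (lookup s j) ⟨$⟩ʳ i , j , b

    κ-injective : ∀ s {u v} → κ s u ≡ κ s v → u ≡ v
    κ-injective s {i , j , b} {i′ , j′ , b′} e with cong (proj₁ ∘ proj₂) e | cong (proj₂ ∘ proj₂) e
    ... | refl | refl with perm-injective (transpose zero (lookup s j)) {i} {i′} (cong proj₁ e)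
    ...   | refl = refl

    all-blocks : List (Fin (suc q) × Fin 4 × Bool)
    all-blocks = cartesianProduct (allFin (suc q)) (cartesianProduct (allFin 4) (false ∷ true ∷ []))

    ∈-all-blocks : ∀ u → u ∈ all-blocks
    ∈-all-blocks (i , j , b) = ∈-cartesianProduct⁺ (∈-allFin i) (∈-cartesianProduct⁺ (∈-allFin j) (bools b))
      where
      bools : ∀ b → b ∈ false ∷ true ∷ []
      bools false = here refl
      bools true  = there (here refl)

    π : Index → Permutation′ m
    π s = proj₁ (extend z (z ∘ κ s) z-injective (κ-injective s ∘ z-injective) all-blocks)

    π-z : ∀ s u → π s ⟨$⟩ʳ z u ≡ z (κ s u)
    π-z s u = proj₂ (extend z (z ∘ κ s) z-injective (κ-injective s ∘ z-injective) all-blocks) (∈-all-blocks u)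

    member : Index → Tab m → ℚ
    member s = y ∘ act (π s)

    member-Signed : ∀ {ε} s i j → let i′ = transpose zero (lookup s j) ⟨$⟩ʳ i in
      Signed ε (z (i′ , j , false)) (z (i′ , j , true)) y → Signed ε (z (i , j , false)) (z (i , j , true)) (member s)
    member-Signed s i j h .sign {P} M = trans (cong y (trans (act-transpose-conj (π s) _ _ P)
        (cong₂ (λ u v → act (transpose u v) (act (π s) P)) (π-z s (i , j , false)) (π-z s (i , j , true)))))
      (sign h (act-matching (π s) M))

    member-anti : ∀ s j → Signed (- 1ℚ) (z (lookup s j , j , false)) (z (lookup s j , j , true)) (member s)
    member-anti s j = member-Signed s (lookup s j) j (subst (λ i → Signed (- 1ℚ) (z (i , j , false)) (z (i , j , true)) y)
      (sym (transpose-right zero (lookup s j))) (anti j))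

    member-symm : ∀ s i j → i ≢ lookup s j → Signed 1ℚ (z (i , j , false)) (z (i , j , true)) (member s)
    member-symm s i j n = member-Signed s i j (go _ refl)
      where
      go : ∀ i′ → transpose zero (lookup s j) ⟨$⟩ʳ i ≡ i′ → Signed 1ℚ (z (i′ , j , false)) (z (i′ , j , true)) y
      go zero     e = ⊥-elim (n (perm-injective (transpose zero (lookup s j)) {i} {lookup s j} (trans e (sym (transpose-right zero (lookup s j))))))
      go (suc i′) e = symm i′ j

    member-orthogonal : ∀ {s s′} → s ≢ s′ → ⟪ member s , member s′ ⟫ ≡ 0ℚ
    member-orthogonal {s} {s′} n with Finₚ.all? (λ j → lookup s j Finₚ.≟ lookup s′ j)
    ... | yes h = ⊥-elim (n (Tab-ext h))
    ... | no ¬h with Finₚ.¬∀⟶∃¬ 4 (λ j → lookup s j ≡ lookup s′ j) (λ j → lookup s j Finₚ.≟ lookup s′ j) ¬h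
    ...   | j , d = orthogonal (member-anti s j) (member-symm s′ (lookup s j) j d)

    family-bound : ι (suc q ^ 4) *ℚ (a *ℚ a) ≤ℚ relatedPairs
    family-bound = subst (λ l → ι l *ℚ (a *ℚ a) ≤ℚ relatedPairs) (length-allVecs (suc q) 4)
      (orthogonal-bound {a = a} member (allVecs (suc q) 4) (AllPairs.map member-orthogonal (allVecs-unique (suc q) 4))
        (λ s → Eig-act {a} E (π s)) (λ s → act (flip (π s)) Q , act-matching (flip (π s)) MQ , λ e → y≢0 (trans (cong y (sym (act-flip′ (π s) Q))) e)))

  -- The four given pairs occupy the 8 points of `U`, and q blocks of four edges of Q are added, 4q
  -- fresh edges in all. The factor 2 is that of `freshEdges`, where partners are avoided too.
  antisymmetric-bound : ∀ {a y} → Eig a y → ∀ {Q} → Matching Q → y Q ≢ 0ℚ →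
    ∀ (p : Fin 4 × Bool → Fin m) → (∀ {u v} → p u ≡ p v → u ≡ v) →
    (∀ j → Signed (- 1ℚ) (p (j , false)) (p (j , true)) y) →
    ∀ q → 2 * (8 + q * 4) ≤ m → ι (suc q ^ 4) *ℚ (a *ℚ a) ≤ℚ relatedPairs
  antisymmetric-bound {a} {y} E {Q} MQ y≢0 p p-injective anti q l =
    Family.family-bound {a} (sym-over-Eig (allFin (q * 4))) MQ (sym-over-Q≢0 (allFin (q * 4))) z (λ {u} {v} → z-injective u v) z-anti z-symm
    where
    U : List (Fin m)
    U = map p (cartesianProduct (allFin 4) (false ∷ true ∷ []))
    p∈U : ∀ u → p u ∈ U
    p∈U (j , b) = ∈-map⁺ p (∈-cartesianProduct⁺ (∈-allFin j) (bools b))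
      where
      bools : ∀ b → b ∈ false ∷ true ∷ []
      bools false = here refl
      bools true  = there (here refl)
    F : FreshEdges Q U (q * 4)
    F = freshEdges MQ U (q * 4) l
    open FreshEdges F
    open Symmetrize {a} E MQ y≢0 F
    z : Blocks (suc q) m
    z (zero  , u)         = p u
    z (suc i , j , false) = vertex (combine i j)
    z (suc i , j , true)  = Q $ vertex (combine i j)
    z-injective : ∀ u v → z u ≡ z v → u ≡ v
    z-injective (zero , u) (zero , v) e = cong (zero ,_) (p-injective e)
    z-injective (zero , u) (suc i , j , false) e = ⊥-elim (vertex∉ (combine i j) (subst (_∈ U) e (p∈U u)))
    z-injective (zero , u) (suc i , j , true)  e = ⊥-elim (partner∉ (combine i j) (subst (_∈ U) e (p∈U u)))
    z-injective (suc i , j , false) (zero , v) e = ⊥-elim (vertex∉ (combine i j) (subst (_∈ U) (sym e) (p∈U v)))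
    z-injective (suc i , j , true)  (zero , v) e = ⊥-elim (partner∉ (combine i j) (subst (_∈ U) (sym e) (p∈U v)))
    z-injective (suc i , j , false) (suc i′ , j′ , true)  e = ⊥-elim (separate (combine i j) (combine i′ j′) e)
    z-injective (suc i , j , true)  (suc i′ , j′ , false) e = ⊥-elim (separate (combine i′ j′) (combine i j) (sym e))
    z-injective (suc i , j , false) (suc i′ , j′ , false) e with combine-injective i j i′ j′ (injective e)
    ... | refl , refl = refl
    z-injective (suc i , j , true)  (suc i′ , j′ , true)  e with combine-injective i j i′ j′ (injective (matching-injective MQ e))
    ... | refl , refl = refl
    z-anti : ∀ j → Signed (- 1ℚ) (z (zero , j , false)) (z (zero , j , true)) (sym-over (allFin (q * 4)))
    z-anti j = sym-over-Signed (allFin (q * 4)) (λ {i} _ →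
      (λ e → vertex∉ i (subst (_∈ U) e (p∈U _))) , (λ e → vertex∉ i (subst (_∈ U) e (p∈U _))) ,
      (λ e → partner∉ i (subst (_∈ U) e (p∈U _))) , (λ e → partner∉ i (subst (_∈ U) e (p∈U _)))) (anti j)
    z-symm : ∀ i j → Signed 1ℚ (z (suc i , j , false)) (z (suc i , j , true)) (sym-over (allFin (q * 4)))
    z-symm i j = sym-over-symmetric (allFin (q * 4)) (∈-allFin (combine i j))

-- Young symmetrizers

==ℕ⇒≡ : ∀ {a b} → (a ==ℕ b) ≡ true → a ≡ b
==ℕ⇒≡ {a} {b} e = ℕₚ.≡ᵇ⇒≡ a b (Equivalence.from T-≡ e)

∑-single : ∀ {A : Set} {xs : List A} {f : A → ℚ} {x} → Unique xs → x ∈ xs → (∀ {y} → y ≢ x → f y ≡ 0ℚ) → ∑ xs f ≡ f x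
∑-single {xs = x ∷ xs} {f} (u ∷ us) (here refl) z =
  trans (cong (f x +ℚ_) (∑-≡0 xs (λ i → z (λ e → All.lookup u i (sym e))))) (ℚₚ.+-identityʳ (f x))
∑-single {xs = y ∷ xs} {f} {x} (u ∷ us) (there i) z =
  trans (cong₂ _+ℚ_ (z (All.lookup u i)) (∑-single us i z)) (ℚₚ.+-identityˡ (f x))

-- The action of an arbitrary table, trivial unless the table is a permutation.
tact : ∀ {m} → Tab m → Tab m → Tab m
tact g P with isPerm g Data.Bool.≟ true
... | yes e = act (ofTab g e) P
... | no  _ = P

module _ {m : ℕ} where

  tact-act : ∀ (g : Tab m) (π : Permutation′ m) P → (∀ x → g $ x ≡ π ⟨$⟩ʳ x) → tact g P ≡ act π P
  tact-act g π P h with isPerm g Data.Bool.≟ true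
  ... | yes e = act-cong (ofTab g e) π P h
  ... | no  n = ⊥-elim (n (isPerm⁺ g λ {x} {y} q → perm-injective π (trans (sym (h x)) (trans q (h y)))))

  ∘T-isPerm : ∀ (g h : Tab m) → isPerm g ≡ true → isPerm h ≡ true → isPerm (g ∘T h) ≡ true
  ∘T-isPerm g h eg eh = isPerm⁺ (g ∘T h) λ {x} {y} q →
    isPerm⁻ h eh (isPerm⁻ g eg (trans (sym (∘T-$ g h x)) (trans q (∘T-$ g h y))))

  tact-∘ : ∀ (g h : Tab m) → isPerm g ≡ true → isPerm h ≡ true → ∀ P → tact (g ∘T h) P ≡ tact g (tact h P)
  tact-∘ g h eg eh P = trans (tact-act (g ∘T h) (ofTab h eh ∘ₚ ofTab g eg) P (∘T-$ g h))
    (trans (sym (act-∘ (ofTab h eh) (ofTab g eg) P))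
      (sym (trans (cong (tact g) (tact-act h (ofTab h eh) P λ _ → refl)) (tact-act g (ofTab g eg) _ λ _ → refl))))

  tact-matching : ∀ (g : Tab m) {P} → Matching P → Matching (tact g P)
  tact-matching g M with isPerm g Data.Bool.≟ true
  ... | yes e = act-matching (ofTab g e) M
  ... | no  _ = M

  ∑-tact : ∀ (g : Tab m) (f : Tab m → ℚ) → ∑ (mats m) (f ∘ tact g) ≡ ∑ (mats m) f
  ∑-tact g f with isPerm g Data.Bool.≟ true
  ... | yes e = ∑-act (ofTab g e) f
  ... | no  _ = refl

  tact-actsTo : ∀ (g : Tab m) → isPerm g ≡ true → ∀ P → actsTo g P (tact g P) ≡ true
  tact-actsTo g e P = allB⁺ λ x → ≡⇒==F (trans (cong (_$ (g $ x)) (tact-act g (ofTab g e) P λ _ → refl)) (act-$-ʳ (ofTab g e) P x))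

  actsTo⇒tact : ∀ (g : Tab m) → isPerm g ≡ true → ∀ P Q → actsTo g P Q ≡ true → Q ≡ tact g P
  actsTo⇒tact g e P Q h = trans (act-unique (ofTab g e) P Q (λ x → ==F⇒≡ (allB⁻ h x))) (sym (tact-act g (ofTab g e) P λ _ → refl))

  ∑-actsTo : ∀ (v : Tab m → ℚ) (g : Tab m) → isPerm g ≡ true → ∀ {P} → Matching P →
             ∑ (mats m) (λ Q → v Q *ℚ indic (actsTo g P Q)) ≡ v (tact g P)
  ∑-actsTo v g e {P} M = trans (∑-single {f = λ Q → v Q *ℚ indic (actsTo g P Q)} (mats-unique m) (∈-mats (tact-matching g M)) off)
    (trans (cong (λ b → v (tact g P) *ℚ indic b) (tact-actsTo g e P)) (ℚₚ.*-identityʳ _))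
    where
    off : ∀ {Q} → Q ≢ tact g P → v Q *ℚ indic (actsTo g P Q) ≡ 0ℚ
    off {Q} n with actsTo g P Q in eq
    ... | true  = ⊥-elim (n (actsTo⇒tact g e P Q eq))
    ... | false = ℚₚ.*-zeroʳ (v Q)

  -- For the keys `rowKey` and `colKey` this is `rowGroup` or `colGroup` by definition, so both
  -- groups share the lemmas below.
  stabilizer : (Fin m → ℕ) → List (Tab m)
  stabilizer c = filterᵇ (λ g → allB (λ x → c (g $ x) ==ℕ c x)) (perms m)

  module _ {c : Fin m → ℕ} where

    stabilizer-unique : Unique (stabilizer c)
    stabilizer-unique = filterᵇ-unique _ (perms-unique m)

    stabilizer-isPerm : ∀ {g} → g ∈ stabilizer c → isPerm g ≡ true
    stabilizer-isPerm i = perms-isPerm (proj₁ (∈-filterᵇ⁻ _ {xs = perms m} i))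

    stabilizer-∘T : ∀ {g a b} → g ∈ stabilizer c → c a ≡ c b → g ∘T tabOf (transpose a b) ∈ stabilizer c
    stabilizer-∘T {g} {a} {b} i e with ∈-filterᵇ⁻ (λ g → allB (λ x → c (g $ x) ==ℕ c x)) {xs = perms m} i
    ... | j , h = ∈-filterᵇ⁺ _ (∈-perms (∘T-isPerm g t (perms-isPerm j) (tabOf-isPerm (transpose a b))))
        (allB⁺ λ x → dec-true (_ Data.Nat.≟ _) (trans (cong c (∘T-$ g t x)) (trans (fixes (t $ x)) (moves x))))
      where
      t = tabOf (transpose a b)
      fixes : ∀ x → c (g $ x) ≡ c x
      fixes x = ==ℕ⇒≡ (allB⁻ h x)
      moves : ∀ x → c (t $ x) ≡ c x
      moves x = trans (cong c (tabOf-$ (transpose a b) x)) (go (transposed a b x))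
        where
        go : ∀ {d} → Transposed a b x d → c d ≡ c x
        go (left refl refl)    = sym e
        go (right refl refl)   = e
        go (other _ _ refl)    = refl

    ∑-stabilizer : ∀ a b → c a ≡ c b → ∀ (f : Tab m → ℚ) →
                   ∑ (stabilizer c) (λ g → f (g ∘T tabOf (transpose a b))) ≡ ∑ (stabilizer c) f
    ∑-stabilizer a b e f = ∑-reindex stabilizer-unique φ φ (λ i → stabilizer-∘T i e) (λ i → stabilizer-∘T i e)
      (λ {g} _ → φφ g) (λ {g} _ → φφ g) f
      where
      t = tabOf (transpose a b)
      φ : Tab m → Tab m
      φ g = g ∘T t
      φφ : ∀ g → φ (φ g) ≡ g
      φφ g = Tab-ext λ x → trans (∘T-$ (g ∘T t) t x) (trans (∘T-$ g t (t $ x))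
        (cong (g $_) (trans (tabOf-$ (transpose a b) _) (trans (cong (transpose a b ⟨$⟩ʳ_) (tabOf-$ (transpose a b) x)) (transpose-involutive a b x)))))

    ∑-sgn : ∀ {a b} → a ≢ b → c a ≡ c b → ∑ (stabilizer c) sgn ≡ 0ℚ
    ∑-sgn {a} {b} n e = x≡-x⇒x≡0 _ (trans (sym (∑-stabilizer a b e sgn)) (trans
      (∑-cong (stabilizer c) (λ {g} i → trans (sgn-transpose g (stabilizer-isPerm i) a b n) (ℚₚ.neg-distribˡ-* 1ℚ (sgn g) ■ cong -_ (ℚₚ.*-identityˡ (sgn g)))))
      (trans (∑-* (- 1ℚ) sgn (stabilizer c)) (trans (sym (ℚₚ.neg-distribˡ-* 1ℚ (∑ (stabilizer c) sgn))) (cong -_ (ℚₚ.*-identityˡ _))))))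
      where
      _■_ : ∀ {x y z : ℚ} → x ≡ y → x ≡ z → z ≡ y
      refl ■ refl = refl

    -- β acts on P before σ does. A transposition applied to P is therefore absorbed into β, and the
    -- points in which the result is antisymmetric do not depend on σ.
    antisymmetrized : Tab m → (Tab m → ℚ) → Tab m → ℚ
    antisymmetrized σ v P = ∑ (stabilizer c) (λ β → sgn β *ℚ v (tact σ (tact β P)))

    tact-transpose : ∀ {g} → isPerm g ≡ true → ∀ a b P → tact g (act (transpose a b) P) ≡ tact (g ∘T tabOf (transpose a b)) P
    tact-transpose {g} e a b P = sym (trans (tact-∘ g (tabOf τ) e (tabOf-isPerm τ) P) (cong (tact g) (tact-act (tabOf τ) τ P (tabOf-$ τ))))
      where
      τ = transpose a b

    antisymmetrized-Signed : ∀ σ v {a b} → a ≢ b → c a ≡ c b → Signed (- 1ℚ) a b (antisymmetrized σ v)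
    antisymmetrized-Signed σ v {a} {b} n e .sign {P} M = begin
      ∑ C (λ β → sgn β *ℚ v (tact σ (tact β (act (transpose a b) P)))) ≡⟨ ∑-cong C (λ {β} i → term β (stabilizer-isPerm i)) ⟩
      ∑ C (λ β → f (β ∘T t)) ≡⟨ ∑-stabilizer a b e f ⟩
      ∑ C f ≡⟨ ∑-* (- 1ℚ) (λ β → sgn β *ℚ v (tact σ (tact β P))) C ⟩
      - 1ℚ *ℚ antisymmetrized σ v P ∎
      where
      open ≡-Reasoning
      C = stabilizer c
      t = tabOf (transpose a b)
      f : Tab m → ℚ
      f β = - 1ℚ *ℚ (sgn β *ℚ v (tact σ (tact β P)))
      term : ∀ β → isPerm β ≡ true → sgn β *ℚ v (tact σ (tact β (act (transpose a b) P))) ≡ f (β ∘T t)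
      term β eβ = trans (cong (λ R → sgn β *ℚ v (tact σ R)) (tact-transpose eβ a b P))
        (trans (solve 2 (λ s w → s :* w := (:- con 1ℚ) :* ((:- s) :* w)) refl (sgn β) w)
          (cong (λ s → - 1ℚ *ℚ (s *ℚ w)) (sym (sgn-transpose β eβ a b n))))
        where
        w = v (tact σ (tact (β ∘T t) P))

    symmetrized : (Tab m → ℚ) → Tab m → ℚ
    symmetrized u P = ∑ (stabilizer c) (λ α → u (tact α P))

    symmetrized-Signed : ∀ u {a b} → c a ≡ c b → Signed 1ℚ a b (symmetrized u)
    symmetrized-Signed u {a} {b} e .sign {P} M = begin
      ∑ (stabilizer c) (λ α → u (tact α (act (transpose a b) P))) ≡⟨ ∑-cong (stabilizer c) (λ {α} i → cong u (tact-transpose (stabilizer-isPerm i) a b P)) ⟩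
      ∑ (stabilizer c) (λ α → u (tact (α ∘T t) P)) ≡⟨ ∑-stabilizer a b e (λ α → u (tact α P)) ⟩
      symmetrized u P ≡⟨ ℚₚ.*-identityˡ _ ⟨
      1ℚ *ℚ symmetrized u P ∎
      where
      open ≡-Reasoning
      t = tabOf (transpose a b)

  -- Translations preserve sums over all matchings, so the total is a multiple of the sum of signs
  -- over the column group, which cancels in pairs β, β (a b). The function is thus orthogonal to
  -- the constants, the [n]-eigenspace.
  ∑-symmetrized : ∀ {c d : Fin m → ℕ} σ v {a b} → a ≢ b → d a ≡ d b →
                  ∑ (mats m) (symmetrized {c} (antisymmetrized {d} σ v)) ≡ 0ℚ
  ∑-symmetrized {c} {d} σ v n e = begin
    ∑ (mats m) (λ P → ∑ R (λ α → u (tact α P))) ≡⟨ ∑-swap (λ P α → u (tact α P)) (mats m) R ⟩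
    ∑ R (λ α → ∑ (mats m) (λ P → u (tact α P))) ≡⟨ ∑-≡0 R (λ {α} _ → trans (∑-tact α u) vanish) ⟩
    0ℚ ∎
    where
    open ≡-Reasoning
    R = stabilizer c
    u = antisymmetrized {d} σ v
    vanish : ∑ (mats m) u ≡ 0ℚ
    vanish = begin
      ∑ (mats m) (λ P → ∑ (stabilizer d) (λ β → sgn β *ℚ v (tact σ (tact β P)))) ≡⟨ ∑-swap (λ P β → sgn β *ℚ v (tact σ (tact β P))) (mats m) (stabilizer d) ⟩
      ∑ (stabilizer d) (λ β → ∑ (mats m) (λ P → sgn β *ℚ v (tact σ (tact β P)))) ≡⟨ ∑-cong (stabilizer d) (λ {β} _ → trans (∑-* (sgn β) (λ P → v (tact σ (tact β P))) (mats m))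
                                                                                        (trans (cong (sgn β *ℚ_) (trans (∑-tact β (v ∘ tact σ)) (∑-tact σ v))) (ℚₚ.*-comm (sgn β) (∑ (mats m) v)))) ⟩
      ∑ (stabilizer d) (λ β → ∑ (mats m) v *ℚ sgn β) ≡⟨ ∑-* (∑ (mats m) v) sgn (stabilizer d) ⟩
      ∑ (mats m) v *ℚ ∑ (stabilizer d) sgn ≡⟨ cong (∑ (mats m) v *ℚ_) (∑-sgn n e) ⟩
      ∑ (mats m) v *ℚ 0ℚ ≡⟨ ℚₚ.*-zeroʳ (∑ (mats m) v) ⟩
      0ℚ ∎

  -- The inner product of v with the indicator of g P is v(g P), which moves the group elements into
  -- the argument of v. With the row sum outermost, the inner sum is `antisymmetrized`.
  ⟪⟫-youngVec : ∀ (v : Tab m → ℚ) (C R : List (Tab m)) σ → isPerm σ ≡ true →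
    (∀ {β} → β ∈ C → isPerm β ≡ true) → (∀ {α} → α ∈ R → isPerm α ≡ true) → ∀ {P} → Matching P →
    ⟪ v , (λ Q → ∑ C (λ β → ∑ R (λ α → sgn β *ℚ indic (actsTo (σ ∘T (β ∘T α)) P Q)))) ⟫
      ≡ ∑ R (λ α → ∑ C (λ β → sgn β *ℚ v (tact σ (tact β (tact α P)))))
  ⟪⟫-youngVec v C R σ eσ eC eR {P} M = begin
    ∑ (mats m) (λ Q → v Q *ℚ ∑ C (λ β → ∑ R (λ α → sgn β *ℚ indic (actsTo (g β α) P Q))))
      ≡⟨ ∑-cong (mats m) (λ {Q} _ → trans (sym (∑-* (v Q) (λ β → ∑ R (λ α → sgn β *ℚ indic (actsTo (g β α) P Q))) C))
           (∑-cong C (λ {β} _ → sym (∑-* (v Q) (λ α → sgn β *ℚ indic (actsTo (g β α) P Q)) R)))) ⟩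
    ∑ (mats m) (λ Q → ∑ C (λ β → ∑ R (λ α → v Q *ℚ (sgn β *ℚ indic (actsTo (g β α) P Q)))))
      ≡⟨ ∑-swap (λ Q β → ∑ R (λ α → v Q *ℚ (sgn β *ℚ indic (actsTo (g β α) P Q)))) (mats m) C ⟩
    ∑ C (λ β → ∑ (mats m) (λ Q → ∑ R (λ α → v Q *ℚ (sgn β *ℚ indic (actsTo (g β α) P Q)))))
      ≡⟨ ∑-cong C (λ {β} _ → ∑-swap (λ Q α → v Q *ℚ (sgn β *ℚ indic (actsTo (g β α) P Q))) (mats m) R) ⟩
    ∑ C (λ β → ∑ R (λ α → ∑ (mats m) (λ Q → v Q *ℚ (sgn β *ℚ indic (actsTo (g β α) P Q)))))
      ≡⟨ ∑-cong C (λ {β} i → ∑-cong R (λ {α} j → term β α (eC i) (eR j))) ⟩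
    ∑ C (λ β → ∑ R (λ α → sgn β *ℚ v (tact σ (tact β (tact α P)))))
      ≡⟨ ∑-swap (λ β α → sgn β *ℚ v (tact σ (tact β (tact α P)))) C R ⟩
    ∑ R (λ α → ∑ C (λ β → sgn β *ℚ v (tact σ (tact β (tact α P))))) ∎
    where
    open ≡-Reasoning
    g : Tab m → Tab m → Tab m
    g β α = σ ∘T (β ∘T α)
    term : ∀ β α → isPerm β ≡ true → isPerm α ≡ true →
           ∑ (mats m) (λ Q → v Q *ℚ (sgn β *ℚ indic (actsTo (g β α) P Q))) ≡ sgn β *ℚ v (tact σ (tact β (tact α P)))
    term β α eβ eα = trans (∑-cong (mats m) (λ {Q} _ → solve 3 (λ v s i → v :* (s :* i) := s :* (v :* i)) refl (v Q) (sgn β) (indic (actsTo (g β α) P Q))))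
      (trans (∑-* (sgn β) (λ Q → v Q *ℚ indic (actsTo (g β α) P Q)) (mats m))
        (cong (sgn β *ℚ_) (trans (∑-actsTo v (g β α) (∘T-isPerm σ (β ∘T α) eσ eβα) M)
          (cong v (trans (tact-∘ σ (β ∘T α) eσ eβα P) (cong (tact σ) (tact-∘ β α eβ eα P)))))))
      where
      eβα = ∘T-isPerm β α eβ eα

rowKey colKey : (m : ℕ) → List ℕ → Fin m → ℕ
rowKey m ν x = rowOf ν (toℕ x)
colKey m ν x = colOf ν (toℕ x)

-- What is retained of membership in the λ-eigenspace: v stays non-zero after antisymmetrizing over
-- columns and then symmetrizing over rows. Both operations preserve eigenfunctions of `rel`.
record Pairing {m} (ν : List ℕ) (v : Tab m → ℚ) : Set where
  field
    labelling : Tab m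
    base      : Tab m
    baseM     : Matching base
    nonzero   : symmetrized {c = rowKey m ν} (antisymmetrized {c = colKey m ν} labelling v) base ≢ 0ℚ

-- In ⟨v,v⟩ ≠ 0 one copy of v is expanded in the generators of the eigenspace; some generator must
-- then have non-zero inner product with v.
eigenspace-pairing : ∀ n (λp : Partition n) v → InEigenspace n λp v → ∀ {P} → IsMatching P → v P ≢ 0ℚ →
  Pairing (double (parts λp)) v
eigenspace-pairing n λp v (gs , span) {P} M v≢0 = found (∑-≢0 gs (λ e → ⟪⟫≢0 {f = v} (isMatching⁻ P M) v≢0 (trans expand e)))
  where
  ν = double (parts λp)
  y : Generator n → Tab (2 * n) → ℚ
  y g = youngVec {n} (parts λp) (Generator.perm g) (Generator.match g)
  expand : ⟪ v , v ⟫ ≡ ∑ gs (λ g → Generator.coeff g *ℚ ⟪ v , y g ⟫)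
  expand = begin
    ∑ (mats (2 * n)) (λ Q → v Q *ℚ v Q)
      ≡⟨ ∑-cong (mats (2 * n)) (λ {Q} i → cong (v Q *ℚ_) (span Q (isMatching⁺ (mats⇒matching i)))) ⟩
    ∑ (mats (2 * n)) (λ Q → v Q *ℚ ∑ gs (λ g → Generator.coeff g *ℚ y g Q))
      ≡⟨ ∑-cong (mats (2 * n)) (λ {Q} _ → trans (sym (∑-* (v Q) (λ g → Generator.coeff g *ℚ y g Q) gs))
           (∑-cong gs (λ {g} _ → solve 3 (λ v c y → v :* (c :* y) := c :* (v :* y)) refl (v Q) (Generator.coeff g) (y g Q)))) ⟩
    ∑ (mats (2 * n)) (λ Q → ∑ gs (λ g → Generator.coeff g *ℚ (v Q *ℚ y g Q)))
      ≡⟨ ∑-swap (λ Q g → Generator.coeff g *ℚ (v Q *ℚ y g Q)) (mats (2 * n)) gs ⟩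
    ∑ gs (λ g → ∑ (mats (2 * n)) (λ Q → Generator.coeff g *ℚ (v Q *ℚ y g Q)))
      ≡⟨ ∑-cong gs (λ {g} _ → ∑-* (Generator.coeff g) (λ Q → v Q *ℚ y g Q) (mats (2 * n))) ⟩
    ∑ gs (λ g → Generator.coeff g *ℚ ⟪ v , y g ⟫) ∎
    where
    open ≡-Reasoning
  found : (∃[ g ] g ∈ gs × Generator.coeff g *ℚ ⟪ v , y g ⟫ ≢ 0ℚ) → Pairing ν v
  found (gen c σ eσ Q MQ , _ , nz) = record { labelling = σ ; base = Q ; baseM = isMatching⁻ Q MQ ; nonzero = λ e → nz (trans (cong (c *ℚ_) (trans
    (⟪⟫-youngVec v (colGroup (2 * n) ν) (rowGroup (2 * n) ν) σ eσ
      (stabilizer-isPerm {c = colKey (2 * n) ν}) (stabilizer-isPerm {c = rowKey (2 * n) ν}) (isMatching⁻ Q MQ)) e)) (ℚₚ.*-zeroʳ c)) }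

module _ {m : ℕ} (rel : Tab m → Tab m → Bool)
         (rel-act : ∀ π {P Q} → Matching P → Matching Q → rel (act π P) (act π Q) ≡ rel P Q) where

  open Scheme rel rel-act

  Eig-tact : ∀ {a y} → Eig a y → ∀ g → Eig a (y ∘ tact g)
  Eig-tact E g with isPerm g Data.Bool.≟ true
  ... | yes e = Eig-act E (ofTab g e)
  ... | no  _ = E

  Eig-antisymmetrized : ∀ {a v c} → Eig a v → ∀ σ → Eig a (antisymmetrized {c = c} σ v)
  Eig-antisymmetrized {v = v} {c} E σ = Eig-∑ (stabilizer c) sgn (λ β P → v (tact σ (tact β P))) (λ {β} _ → Eig-tact (Eig-tact E σ) β)

  Eig-symmetrized : ∀ {a u c} → Eig a u → Eig a (symmetrized {c = c} u)
  Eig-symmetrized {u = u} {c} E = Eig-cong (λ P → ∑-cong (stabilizer c) (λ {α} _ → ℚₚ.*-identityˡ (u (tact α P))))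
    (Eig-∑ (stabilizer c) (λ _ → 1ℚ) (λ α → u ∘ tact α) (λ {α} _ → Eig-tact E α))

-- Eigenvalues outside [n] and [n-1,1]

data Cell : List ℕ → ℕ → ℕ → Set where
  first : ∀ {p ps c} → c < p → Cell (p ∷ ps) 0 c
  below : ∀ {p ps r c} → Cell ps r c → Cell (p ∷ ps) (suc r) c

position : ∀ {ν r c} → Cell ν r c → ℕ
position (first {c = c} _) = c
position (below {p} x)     = p + position x

position< : ∀ {ν r c} (x : Cell ν r c) → position x < sum ν
position< (first {p} {ps} l) = ℕₚ.<-≤-trans l (ℕₚ.m≤m+n p (sum ps))
position< (below {p} x)      = ℕₚ.+-monoʳ-< p (position< x)

rowCol-position : ∀ {ν r c} (x : Cell ν r c) → rowCol ν (position x) ≡ (r , c)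
rowCol-position (first {p} {ps} {c} l) with c <ᵇ p | Equivalence.to T-≡ (ℕₚ.<⇒<ᵇ l)
... | .true | refl = refl
rowCol-position (below {p} {ps} {r} {c} x) with (p + position x) <ᵇ p in eq
... | true  = ⊥-elim (ℕₚ.m+n≮m p (position x) (ℕₚ.<ᵇ⇒< (p + position x) p (Equivalence.from T-≡ eq)))
... | false rewrite ℕₚ.m+n∸m≡n p (position x) with rowCol ps (position x) | rowCol-position x
...   | .(r , c) | refl = refl

sum-double : ∀ xs → sum (double xs) ≡ 2 * sum xs
sum-double []       = refl
sum-double (x ∷ xs) = trans (cong (2 * x +_) (sum-double xs)) (sym (ℕₚ.*-distribˡ-+ 2 x (sum xs)))

module _ {ν m} (size : sum ν ≡ m) where

  point : ∀ {r c} → Cell ν r c → Fin m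
  point x = fromℕ< (subst (position x <_) size (position< x))

  toℕ-point : ∀ {r c} (x : Cell ν r c) → toℕ (point x) ≡ position x
  toℕ-point x = toℕ-fromℕ< _

  rowCol-point : ∀ {r c} (x : Cell ν r c) → rowCol ν (toℕ (point x)) ≡ (r , c)
  rowCol-point x = trans (cong (rowCol ν) (toℕ-point x)) (rowCol-position x)

  point-injective : ∀ {r c r′ c′} (x : Cell ν r c) (y : Cell ν r′ c′) → point x ≡ point y → (r , c) ≡ (r′ , c′)
  point-injective x y e = trans (sym (rowCol-point x)) (trans (cong (rowCol ν ∘ toℕ) e) (rowCol-point y))

  point-≢ : ∀ {r c r′ c′} (x : Cell ν r c) (y : Cell ν r′ c′) → (r , c) ≢ (r′ , c′) → point x ≢ point y
  point-≢ x y n e = n (point-injective x y e)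

  point-column : ∀ {r r′ c} (x : Cell ν r c) (y : Cell ν r′ c) → colKey m ν (point x) ≡ colKey m ν (point y)
  point-column x y = trans (cong proj₂ (rowCol-point x)) (sym (cong proj₂ (rowCol-point y)))

∃≢0? : ∀ {A : Set} (f : A → ℚ) xs → (∃[ x ] x ∈ xs × f x ≢ 0ℚ) ⊎ (∀ {x} → x ∈ xs → f x ≡ 0ℚ)
∃≢0? f []       = inj₂ λ ()
∃≢0? f (x ∷ xs) with f x ℚₚ.≟ 0ℚ | ∃≢0? f xs
... | no  n | _                 = inj₁ (x , here refl , n)
... | yes _ | inj₁ (y , i , n)  = inj₁ (y , there i , n)
... | yes e | inj₂ h            = inj₂ λ where
  (here refl) → e
  (there i)   → h i

-- If y is antisymmetric under (a c), then y cannot be invariant under (c g): the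
-- transposition (a g) is conjugate to (c g) under (a c) and to (a c) under (c g).
invariant⇒zero : ∀ {m} {a c g : Fin m} {y : Tab m → ℚ} → a ≢ c → a ≢ g → c ≢ g →
                 Signed (- 1ℚ) a c y → Signed 1ℚ c g y → ∀ {P} → Matching P → y P ≡ 0ℚ
invariant⇒zero {m} {a} {c} {g} {y} ac ag cg anti symm {P} M = x≡-x⇒x≡0 (y P) (trans (sym plus) (trans (cong y (sym same)) minus))
  where
  open ≡-Reasoning
  A C G : Tab m → Tab m
  A = act (transpose a c)
  C = act (transpose c g)
  G = act (transpose a g)
  mA : ∀ {P} → Matching P → Matching (A P)
  mA = act-matching (transpose a c)
  mC : ∀ {P} → Matching P → Matching (C P)
  mC = act-matching (transpose c g)
  same : C (A (C P)) ≡ A (C (A P))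
  same = trans (trans (act-transpose-conj (transpose c g) a c (C P))
      (cong₂ (λ u v → act (transpose u v) (C (C P))) (transpose-other c g ac ag) (transpose-left c g)))
    (trans (cong G (trans (act-transpose² c g P) (sym (act-transpose² a c P))))
      (sym (trans (act-transpose-conj (transpose a c) c g (A P))
        (cong₂ (λ u v → act (transpose u v) (A (A P))) (transpose-right a c) (transpose-other a c (ag ∘ sym) (cg ∘ sym))))))
  plus : y (A (C (A P))) ≡ y P
  plus = trans (sign anti (mC (mA M))) (trans (cong (- 1ℚ *ℚ_) (trans (sign symm (mA M)) (cong (1ℚ *ℚ_) (sign anti M))))
    (solve 1 (λ u → (:- con 1ℚ) :* (con 1ℚ :* ((:- con 1ℚ) :* u)) := u) refl (y P)))
  minus : y (C (A (C P))) ≡ - y P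
  minus = trans (sign symm (mA (mC M))) (trans (cong (1ℚ *ℚ_) (trans (sign anti (mC M)) (cong (- 1ℚ *ℚ_) (sign symm M))))
    (solve 1 (λ u → con 1ℚ :* ((:- con 1ℚ) :* (con 1ℚ :* u)) := :- u) refl (y P)))

list-lookup-injective : ∀ {A : Set} {xs : List A} → Unique xs → ∀ i j → Data.List.lookup xs i ≡ Data.List.lookup xs j → i ≡ j
list-lookup-injective (_ ∷ _)  zero    zero    e = refl
list-lookup-injective {xs = _ ∷ xs} (u ∷ _)  zero    (suc j) e = ⊥-elim (All.lookup u (∈-lookup {xs = xs} j) e)
list-lookup-injective {xs = _ ∷ xs} (u ∷ _)  (suc i) zero    e = ⊥-elim (All.lookup u (∈-lookup {xs = xs} i) (sym e))
list-lookup-injective (_ ∷ us) (suc i) (suc j) e = cong suc (list-lookup-injective us i j e)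

∉⇒All : ∀ {A : Set} {x : A} {xs} → x ∉ xs → All (x ≢_) xs
∉⇒All {xs = xs} n = All.tabulate (λ i e → n (subst (_∈ xs) (sym e) i))

module Antisymmetry {m : ℕ} (rel : Tab m → Tab m → Bool)
         (rel-act : ∀ π {P Q} → Matching P → Matching Q → rel (act π P) (act π Q) ≡ rel P Q) where

  open Scheme rel rel-act
  open Spread rel rel-act

  record Nonzero (a : ℚ) (y : Tab m → ℚ) : Set where
    field
      isEig : Eig a y
      at    : Tab m
      atM   : Matching at
      value : y at ≢ 0ℚ

  twist : Fin m → Fin m → (Tab m → ℚ) → Tab m → ℚ
  twist c g y P = y P +ℚ (- 1ℚ) *ℚ y (act (transpose c g) P)

  twist-anti : ∀ c g y → Signed (- 1ℚ) c g (twist c g y)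
  twist-anti c g y .sign {P} M = trans (cong (λ R → y (act (transpose c g) P) +ℚ (- 1ℚ) *ℚ y R) (act-transpose² c g P))
    (solve 2 (λ u v → u :+ (:- con 1ℚ) :* v := (:- con 1ℚ) :* (v :+ (:- con 1ℚ) :* u)) refl (y (act (transpose c g) P)) (y P))

  twist-Signed : ∀ {ε a b c g y} → a ≢ c → a ≢ g → b ≢ c → b ≢ g → Signed ε a b y → Signed ε a b (twist c g y)
  twist-Signed {ε} {a} {b} {c} {g} {y} ac ag bc bg s .sign {P} M = trans
    (cong₂ (λ u v → u +ℚ (- 1ℚ) *ℚ v) (sign s M) (trans (cong y (sym (transpose-comm a b c g ac ag bc bg P))) (sign s (act-matching (transpose c g) M))))
    (solve 3 (λ e u v → e :* u :+ (:- con 1ℚ) :* (e :* v) := e :* (u :+ (:- con 1ℚ) :* v)) refl ε (y P) (y (act (transpose c g) P)))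

  -- A vanishing twist would mean that y is invariant under (c g); being antisymmetric under (a c),
  -- y would vanish by `invariant⇒zero`.
  twist-Nonzero : ∀ {α a c g y} → a ≢ c → a ≢ g → c ≢ g → Signed (- 1ℚ) a c y → Nonzero α y → Nonzero α (twist c g y)
  twist-Nonzero {α} {a} {c} {g} {y} ac ag cg s N with ∃≢0? (twist c g y) (mats m)
  ... | inj₁ (P , i , n) = record { isEig = Eig-+ (Nonzero.isEig N) (Eig-act (Nonzero.isEig N) (transpose c g)) (- 1ℚ)
                                  ; at = P ; atM = mats⇒matching i ; value = n }
  ... | inj₂ h = ⊥-elim (Nonzero.value N (invariant⇒zero ac ag cg s (signed λ {P} M →
          trans (sym (ℚₚ.+-identityˡ _)) (trans (cong (_+ℚ y (act (transpose c g) P)) (sym (h (∈-mats M))))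
            (solve 2 (λ u v → (u :+ (:- con 1ℚ) :* v) :+ v := con 1ℚ :* u) refl (y P) (y (act (transpose c g) P))))) (Nonzero.atM N)))

  module _ (q : ℕ) (enough : 2 * (8 + q * 4) ≤ m) where

    Bound : ℚ → Set
    Bound a = ι (suc q ^ 4) *ℚ (a *ℚ a) ≤ℚ relatedPairs

    bound : ∀ {α y} → Nonzero α y → (p : Fin 4 × Bool → Fin m) → (∀ {u v} → p u ≡ p v → u ≡ v) →
            (∀ j → Signed (- 1ℚ) (p (j , false)) (p (j , true)) y) → Bound α
    bound N p inj anti = antisymmetric-bound (Nonzero.isEig N) (Nonzero.atM N) (Nonzero.value N) p inj anti q enough

    -- Twisting by (c g) and (f h) turns the two triples a b c and d e f into the four
    -- disjoint antisymmetric pairs a b, c g, d e, f h.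
    two-triples-bound : ∀ {α y a b c d e f} → Nonzero α y → Unique (a ∷ b ∷ c ∷ d ∷ e ∷ f ∷ []) →
      Signed (- 1ℚ) a b y → Signed (- 1ℚ) a c y → Signed (- 1ℚ) d e y → Signed (- 1ℚ) d f y → Bound α
    two-triples-bound {α} {y} {a} {b} {c} {d} {e} {f} N
      six@((ab ∷ ac ∷ ad ∷ ae ∷ af ∷ []) ∷ (bc ∷ bd ∷ be ∷ bf ∷ []) ∷ (cd ∷ ce ∷ cf ∷ []) ∷ (de ∷ df ∷ []) ∷ (ef ∷ []) ∷ _)
      sab sac sde sdf
      with fresh (a ∷ b ∷ c ∷ d ∷ e ∷ f ∷ []) (ℕₚ.<-≤-trans (s≤s (s≤s (s≤s (s≤s (s≤s (s≤s (s≤s z≤n))))))) (ℕₚ.≤-trans (ℕₚ.m≤m+n 16 _) (subst (_≤ m) (ℕₚ.*-distribˡ-+ 2 8 (q * 4)) enough)))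
    ... | g , g∉ with fresh (g ∷ a ∷ b ∷ c ∷ d ∷ e ∷ f ∷ []) (ℕₚ.<-≤-trans (s≤s (s≤s (s≤s (s≤s (s≤s (s≤s (s≤s (s≤s z≤n)))))))) (ℕₚ.≤-trans (ℕₚ.m≤m+n 16 _) (subst (_≤ m) (ℕₚ.*-distribˡ-+ 2 8 (q * 4)) enough)))
    ...   | h , h∉ = bound N₂ p p-injective anti
      where
      L : List (Fin m)
      L = h ∷ g ∷ a ∷ b ∷ c ∷ d ∷ e ∷ f ∷ []
      ga : a ≢ g
      ga r = g∉ (here (sym r))
      gb : b ≢ g
      gb r = g∉ (there (here (sym r)))
      gc : c ≢ g
      gc r = g∉ (there (there (here (sym r))))
      gd : d ≢ g
      gd r = g∉ (there (there (there (here (sym r)))))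
      ge : e ≢ g
      ge r = g∉ (there (there (there (there (here (sym r))))))
      gf : f ≢ g
      gf r = g∉ (there (there (there (there (there (here (sym r)))))))
      hg : g ≢ h
      hg r = h∉ (here (sym r))
      ha : a ≢ h
      ha r = h∉ (there (here (sym r)))
      hb : b ≢ h
      hb r = h∉ (there (there (here (sym r))))
      hc : c ≢ h
      hc r = h∉ (there (there (there (here (sym r)))))
      hd : d ≢ h
      hd r = h∉ (there (there (there (there (here (sym r))))))
      he : e ≢ h
      he r = h∉ (there (there (there (there (there (here (sym r)))))))
      hf : f ≢ h
      hf r = h∉ (there (there (there (there (there (there (here (sym r))))))))
      y₁ y₂ : Tab m → ℚ
      y₁ = twist c g y
      y₂ = twist f h y₁
      N₂ : Nonzero α y₂
      N₂ = twist-Nonzero df hd hf (twist-Signed (cd ∘ sym) gd (cf ∘ sym) gf sdf) (twist-Nonzero ac ga gc sac N)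
      -- Positions in `L` of the pairs a b, c g, d e, f h. With `unindex` as a left inverse,
      -- injectivity of `p` follows from `L` having no repetitions.
      index : Fin 4 × Bool → Fin 8
      index (zero , false)                 = suc (suc zero)
      index (zero , true)                  = suc (suc (suc zero))
      index (suc zero , false)             = suc (suc (suc (suc zero)))
      index (suc zero , true)              = suc zero
      index (suc (suc zero) , false)       = suc (suc (suc (suc (suc zero))))
      index (suc (suc zero) , true)        = suc (suc (suc (suc (suc (suc zero)))))
      index (suc (suc (suc zero)) , false) = suc (suc (suc (suc (suc (suc (suc zero))))))
      index (suc (suc (suc zero)) , true)  = zero
      unindex : Fin 8 → Fin 4 × Bool
      unindex i = lookup ((suc (suc (suc zero)) , true) ∷ (suc zero , true) ∷ (zero , false) ∷ (zero , true) ∷ (suc zero , false)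
                          ∷ (suc (suc zero) , false) ∷ (suc (suc zero) , true) ∷ (suc (suc (suc zero)) , false) ∷ []) i
      unindex-index : ∀ u → unindex (index u) ≡ u
      unindex-index (zero , false)                 = refl
      unindex-index (zero , true)                  = refl
      unindex-index (suc zero , false)             = refl
      unindex-index (suc zero , true)              = refl
      unindex-index (suc (suc zero) , false)       = refl
      unindex-index (suc (suc zero) , true)        = refl
      unindex-index (suc (suc (suc zero)) , false) = refl
      unindex-index (suc (suc (suc zero)) , true)  = refl
      p : Fin 4 × Bool → Fin m
      p u = Data.List.lookup L (index u)
      L-unique : Unique L
      L-unique = ∉⇒All h∉ ∷ ∉⇒All g∉ ∷ six
      p-injective : ∀ {u v} → p u ≡ p v → u ≡ v
      p-injective {u} {v} r = trans (sym (unindex-index u)) (trans (cong unindex (list-lookup-injective L-unique (index u) (index v) r)) (unindex-index v))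
      anti : ∀ j → Signed (- 1ℚ) (p (j , false)) (p (j , true)) y₂
      anti zero                   = twist-Signed af ha bf hb (twist-Signed ac ga bc gb sab)
      anti (suc zero)             = twist-Signed cf hc (gf ∘ sym) hg (twist-anti c g y)
      anti (suc (suc zero))       = twist-Signed df hd ef he (twist-Signed (cd ∘ sym) gd (ce ∘ sym) ge sde)
      anti (suc (suc (suc zero))) = twist-anti f h y₁

  module _ {ν} (size : sum ν ≡ m) {α v} (E : Eig α v) (𝒫 : Pairing ν v) where

    open Pairing 𝒫

    column-vector : Tab m → ℚ
    column-vector = antisymmetrized {c = colKey m ν} labelling v

    -- A non-zero sum over the row group has a non-zero term, so the column antisymmetrization by
    -- itself is non-zero at a translate of `base`.
    column-Nonzero : Nonzero α column-vector
    column-Nonzero with ∑-≢0 (stabilizer (rowKey m ν)) nonzero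
    ... | g , _ , h = record { isEig = Eig-antisymmetrized rel rel-act {c = colKey m ν} E labelling
                             ; at = tact g base ; atM = tact-matching g baseM ; value = h }

    column-anti : ∀ {r r′ c} (x : Cell ν r c) (y : Cell ν r′ c) → r ≢ r′ →
                  Signed (- 1ℚ) (point size x) (point size y) column-vector
    column-anti x y n = antisymmetrized-Signed {c = colKey m ν} labelling v (point-≢ size x y (n ∘ cong proj₁)) (point-column size x y)

  -- Columns 0 to 3 all meet the first two rows and supply the four antisymmetric pairs.
  two-rows-bound : ∀ {p₁ p₂ ps} (q : ℕ) (enough : 2 * (8 + q * 4) ≤ m) → let ν = p₁ ∷ p₂ ∷ ps in
    sum ν ≡ m → 4 ≤ p₁ → 4 ≤ p₂ → ∀ {α v} → Eig α v → Pairing ν v → Bound q enough α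
  two-rows-bound {p₁} {p₂} {ps} q enough size l₁ l₂ E 𝒫 =
    bound q enough (column-Nonzero size E 𝒫) p p-injective (λ j → column-anti size E 𝒫 (top j) (bottom j) λ ())
    where
    ν = p₁ ∷ p₂ ∷ ps
    top : ∀ (j : Fin 4) → Cell ν 0 (toℕ j)
    top j = first (ℕₚ.<-≤-trans (toℕ<n j) l₁)
    bottom : ∀ (j : Fin 4) → Cell ν 1 (toℕ j)
    bottom j = below (first (ℕₚ.<-≤-trans (toℕ<n j) l₂))
    p : Fin 4 × Bool → Fin m
    p (j , false) = point size (top j)
    p (j , true)  = point size (bottom j)
    p-injective : ∀ {u v} → p u ≡ p v → u ≡ v
    p-injective {i , false} {j , false} e = cong (_, false) (toℕ-injective (cong proj₂ (point-injective size (top i) (top j) e)))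
    p-injective {i , false} {j , true}  e = ⊥-elim (point-≢ size (top i) (bottom j) (λ ()) e)
    p-injective {i , true}  {j , false} e = ⊥-elim (point-≢ size (bottom i) (top j) (λ ()) e)
    p-injective {i , true}  {j , true}  e = cong (_, true) (toℕ-injective (cong proj₂ (point-injective size (bottom i) (bottom j) e)))

  -- The two triples are the top three cells of columns 0 and 1.
  three-rows-bound : ∀ {p₁ p₂ p₃ ps} (q : ℕ) (enough : 2 * (8 + q * 4) ≤ m) → let ν = p₁ ∷ p₂ ∷ p₃ ∷ ps in
    sum ν ≡ m → 2 ≤ p₁ → 2 ≤ p₂ → 2 ≤ p₃ → ∀ {α v} → Eig α v → Pairing ν v → Bound q enough α
  three-rows-bound {p₁} {p₂} {p₃} {ps} q enough size l₁ l₂ l₃ E 𝒫 =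
    two-triples-bound q enough (column-Nonzero size E 𝒫) six
      (column-anti size E 𝒫 a b λ ()) (column-anti size E 𝒫 a c λ ())
      (column-anti size E 𝒫 d e λ ()) (column-anti size E 𝒫 d f λ ())
    where
    ν = p₁ ∷ p₂ ∷ p₃ ∷ ps
    a : Cell ν 0 0
    a = first (ℕₚ.<-≤-trans (s≤s z≤n) l₁)
    b : Cell ν 1 0
    b = below (first (ℕₚ.<-≤-trans (s≤s z≤n) l₂))
    c : Cell ν 2 0
    c = below (below (first (ℕₚ.<-≤-trans (s≤s z≤n) l₃)))
    d : Cell ν 0 1
    d = first l₁
    e : Cell ν 1 1
    e = below (first l₂)
    f : Cell ν 2 1
    f = below (below (first l₃))
    ≢p : ∀ {r c r′ c′} (x : Cell ν r c) (y : Cell ν r′ c′) → (r , c) ≢ (r′ , c′) → point size x ≢ point size y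
    ≢p = point-≢ size
    six : Unique (point size a ∷ point size b ∷ point size c ∷ point size d ∷ point size e ∷ point size f ∷ [])
    six = (≢p a b (λ ()) ∷ ≢p a c (λ ()) ∷ ≢p a d (λ ()) ∷ ≢p a e (λ ()) ∷ ≢p a f (λ ()) ∷ [])
        ∷ (≢p b c (λ ()) ∷ ≢p b d (λ ()) ∷ ≢p b e (λ ()) ∷ ≢p b f (λ ()) ∷ [])
        ∷ (≢p c d (λ ()) ∷ ≢p c e (λ ()) ∷ ≢p c f (λ ()) ∷ [])
        ∷ (≢p d e (λ ()) ∷ ≢p d f (λ ()) ∷ []) ∷ (≢p e f (λ ()) ∷ []) ∷ [] ∷ []

module _ (n : ℕ) (rel : Tab (2 * n) → Tab (2 * n) → Bool)
         (rel-act : ∀ π {P Q} → Matching P → Matching Q → rel (act π P) (act π Q) ≡ rel P Q) where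

  open Scheme rel rel-act
  open Antisymmetry rel rel-act

  -- The second part decides. If it is at least 2, the first two rows of 2λ have length at least 4.
  -- If it is 1, then λ ≠ [n-1,1] forces a third part, which is again 1, and 2λ has three rows of
  -- length at least 2. The empty partition is excluded by `enough`.
  eigenvalue-bound-parts : ∀ (q : ℕ) (enough : 2 * (8 + q * 4) ≤ 2 * n) ps →
    All (1 ≤_) ps → Linked (λ a b → b ≤ a) ps → sum ps ≡ n → ¬ (ps ≡ n ∷ []) → ¬ (ps ≡ (n ∸ 1) ∷ 1 ∷ []) →
    ∀ {a v} → Eig a v → Pairing (double ps) v → Bound q enough a
  eigenvalue-bound-parts q enough [] _ _ refl _ _ E 𝒫 =
    ⊥-elim (ℕₚ.n≮0 (ℕₚ.≤-trans (ℕₚ.m≤m+n 16 _) (subst (_≤ 0) (ℕₚ.*-distribˡ-+ 2 8 (q * 4)) enough)))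
  eigenvalue-bound-parts q enough (p₁ ∷ []) _ _ e ¬n _ E 𝒫 = ⊥-elim (¬n (cong (_∷ []) (trans (sym (ℕₚ.+-identityʳ p₁)) e)))
  eigenvalue-bound-parts q enough (p₁ ∷ zero ∷ _) (_ ∷ () ∷ _)
  eigenvalue-bound-parts q enough (p₁ ∷ suc zero ∷ []) _ _ e _ ¬n-1 E 𝒫 =
    ⊥-elim (¬n-1 (cong (_∷ 1 ∷ []) (trans (sym (ℕₚ.m+n∸n≡m p₁ 1)) (cong (_∸ 1) e))))
  eigenvalue-bound-parts q enough (p₁ ∷ suc zero ∷ zero ∷ _) (_ ∷ _ ∷ () ∷ _)
  eigenvalue-bound-parts q enough (p₁ ∷ suc zero ∷ suc zero ∷ ps) (l ∷ _) _ e _ _ E 𝒫 = three-rows-bound q enough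
    (trans (sum-double (p₁ ∷ 1 ∷ 1 ∷ ps)) (cong (2 *_) e)) (ℕₚ.*-monoʳ-≤ 2 l) ℕₚ.≤-refl ℕₚ.≤-refl E 𝒫
  eigenvalue-bound-parts q enough (p₁ ∷ suc zero ∷ suc (suc _) ∷ ps) _ (_ ∷ s≤s () ∷ _)
  eigenvalue-bound-parts q enough (p₁ ∷ suc (suc p₂) ∷ ps) _ (l ∷ _) e _ _ E 𝒫 = two-rows-bound q enough
    (trans (sum-double (p₁ ∷ suc (suc p₂) ∷ ps)) (cong (2 *_) e))
    (ℕₚ.*-monoʳ-≤ 2 (ℕₚ.≤-trans (s≤s (s≤s z≤n)) l)) (ℕₚ.*-monoʳ-≤ 2 (s≤s (s≤s z≤n))) E 𝒫

  eigenvalue-bound : ∀ (q : ℕ) (enough : 2 * (8 + q * 4) ≤ 2 * n) (λp : Partition n) →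
    ¬ (parts λp ≡ n ∷ []) → ¬ (parts λp ≡ (n ∸ 1) ∷ 1 ∷ []) →
    ∀ {a v} → Eig a v → InEigenspace n λp v → ∀ {P} → IsMatching P → v P ≢ 0ℚ → Bound q enough a
  eigenvalue-bound q enough λp ¬n ¬n-1 {v = v} E I M v≢0 =
    eigenvalue-bound-parts q enough (parts λp) (positive λp) (decr λp) (Partition.total λp) ¬n ¬n-1 E (eigenspace-pairing n λp v I M v≢0)

-- The eigenvalue of [n-1,1]

x≤∣x∣ : ∀ x → x ≤ℚ ∣ x ∣
x≤∣x∣ x with ℚₚ.≤-total 0ℚ x
... | inj₁ p = ℚₚ.≤-reflexive (sym (ℚₚ.0≤p⇒∣p∣≡p p))
... | inj₂ p = ℚₚ.≤-trans p (ℚₚ.0≤∣p∣ x)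

-x≤∣x∣ : ∀ x → - x ≤ℚ ∣ x ∣
-x≤∣x∣ x = subst (- x ≤ℚ_) (ℚₚ.∣-p∣≡∣p∣ x) (x≤∣x∣ (- x))

0≤indic : ∀ b → 0ℚ ≤ℚ indic b
0≤indic true  = 0≤1
0≤indic false = ℚₚ.≤-refl

∑-indic : ∀ {m} (x : Fin m) → ∑ (allFin m) (λ j → indic (x ==F j)) ≡ 1ℚ
∑-indic {m} x = trans (∑-single (allFin⁺ m) (∈-allFin x) (λ n → cong indic (≢⇒==F (n ∘ sym)))) (cong indic (≡⇒==F {x = x} refl))

module _ {m : ℕ} {X : Set} (F : Tab m → X) where

  -- Swapping P x and P′ x makes P agree with P′ at x; neither point is one where P and
  -- P′ already agree, so the agreement set only grows.
  align : ∀ {P P′ : Tab m} → Matching P → Matching P′ → ∀ x →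
          (P $ x ≢ P′ $ x → F (act (transpose (P $ x) (P′ $ x)) P) ≡ F P) →
          ∃[ P₁ ] Matching P₁ × F P₁ ≡ F P × P₁ $ x ≡ P′ $ x × (∀ z → P $ z ≡ P′ $ z → P₁ $ z ≡ P′ $ z)
  align {P} {P′} M M′ x inv with P $ x Finₚ.≟ P′ $ x
  ... | yes e = P , M , refl , e , λ _ h → h
  ... | no  n = act τ P , act-matching τ M , inv n , here-x , keep
    where
    a = P $ x
    c = P′ $ x
    τ = transpose a c
    at-fixed : ∀ z → z ≢ a → z ≢ c → act τ P $ z ≡ τ ⟨$⟩ʳ (P $ z)
    at-fixed z za zc = trans (cong (act τ P $_) (sym (transpose-other a c za zc))) (act-$-ʳ τ P z)
    here-x : act τ P $ x ≡ c
    here-x = trans (at-fixed x (irreflexive M x ∘ sym) (irreflexive M′ x ∘ sym)) (transpose-left a c)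
    keep : ∀ z → P $ z ≡ P′ $ z → act τ P $ z ≡ P′ $ z
    keep z h = trans (at-fixed z za zc) (trans (transpose-other a c Pza Pzc) h)
      where
      za : z ≢ a
      za refl = n (sym (trans (cong (P′ $_) (sym (trans (sym h) (involutive M x)))) (involutive M′ a)))
      zc : z ≢ c
      zc refl = n (trans (cong (P $_) (sym (trans h (involutive M′ x)))) (involutive M c))
      z≢x : z ≢ x
      z≢x refl = n h
      Pza : P $ z ≢ a
      Pza e = z≢x (matching-injective M e)
      Pzc : P $ z ≢ c
      Pzc e = z≢x (matching-injective M′ (trans (sym h) e))

  -- P is aligned with P′ at one vertex x after another. The swapped points P x and P′ x lie outside
  -- A: at a point of A both matchings agree, so if one of the two lay in A, it would be the partner
  -- of x in both, and nothing would be swapped.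
  connect : ∀ (A : Fin m → Set) → (∀ {a c} → ¬ A a → ¬ A c → ∀ {P} → Matching P → F (act (transpose a c) P) ≡ F P) →
            ∀ {P P′ : Tab m} → Matching P → Matching P′ → (∀ x → A x → P $ x ≡ P′ $ x) → F P ≡ F P′
  connect A inv {P} {P′} M M′ agree with go (allFin m)
    where
    go : ∀ xs → ∃[ P₁ ] Matching P₁ × F P₁ ≡ F P × (∀ z → A z ⊎ z ∈ xs → P₁ $ z ≡ P′ $ z)
    go []       = P , M , refl , λ where z (inj₁ h) → agree z h
    go (x ∷ xs) with go xs
    ... | P₁ , M₁ , e₁ , h₁ with align {P₁} {P′} M₁ M′ x (λ n → inv
            (λ h → n (trans (sym (involutive M′ _)) (cong (P′ $_) (trans (sym (h₁ _ (inj₁ h))) (involutive M₁ x)))))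
            (λ h → n (trans (cong (P₁ $_) (sym (trans (h₁ _ (inj₁ h)) (involutive M′ x)))) (involutive M₁ _))) M₁)
    ...   | P₂ , M₂ , e₂ , hx , h₂ = P₂ , M₂ , trans e₂ e₁ , λ where
              z (inj₁ h)           → h₂ z (h₁ z (inj₁ h))
              z (inj₂ (here refl)) → hx
              z (inj₂ (there i))   → h₂ z (h₁ z (inj₂ i))
  ... | P₁ , _ , e , h = trans (sym e) (cong F (Tab-ext λ x → h x (inj₂ (∈-allFin x))))

  module _ {s t : Fin m} (s≢t : s ≢ t)
           (inv : ∀ {a c} → a ≢ s → a ≢ t → c ≢ s → c ≢ t → ∀ {P} → Matching P → F (act (transpose a c) P) ≡ F P) where

    connect-agree : ∀ {P P′ : Tab m} → Matching P → Matching P′ → P $ s ≡ P′ $ s → P $ t ≡ P′ $ t → F P ≡ F P′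
    connect-agree M M′ es et = connect (λ x → x ≡ s ⊎ x ≡ t)
      (λ na nc → inv (na ∘ inj₁) (na ∘ inj₂) (nc ∘ inj₁) (nc ∘ inj₂)) M M′
      (λ where x (inj₁ refl) → es
               x (inj₂ refl) → et)

    -- The symmetric group on the points other than s and t has two orbits on matchings, those with
    -- the edge {s,t} and those without. This lemma and the next show that F is constant on each.
    connect-with : ∀ {P P′ : Tab m} → Matching P → Matching P′ → P $ s ≡ t → P′ $ s ≡ t → F P ≡ F P′
    connect-with {P} {P′} M M′ e e′ = connect-agree M M′ (trans e (sym e′))
      (trans (cong (P $_) (sym e)) (trans (involutive M s) (trans (sym (involutive M′ s)) (cong (P′ $_) e′))))

    -- The edge at s is aligned first, then the edge at t. Since P′ and the matching being changed
    -- both lack {s,t}, the swapped points are never s or t.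
    connect-without : ∀ {P P′ : Tab m} → Matching P → Matching P′ → P $ s ≢ t → P′ $ s ≢ t → F P ≡ F P′
    connect-without {P} {P′} M M′ n n′ with align {P} {P′} M M′ s (λ _ → inv (irreflexive M s) n (irreflexive M′ s) n′ M)
    ... | P₁ , M₁ , e₁ , s₁ , _ with align {P₁} {P′} M₁ M′ t (λ _ → inv
              (λ e → n′ (trans (sym s₁) (trans (cong (P₁ $_) (sym e)) (involutive M₁ t)))) (irreflexive M₁ t)
              (λ e → n′ (trans (cong (P′ $_) (sym e)) (involutive M′ t))) (irreflexive M′ t) M₁)
    ...   | P₂ , M₂ , e₂ , t₂ , keep = trans (sym (trans e₂ e₁)) (connect-agree M₂ M′ (keep s s₁) t₂)

module Second {m : ℕ} (rel : Tab m → Tab m → Bool)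
         (rel-act : ∀ π {P Q} → Matching P → Matching Q → rel (act π P) (act π Q) ≡ rel P Q) where

  open Scheme rel rel-act

  valency : Tab m → ℚ
  valency P = ∑ (mats m) (row P)

  valency-act : ∀ π {P} → Matching P → valency (act π P) ≡ valency P
  valency-act π {P} M = trans (sym (∑-act π (row (act π P)))) (∑-cong (mats m) (λ i → cong indic (rel-act π M (mats⇒matching i))))

  valency-constant : ∀ {P P′} → Matching P → Matching P′ → valency P ≡ valency P′
  valency-constant M M′ = connect valency (λ _ → ⊥) (λ {a} {c} _ _ → valency-act (transpose a c)) M M′ (λ _ ())

  relatedPairs-valency : ∀ {P} → Matching P → relatedPairs ≡ ι (length (mats m)) *ℚ valency P
  relatedPairs-valency {P} M = trans (∑-cong (mats m) (λ i → valency-constant (mats⇒matching i) M)) (∑-const (valency P) (mats m))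

  -- Counts the neighbours of P containing the edge {x,y}. At s, t it gives the column for {s,t} of
  -- the 2 × 2 quotient matrix of `rel` on the two orbits.
  edges : Fin m → Fin m → Tab m → ℚ
  edges x y P = ∑ (mats m) (λ Q → row P Q *ℚ indic (Q $ x ==F y))

  0≤edges : ∀ x y P → 0ℚ ≤ℚ edges x y P
  0≤edges x y P = subst (_≤ℚ edges x y P) (∑-0 (mats m)) (∑-mono-≤ (mats m) (λ {Q} _ → both (rel P Q) (Q $ x ==F y)))
    where
    both : ∀ a b → 0ℚ ≤ℚ indic a *ℚ indic b
    both true  b = subst (0ℚ ≤ℚ_) (sym (ℚₚ.*-identityˡ (indic b))) (0≤indic b)
    both false b = ℚₚ.≤-reflexive (sym (ℚₚ.*-zeroˡ (indic b)))

  edges-act : ∀ π x y {P} → Matching P → edges (π ⟨$⟩ʳ x) (π ⟨$⟩ʳ y) (act π P) ≡ edges x y P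
  edges-act π x y {P} M = trans (sym (∑-act π (λ Q → row (act π P) Q *ℚ indic (Q $ (π ⟨$⟩ʳ x) ==F π ⟨$⟩ʳ y))))
    (∑-cong (mats m) (λ {Q} i → cong₂ (λ a b → indic a *ℚ indic b) (rel-act π M (mats⇒matching i)) (same Q)))
    where
    same : ∀ Q → (act π Q $ (π ⟨$⟩ʳ x) ==F π ⟨$⟩ʳ y) ≡ (Q $ x ==F y)
    same Q = ≡-from-⇔ (λ e → ≡⇒==F (perm-injective π (trans (sym (act-$-ʳ π Q x)) (==F⇒≡ e))))
                      (λ e → ≡⇒==F (trans (act-$-ʳ π Q x) (cong (π ⟨$⟩ʳ_) (==F⇒≡ e))))

  module Pair {s t : Fin m} (s≢t : s ≢ t) where

    edges-invariant : ∀ {a c} → a ≢ s → a ≢ t → c ≢ s → c ≢ t → ∀ {P} → Matching P → edges s t (act (transpose a c) P) ≡ edges s t P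
    edges-invariant {a} {c} as at cs ct {P} M = trans
      (cong₂ (λ x y → edges x y (act (transpose a c) P)) (sym (transpose-other a c (as ∘ sym) (cs ∘ sym))) (sym (transpose-other a c (at ∘ sym) (ct ∘ sym))))
      (edges-act (transpose a c) s t M)

    module _ {P₁ P₂ : Tab m} (M₁ : Matching P₁) (M₂ : Matching P₂) (e₁ : P₁ $ s ≡ t) (n₂ : P₂ $ s ≢ t) where

      α₁ α₂ : ℚ
      α₁ = edges s t P₁
      α₂ = edges s t P₂

      -- (j t) takes the edge {s,j} to {s,t}, and takes P₁ to a matching with the edge {s,j}, hence
      -- without {s,t}.
      edges-other : ∀ j → j ≢ s → j ≢ t → edges s j P₁ ≡ α₂
      edges-other j js jt = trans (trans (sym (edges-act τ s j M₁)) (cong₂ (λ x y → edges x y (act τ P₁)) τs (transpose-left j t)))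
        (connect-without (edges s t) s≢t edges-invariant (act-matching τ M₁) M₂
          (λ e → jt (trans (sym (trans (cong (τ ⟨$⟩ʳ_) e₁) (transpose-right j t))) (trans (sym (act-$-ʳ τ P₁ s)) (trans (cong (act τ P₁ $_) τs) e)))) n₂)
        where
        τ = transpose j t
        τs : τ ⟨$⟩ʳ s ≡ s
        τs = transpose-other j t (js ∘ sym) s≢t

      edges-self : edges s s P₁ ≡ 0ℚ
      edges-self = ∑-≡0 (mats m) (λ {Q} i → trans (cong (λ b → row P₁ Q *ℚ indic b) (≢⇒==F (irreflexive (mats⇒matching i) s))) (ℚₚ.*-zeroʳ (row P₁ Q)))

      -- Neighbours of P₁ are counted by their partner of s: t gives α₁, s itself gives 0, and each
      -- of the other m - 2 points gives α₂. The right-hand side is α₁ + (m - 2) α₂ without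
      -- subtraction in ℕ.
      valency-split : valency P₁ ≡ ι m *ℚ α₂ +ℚ ((α₁ -ℚ α₂) -ℚ α₂)
      valency-split = begin
        ∑ (mats m) (row P₁) ≡⟨ ∑-cong (mats m) (λ {Q} _ → trans (sym (ℚₚ.*-identityʳ (row P₁ Q))) (cong (row P₁ Q *ℚ_) (sym (∑-indic (Q $ s))))) ⟩
        ∑ (mats m) (λ Q → row P₁ Q *ℚ ∑ (allFin m) (λ j → indic (Q $ s ==F j))) ≡⟨ ∑-cong (mats m) (λ {Q} _ → sym (∑-* (row P₁ Q) (λ j → indic (Q $ s ==F j)) (allFin m))) ⟩
        ∑ (mats m) (λ Q → ∑ (allFin m) (λ j → row P₁ Q *ℚ indic (Q $ s ==F j))) ≡⟨ ∑-swap (λ Q j → row P₁ Q *ℚ indic (Q $ s ==F j)) (mats m) (allFin m) ⟩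
        ∑ (allFin m) (λ j → edges s j P₁) ≡⟨ ∑-cong (allFin m) (λ {j} _ → shape j) ⟩
        ∑ (allFin m) (λ j → α₂ +ℚ ((α₁ -ℚ α₂) *ℚ indic (t ==F j) +ℚ (- α₂) *ℚ indic (s ==F j)))
          ≡⟨ trans (∑-+ (λ _ → α₂) (λ j → (α₁ -ℚ α₂) *ℚ indic (t ==F j) +ℚ (- α₂) *ℚ indic (s ==F j)) (allFin m))
               (cong₂ _+ℚ_ (trans (∑-const α₂ (allFin m)) (cong (λ l → ι l *ℚ α₂) (length-allFin m)))
                 (trans (∑-+ (λ j → (α₁ -ℚ α₂) *ℚ indic (t ==F j)) (λ j → (- α₂) *ℚ indic (s ==F j)) (allFin m))
                   (cong₂ _+ℚ_ (delta (α₁ -ℚ α₂) t) (delta (- α₂) s)))) ⟩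
        ι m *ℚ α₂ +ℚ ((α₁ -ℚ α₂) -ℚ α₂) ∎
        where
        open ≡-Reasoning
        delta : ∀ c x → ∑ (allFin m) (λ j → c *ℚ indic (x ==F j)) ≡ c
        delta c x = trans (∑-* c (λ j → indic (x ==F j)) (allFin m)) (trans (cong (c *ℚ_) (∑-indic x)) (ℚₚ.*-identityʳ c))
        shape : ∀ j → edges s j P₁ ≡ α₂ +ℚ ((α₁ -ℚ α₂) *ℚ indic (t ==F j) +ℚ (- α₂) *ℚ indic (s ==F j))
        shape j with j Finₚ.≟ t | j Finₚ.≟ s
        ... | yes refl | yes refl = ⊥-elim (s≢t refl)
        ... | yes refl | no  n    rewrite ≡⇒==F {x = t} refl | ≢⇒==F s≢t =
              solve 2 (λ a b → a := b :+ ((a :- b) :* con 1ℚ :+ (:- b) :* con 0ℚ)) refl α₁ α₂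
        ... | no  n    | yes refl rewrite ≡⇒==F {x = s} refl | ≢⇒==F (s≢t ∘ sym) =
              trans edges-self (solve 2 (λ a b → con 0ℚ := b :+ ((a :- b) :* con 0ℚ :+ (:- b) :* con 1ℚ)) refl α₁ α₂)
        ... | no  n    | no  n′   rewrite ≢⇒==F (n ∘ sym) | ≢⇒==F (n′ ∘ sym) =
              trans (edges-other j n′ n) (solve 2 (λ a b → b := b :+ ((a :- b) :* con 0ℚ :+ (:- b) :* con 0ℚ)) refl α₁ α₂)

      -- Every neighbour shares an edge with P₁ and is found from both ends of that edge, so the sum
      -- over x counts it at least twice. By symmetry each x contributes α₁.
      common-edge-bound : (∀ {P Q} → Matching P → Matching Q → rel P Q ≡ true → ∃[ x ] Q $ x ≡ P $ x) →
                          (1ℚ +ℚ 1ℚ) *ℚ valency P₁ ≤ℚ ι m *ℚ α₁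
      common-edge-bound common = begin
        (1ℚ +ℚ 1ℚ) *ℚ valency P₁ ≡⟨ ∑-* (1ℚ +ℚ 1ℚ) (row P₁) (mats m) ⟨
        ∑ (mats m) (λ Q → (1ℚ +ℚ 1ℚ) *ℚ row P₁ Q) ≤⟨ ∑-mono-≤ (mats m) (λ i → twice (mats⇒matching i)) ⟩
        ∑ (mats m) (λ Q → ∑ (allFin m) (λ x → row P₁ Q *ℚ indic (Q $ x ==F P₁ $ x))) ≡⟨ ∑-swap (λ Q x → row P₁ Q *ℚ indic (Q $ x ==F P₁ $ x)) (mats m) (allFin m) ⟩
        ∑ (allFin m) (λ x → edges x (P₁ $ x) P₁) ≡⟨ ∑-cong (allFin m) (λ {x} _ → same x) ⟩
        ∑ (allFin m) (λ _ → α₁) ≡⟨ trans (∑-const α₁ (allFin m)) (cong (λ l → ι l *ℚ α₁) (length-allFin m)) ⟩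
        ι m *ℚ α₁ ∎
        where
        open ℚₚ.≤-Reasoning
        same : ∀ x → edges x (P₁ $ x) P₁ ≡ α₁
        same x with extend (pair x (P₁ $ x)) (pair s t) (pair-injective (irreflexive M₁ x ∘ sym)) (pair-injective s≢t) (false ∷ true ∷ [])
        ... | π , h = trans (sym (edges-act π x (P₁ $ x) M₁)) (trans (cong₂ (λ a b → edges a b (act π P₁)) πx πPx)
                (connect-with (edges s t) s≢t edges-invariant (act-matching π M₁) M₁
                  (trans (cong (act π P₁ $_) (sym πx)) (trans (act-$-ʳ π P₁ x) πPx)) e₁))
          where
          πx : π ⟨$⟩ʳ x ≡ s
          πx = h {false} (here refl)
          πPx : π ⟨$⟩ʳ (P₁ $ x) ≡ t
          πPx = h {true} (there (here refl))
        twice : ∀ {Q} → Matching Q → (1ℚ +ℚ 1ℚ) *ℚ row P₁ Q ≤ℚ ∑ (allFin m) (λ x → row P₁ Q *ℚ indic (Q $ x ==F P₁ $ x))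
        twice {Q} MQ with rel P₁ Q in r
        ... | false = ℚₚ.≤-reflexive (sym (∑-≡0 (allFin m) (λ {x} _ → ℚₚ.*-zeroˡ (indic (Q $ x ==F P₁ $ x)))))
        ... | true with common M₁ MQ r
        ...   | x , e = subst (_≤ℚ ∑ (allFin m) f) two (∑-mono-≤ (allFin m) (λ {j} _ → below-f j))
          where
          f : Fin m → ℚ
          f j = 1ℚ *ℚ indic (Q $ j ==F P₁ $ j)
          g : Fin m → Fin m → ℚ
          g y j = indic (y ==F j)
          x′ = P₁ $ x
          e′ : Q $ x′ ≡ P₁ $ x′
          e′ = trans (cong (Q $_) (sym e)) (trans (involutive MQ x) (sym (involutive M₁ x)))
          two : ∑ (allFin m) (λ j → g x j +ℚ g x′ j) ≡ (1ℚ +ℚ 1ℚ) *ℚ 1ℚ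
          two = trans (∑-+ (g x) (g x′) (allFin m)) (trans (cong₂ _+ℚ_ (∑-indic x) (∑-indic x′)) refl)
          below-f : ∀ j → g x j +ℚ g x′ j ≤ℚ f j
          below-f j with x Finₚ.≟ j | x′ Finₚ.≟ j
          ... | yes refl | yes q    = ⊥-elim (irreflexive M₁ x q)
          ... | yes refl | no  q    rewrite ≡⇒==F e = ℚₚ.≤-refl
          ... | no  _    | yes refl rewrite ≡⇒==F e′ = ℚₚ.≤-refl
          ... | no  _    | no  _    = subst (0ℚ ≤ℚ_) (sym (ℚₚ.*-identityˡ (indic (Q $ j ==F P₁ $ j)))) (0≤indic (Q $ j ==F P₁ $ j))

      no-common-edge : (∀ {P Q} → Matching P → Matching Q → rel P Q ≡ true → ∀ x → Q $ x ≢ P $ x) → α₁ ≡ 0ℚ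
      no-common-edge none = ∑-≡0 (mats m) (λ {Q} i → vanish (mats⇒matching i))
        where
        vanish : ∀ {Q} → Matching Q → row P₁ Q *ℚ indic (Q $ s ==F t) ≡ 0ℚ
        vanish {Q} MQ with rel P₁ Q in r
        ... | false = ℚₚ.*-zeroˡ (indic (Q $ s ==F t))
        ... | true  = cong (λ b → 1ℚ *ℚ indic b) (≢⇒==F (λ e → none M₁ MQ r s (trans e (sym e₁))))

      module _ {b : ℚ} {y : Tab m → ℚ} (E : Eig b y)
               (invariant : ∀ {a c} → a ≢ s → a ≢ t → c ≢ s → c ≢ t → Signed 1ℚ a c y) where

        c₁ c₂ : ℚ
        c₁ = y P₁
        c₂ = y P₂

        y-invariant : ∀ {a c} → a ≢ s → a ≢ t → c ≢ s → c ≢ t → ∀ {P} → Matching P → y (act (transpose a c) P) ≡ y P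
        y-invariant as at cs ct M = trans (sign (invariant as at cs ct) M) (ℚₚ.*-identityˡ _)

        y-shape : ∀ {Q} → Matching Q → y Q ≡ c₂ +ℚ (c₁ -ℚ c₂) *ℚ indic (Q $ s ==F t)
        y-shape {Q} MQ with Q $ s Finₚ.≟ t
        ... | yes e = trans (connect-with y s≢t y-invariant MQ M₁ e e₁) (solve 2 (λ a b → a := b :+ (a :- b) :* con 1ℚ) refl c₁ c₂)
        ... | no  e = trans (connect-without y s≢t y-invariant MQ M₂ e n₂) (solve 2 (λ a b → b := b :+ (a :- b) :* con 0ℚ) refl c₁ c₂)

        eigen-shape : ∀ {P} → Matching P → b *ℚ y P ≡ c₂ *ℚ valency P +ℚ (c₁ -ℚ c₂) *ℚ edges s t P
        eigen-shape {P} M = trans (sym (Eig-row E M)) (trans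
          (∑-cong (mats m) (λ {Q} i → trans (cong (row P Q *ℚ_) (y-shape (mats⇒matching i)))
            (solve 4 (λ r c d e → r :* (c :+ d :* e) := c :* r :+ d :* (r :* e)) refl (row P Q) c₂ (c₁ -ℚ c₂) (indic (Q $ s ==F t)))))
          (trans (∑-+ (λ Q → c₂ *ℚ row P Q) (λ Q → (c₁ -ℚ c₂) *ℚ (row P Q *ℚ indic (Q $ s ==F t))) (mats m))
            (cong₂ _+ℚ_ (∑-* c₂ (row P) (mats m)) (∑-* (c₁ -ℚ c₂) (λ Q → row P Q *ℚ indic (Q $ s ==F t)) (mats m)))))

        -- If c₁ = c₂, then y is constant on matchings, and a constant with total 0 vanishes.
        c₁≢c₂ : ∑ (mats m) y ≡ 0ℚ → ∀ {P} → Matching P → y P ≢ 0ℚ → c₁ -ℚ c₂ ≢ 0ℚ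
        c₁≢c₂ z {P} M nz e = nz (trans (constant M) (cancel (length (mats m)) (∈-length (∈-mats M)) (trans (sym (∑-const c₂ (mats m)))
            (trans (sym (∑-cong (mats m) (λ i → constant (mats⇒matching i)))) z))))
          where
          constant : ∀ {Q} → Matching Q → y Q ≡ c₂
          constant {Q} MQ = trans (y-shape MQ) (trans (cong (λ d → c₂ +ℚ d *ℚ indic (Q $ s ==F t)) e)
            (trans (cong (c₂ +ℚ_) (ℚₚ.*-zeroˡ (indic (Q $ s ==F t)))) (ℚₚ.+-identityʳ c₂)))
          cancel : ∀ l → 1 ≤ l → ι l *ℚ c₂ ≡ 0ℚ → c₂ ≡ 0ℚ
          cancel (suc l) _ = *-cancel-zero (ι (suc l)) (0<⇒≢0 (0<ι l))

        -- The eigenvalue equations at P₁ and P₂ are subtracted. All valencies agree, so these terms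
        -- cancel, and c₁ - c₂ can be divided out.
        eigenvalue-difference : ∑ (mats m) y ≡ 0ℚ → ∀ {P} → Matching P → y P ≢ 0ℚ → b ≡ α₁ -ℚ α₂
        eigenvalue-difference z M nz = begin
          b ≡⟨ cancel b ⟨
          b *ℚ d *ℚ 1/ℚ d ≡⟨ cong (_*ℚ 1/ℚ d) equal ⟩
          (α₁ -ℚ α₂) *ℚ d *ℚ 1/ℚ d ≡⟨ cancel (α₁ -ℚ α₂) ⟩
          α₁ -ℚ α₂ ∎
          where
          open ≡-Reasoning
          d = c₁ -ℚ c₂
          instance
            nonzero : ℚ.NonZero d
            nonzero = ℚ.≢-nonZero (c₁≢c₂ z M nz)
          cancel : ∀ x → x *ℚ d *ℚ 1/ℚ d ≡ x
          cancel x = trans (ℚₚ.*-assoc x d (1/ℚ d)) (trans (cong (x *ℚ_) (ℚₚ.*-inverseʳ d)) (ℚₚ.*-identityʳ x))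
          equal : b *ℚ d ≡ (α₁ -ℚ α₂) *ℚ d
          equal = begin
            b *ℚ d ≡⟨ solve 3 (λ b x y → b :* (x :- y) := b :* x :- b :* y) refl b c₁ c₂ ⟩
            b *ℚ c₁ -ℚ b *ℚ c₂ ≡⟨ cong₂ _-ℚ_ (eigen-shape M₁) (trans (eigen-shape M₂) (cong (λ v → c₂ *ℚ v +ℚ d *ℚ α₂) (valency-constant M₂ M₁))) ⟩
            (c₂ *ℚ V +ℚ d *ℚ α₁) -ℚ (c₂ *ℚ V +ℚ d *ℚ α₂) ≡⟨ solve 5 (λ c V d a b → (c :* V :+ d :* a) :- (c :* V :+ d :* b) := (a :- b) :* d) refl c₂ V d α₁ α₂ ⟩
            (α₁ -ℚ α₂) *ℚ d ∎
            where
            V = valency P₁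

-- From the neighbour counts to the lower bound for the second eigenvalue

x≤y⇒0≤y-x : ∀ {x y} → x ≤ℚ y → 0ℚ ≤ℚ y -ℚ x
x≤y⇒0≤y-x {x} {y} p = subst (_≤ℚ y -ℚ x) (ℚₚ.+-inverseʳ x) (ℚₚ.+-monoˡ-≤ (- x) p)

0≤y-x⇒x≤y : ∀ {x y} → 0ℚ ≤ℚ y -ℚ x → x ≤ℚ y
0≤y-x⇒x≤y {x} {y} p = subst₂ _≤ℚ_ (ℚₚ.+-identityˡ x) (solve 2 (λ x y → (y :- x) :+ x := y) refl x y) (ℚₚ.+-monoˡ-≤ x p)

0≤* : ∀ {x y} → 0ℚ ≤ℚ x → 0ℚ ≤ℚ y → 0ℚ ≤ℚ x *ℚ y
0≤* {x} {y} p q = subst (_≤ℚ x *ℚ y) (ℚₚ.*-zeroʳ x) (ℚₚ.*-monoˡ-≤-nonNeg x {{ℚ.nonNegative p}} q)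

ι-double : ∀ k → ι (2 * suc k) ≡ (1ℚ +ℚ 1ℚ) *ℚ (1ℚ +ℚ ι k)
ι-double k = trans (ι-* 2 (suc k)) (cong (λ z → (1ℚ +ℚ z) *ℚ (1ℚ +ℚ ι k)) (ℚₚ.+-identityʳ 1ℚ))

module _ (k : ℕ) {α₁ α₂ V : ℚ} (split : V ≡ ι (2 * suc (suc k)) *ℚ α₂ +ℚ ((α₁ -ℚ α₂) -ℚ α₂)) (0≤α₂ : 0ℚ ≤ℚ α₂) where

  private
    ρ : ℚ
    ρ = ι (suc k)
    M : ℚ
    M = ι (2 * suc (suc k))

  -- Here k is n - 2, so M is the number 2n of points and ρ is n - 1. With α₁ = 0 the split reads V
  -- = (M - 2) α₂, while the difference has absolute value α₂.
  absent-bound : α₁ ≡ 0ℚ → V ≤ℚ M *ℚ ∣ α₁ -ℚ α₂ ∣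
  absent-bound refl = ℚₚ.≤-trans (0≤y-x⇒x≤y (subst (0ℚ ≤ℚ_)
      (sym (trans (cong (M *ℚ α₂ -ℚ_) split) (solve 2 (λ m a → m :* a :- (m :* a :+ ((con 0ℚ :- a) :- a)) := a :+ a) refl M α₂)))
      (ℚₚ.+-mono-≤ 0≤α₂ 0≤α₂)))
    (ℚₚ.*-monoˡ-≤-nonNeg M {{ℚ.nonNegative (0≤ι (2 * suc (suc k)))}} (subst (_≤ℚ ∣ 0ℚ -ℚ α₂ ∣) (solve 1 (λ a → :- (con 0ℚ :- a) := a) refl α₂) (-x≤∣x∣ (0ℚ -ℚ α₂))))

  -- Substituting V = α₁ + (M - 2) α₂ into 2V ≤ M α₁ gives (M - 2)(α₁ - 2α₂) ≥ 0, hence δ ≥ 0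
  -- because M - 2 = 2ρ > 0. The gap M (α₁ - α₂) - V is (M - 1) δ.
  present-bound : (1ℚ +ℚ 1ℚ) *ℚ V ≤ℚ M *ℚ α₁ → V ≤ℚ M *ℚ ∣ α₁ -ℚ α₂ ∣
  present-bound l = ℚₚ.≤-trans (0≤y-x⇒x≤y (subst (0ℚ ≤ℚ_) (sym gap) (0≤* 0≤1+2ρ 0≤δ)))
      (ℚₚ.*-monoˡ-≤-nonNeg M {{ℚ.nonNegative (0≤ι (2 * suc (suc k)))}} (x≤∣x∣ (α₁ -ℚ α₂)))
    where
    δ 2ρ : ℚ
    δ = α₁ -ℚ (α₂ +ℚ α₂)
    2ρ = ρ +ℚ ρ
    V≡ : V ≡ (1ℚ +ℚ 1ℚ) *ℚ (1ℚ +ℚ ρ) *ℚ α₂ +ℚ ((α₁ -ℚ α₂) -ℚ α₂)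
    V≡ = trans split (cong (λ z → z *ℚ α₂ +ℚ ((α₁ -ℚ α₂) -ℚ α₂)) (ι-double (suc k)))
    0≤1+2ρ : 0ℚ ≤ℚ 1ℚ +ℚ 2ρ
    0≤1+2ρ = ℚₚ.+-mono-≤ 0≤1 (ℚₚ.+-mono-≤ (0≤ι (suc k)) (0≤ι (suc k)))
    0≤δ : 0ℚ ≤ℚ δ
    0≤δ = ℚₚ.*-cancelˡ-≤-pos 2ρ {{ℚ.positive (ℚₚ.+-mono-< (0<ι k) (0<ι k))}} (subst₂ _≤ℚ_ (sym (ℚₚ.*-zeroʳ 2ρ))
      (trans (cong₂ (λ m v → m *ℚ α₁ -ℚ (1ℚ +ℚ 1ℚ) *ℚ v) (ι-double (suc k)) V≡)
        (solve 3 (λ r a b → (con 1ℚ :+ con 1ℚ) :* (con 1ℚ :+ r) :* a :- (con 1ℚ :+ con 1ℚ) :* ((con 1ℚ :+ con 1ℚ) :* (con 1ℚ :+ r) :* b :+ ((a :- b) :- b))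
          := (r :+ r) :* (a :- (b :+ b))) refl ρ α₁ α₂)) (x≤y⇒0≤y-x l))
    gap : M *ℚ (α₁ -ℚ α₂) -ℚ V ≡ (1ℚ +ℚ 2ρ) *ℚ δ
    gap = trans (cong₂ (λ m v → m *ℚ (α₁ -ℚ α₂) -ℚ v) (ι-double (suc k)) V≡)
      (solve 3 (λ r a b → (con 1ℚ :+ con 1ℚ) :* (con 1ℚ :+ r) :* (a :- b) :- ((con 1ℚ :+ con 1ℚ) :* (con 1ℚ :+ r) :* b :+ ((a :- b) :- b))
        := (con 1ℚ :+ (r :+ r)) :* (a :- (b :+ b))) refl ρ α₁ α₂)

module _ {m : ℕ} (rel : Tab m → Tab m → Bool)
         (rel-act : ∀ π {P Q} → Matching P → Matching Q → rel (act π P) (act π Q) ≡ rel P Q) where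

  open Scheme rel rel-act
  open Second rel rel-act

  -- The two cases in which b has opposite signs: α₁ ≥ 2 α₂ and b ≥ 0 in the first, α₁ = 0 and b =
  -- -α₂ in the second.
  CommonEdges : Set
  CommonEdges = (∀ {P Q} → Matching P → Matching Q → rel P Q ≡ true → ∃[ x ] Q $ x ≡ P $ x)
              ⊎ (∀ {P Q} → Matching P → Matching Q → rel P Q ≡ true → ∀ x → Q $ x ≢ P $ x)

  second-eigenvalue : ∀ k → m ≡ 2 * suc (suc k) → CommonEdges → ∀ {b y} → Eig b y → ∀ {s t} → s ≢ t →
    (∀ {a c} → a ≢ s → a ≢ t → c ≢ s → c ≢ t → Signed 1ℚ a c y) → ∑ (mats m) y ≡ 0ℚ →
    ∀ {P} → Matching P → y P ≢ 0ℚ → valency P ≤ℚ ι m *ℚ ∣ b ∣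
  second-eigenvalue k refl common {b} {y} E {s} {t} s≢t inv z {P} M nz = go (P $ s Finₚ.≟ t)
    where
    conclude : ∀ {P₁ P₂} → Matching P₁ → Matching P₂ → P₁ $ s ≡ t → P₂ $ s ≢ t → valency P ≤ℚ ι m *ℚ ∣ b ∣
    conclude {P₁} {P₂} M₁ M₂ e₁ n₂ = subst₂ (λ v c → v ≤ℚ ι m *ℚ ∣ c ∣) (valency-constant M₁ M)
      (sym (eigenvalue-difference M₁ M₂ e₁ n₂ E inv z M nz))
      (bounds common)
      where
      open Pair s≢t
      bounds : CommonEdges → valency P₁ ≤ℚ ι m *ℚ ∣ α₁ M₁ M₂ e₁ n₂ -ℚ α₂ M₁ M₂ e₁ n₂ ∣
      bounds (inj₁ h) = present-bound k (valency-split M₁ M₂ e₁ n₂) (0≤edges s t P₂) (common-edge-bound M₁ M₂ e₁ n₂ h)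
      bounds (inj₂ h) = absent-bound k (valency-split M₁ M₂ e₁ n₂) (0≤edges s t P₂) (no-common-edge M₁ M₂ e₁ n₂ h)
    -- A matching with {s,t} and one without it are required. P is one of them and a transposition
    -- supplies the other: moving t to a third point breaks the edge, moving the partner of s to t
    -- creates it.
    go : Dec (P $ s ≡ t) → valency P ≤ℚ ι m *ℚ ∣ b ∣
    go (yes e) = conclude M (act-matching τ M) e (λ e′ → g∉ (there (here (trans (sym move) e′))))
      where
      new : ∃[ g ] g ∉ s ∷ t ∷ []
      new = fresh (s ∷ t ∷ []) (ℕₚ.≤-trans (ℕₚ.n≤1+n 3) (ℕₚ.*-monoʳ-≤ 2 (s≤s (s≤s (z≤n {k})))))
      g = proj₁ new
      g∉ = proj₂ new
      τ = transpose t g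
      move : act τ P $ s ≡ g
      move = trans (cong (act τ P $_) (sym (transpose-other t g s≢t (λ r → g∉ (here (sym r))))))
        (trans (act-$-ʳ τ P s) (trans (cong (τ ⟨$⟩ʳ_) e) (transpose-left t g)))
    go (no n) = conclude (act-matching τ M) M move n
      where
      τ = transpose (P $ s) t
      move : act τ P $ s ≡ t
      move = trans (cong (act τ P $_) (sym (transpose-other (P $ s) t (irreflexive M s ∘ sym) s≢t)))
        (trans (act-$-ʳ τ P s) (transpose-left (P $ s) t))

  module _ (k : ℕ) (m≡ : m ≡ 2 * suc (suc k)) where

    -- The shape [2n-2,2] with n = k + 2. The two cells of its second row, the feet, play the parts
    -- of s and t.
    hook : List ℕ
    hook = double (suc k ∷ 1 ∷ [])

    hook-size : sum hook ≡ m
    hook-size = trans (sum-double (suc k ∷ 1 ∷ [])) (trans (cong (2 *_) (ℕₚ.+-comm (suc k) 1)) (sym m≡))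

    foot₀ : Cell hook 1 0
    foot₀ = below (first (s≤s z≤n))

    foot₁ : Cell hook 1 1
    foot₁ = below (first (s≤s (s≤s z≤n)))

    corner : Cell hook 0 0
    corner = first (s≤s z≤n)

    top-row : ∀ {x} → x ≢ point hook-size foot₀ → x ≢ point hook-size foot₁ → rowKey m hook x ≡ 0
    top-row {x} n₀ n₁ = go (toℕ x <? 2 * suc k)
      where
      go : Dec (toℕ x < 2 * suc k) → rowKey m hook x ≡ 0
      go (yes l) = cong proj₁ (rowCol-position {hook} (first l))
      go (no ¬l) = ⊥-elim (split (ℕₚ.m≤n⇒m<n∨m≡n (ℕₚ.≮⇒≥ ¬l)))
        where
        split : 2 * suc k < toℕ x ⊎ 2 * suc k ≡ toℕ x → ⊥
        split (inj₂ e) = n₀ (toℕ-injective (trans (sym e) (trans (sym (ℕₚ.+-identityʳ _)) (sym (toℕ-point hook-size foot₀)))))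
        split (inj₁ l) = n₁ (toℕ-injective (trans (ℕₚ.≤-antisym
            (s≤s⁻¹ (subst (toℕ x <_) (trans m≡ (trans (ℕₚ.*-distribˡ-+ 2 1 (suc k)) (ℕₚ.+-comm 2 (2 * suc k)) ■ ℕₚ.+-suc (2 * suc k) 1)) (toℕ<n x)))
            (subst (_≤ toℕ x) (sym (ℕₚ.+-comm (2 * suc k) 1)) l)) (sym (toℕ-point hook-size foot₁))))
          where
          _■_ : ∀ {a b c : ℕ} → a ≡ b → b ≡ c → a ≡ c
          refl ■ q = q

    -- All points other than the feet lie in row 0, so row symmetrization gives invariance under
    -- every transposition avoiding s and t. Corner and left foot share a column, so the total
    -- vanishes.
    hook-eigenvalue : CommonEdges → ∀ {b w} → Eig b w → Pairing hook w → ∃[ P ] Matching P × valency P ≤ℚ ι m *ℚ ∣ b ∣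
    hook-eigenvalue common {b} {w} E 𝒫 = base , baseM , second-eigenvalue k m≡ common
        (Eig-symmetrized rel rel-act {c = rowKey m hook} (Eig-antisymmetrized rel rel-act {c = colKey m hook} E labelling))
        (point-≢ hook-size foot₀ foot₁ λ ())
        (λ as at cs ct → symmetrized-Signed {c = rowKey m hook} (antisymmetrized {c = colKey m hook} labelling w) (trans (top-row as at) (sym (top-row cs ct))))
        (∑-symmetrized {c = rowKey m hook} {d = colKey m hook} labelling w (point-≢ hook-size corner foot₀ λ ()) (point-column hook-size corner foot₀))
        baseM nonzero
      where open Pairing 𝒫

-- Numbers of matchings and of permutations

length-cartesianProduct : ∀ {A B : Set} (xs : List A) (ys : List B) → length (cartesianProduct xs ys) ≡ length xs * length ys
length-cartesianProduct []       ys = refl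
length-cartesianProduct (x ∷ xs) ys = trans (Listₚ.length-++ (map (x ,_) ys))
  (cong₂ _+_ (Listₚ.length-map (x ,_) ys) (length-cartesianProduct xs ys))

-- Deleting the edge through 0 from a matching of 2 + m points: others j embeds the
-- remaining m points when the partner of 0 is suc j.
module _ {m : ℕ} where

  others : Fin (suc m) → Fin m → Fin (suc (suc m))
  others j i = suc (punchIn j i)

  others-injective : ∀ j {i i′} → others j i ≡ others j i′ → i ≡ i′
  others-injective j e = Finₚ.punchIn-injective j _ _ (Finₚ.suc-injective e)

  locate : Fin (suc m) → Fin m → Fin (suc (suc m)) → Fin m
  locate j d zero    = d
  locate j d (suc x) with j Finₚ.≟ x
  ... | yes _ = d
  ... | no  n = punchOut n

  others-locate : ∀ j d x → x ≢ zero → x ≢ suc j → others j (locate j d x) ≡ x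
  others-locate j d zero    n _ = ⊥-elim (n refl)
  others-locate j d (suc x) _ n with j Finₚ.≟ x
  ... | yes refl = ⊥-elim (n refl)
  ... | no  p    = cong suc (Finₚ.punchIn-punchOut p)

  data View (j : Fin (suc m)) : Fin (suc (suc m)) → Set where
    origin  : View j zero
    partner : View j (suc j)
    other   : ∀ i → View j (others j i)

  view : ∀ j x → View j x
  view j zero    = origin
  view j (suc x) with j Finₚ.≟ x
  ... | yes refl = partner
  ... | no  p    = subst (View j) (cong suc (Finₚ.punchIn-punchOut p)) (other (punchOut p))

  mate : Tab (suc (suc m)) → Fin (suc m)
  mate Q with Q $ zero
  ... | zero  = zero
  ... | suc j = j

  mate-$ : ∀ {Q} → Matching Q → Q $ zero ≡ suc (mate Q)
  mate-$ {Q} M with Q $ zero in e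
  ... | zero  = ⊥-elim (irreflexive M zero e)
  ... | suc j = refl

  shrink : Tab (suc (suc m)) → Tab m
  shrink Q = tabulate (λ i → locate (mate Q) i (Q $ others (mate Q) i))

  others-shrink : ∀ {Q} → Matching Q → ∀ i → others (mate Q) (shrink Q $ i) ≡ Q $ others (mate Q) i
  others-shrink {Q} M i = trans (cong (others j) (lookup∘tabulate _ i)) (others-locate j i (Q $ others j i) ≢zero ≢j)
    where
    j = mate Q
    ≢zero : Q $ others j i ≢ zero
    ≢zero e = Finₚ.punchInᵢ≢i j i (Finₚ.suc-injective (sym (trans (sym (mate-$ M)) (trans (cong (Q $_) (sym e)) (involutive M _)))))
    ≢j : Q $ others j i ≢ suc j
    ≢j e = Finₚ.0≢1+n (matching-injective M (trans (mate-$ M) (sym e)))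

  shrink-matching : ∀ {Q} → Matching Q → Matching (shrink Q)
  shrink-matching {Q} M .involutive i = others-injective j (trans (others-shrink M (shrink Q $ i))
    (trans (cong (Q $_) (others-shrink M i)) (involutive M _)))
    where j = mate Q
  shrink-matching {Q} M .irreflexive i e = irreflexive M (others (mate Q) i) (trans (sym (others-shrink M i)) (cong (others (mate Q)) e))

  shrink-injective : ∀ {Q R} → Matching Q → Matching R → mate Q ≡ mate R → shrink Q ≡ shrink R → Q ≡ R
  shrink-injective {Q} {R} M M′ ej es = Tab-ext λ x → go (view (mate Q) x)
    where
    go : ∀ {x} → View (mate Q) x → Q $ x ≡ R $ x
    go origin    = trans (mate-$ M) (trans (cong suc ej) (sym (mate-$ M′)))
    go partner   = trans (trans (cong (Q $_) (sym (mate-$ M))) (involutive M zero))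
      (sym (trans (cong (R $_) (trans (cong suc ej) (sym (mate-$ M′)))) (involutive M′ zero)))
    go (other i) = trans (sym (others-shrink M i)) (trans (cong₂ (λ j S → others j (S $ i)) ej es)
      (trans (others-shrink M′ i) (cong (λ j → R $ others j i) (sym ej))))

  mats-step : length (mats (suc (suc m))) ≤ suc m * length (mats m)
  mats-step = subst (length (mats (suc (suc m))) ≤_) (trans (length-cartesianProduct (allFin (suc m)) (mats m)) (cong (_* length (mats m)) (length-allFin (suc m))))
    (inj-length {ys = cartesianProduct (allFin (suc m)) (mats m)} (mats-unique (suc (suc m))) (λ Q → mate Q , shrink Q)
      (λ {Q} i → ∈-cartesianProduct⁺ (∈-allFin (mate Q)) (∈-mats (shrink-matching (mats⇒matching i))))
      (λ i j e → shrink-injective (mats⇒matching i) (mats⇒matching j) (cong proj₁ e) (cong proj₂ e)))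

  grow : Fin (suc m) × Tab m → Tab (suc m)
  grow (i , g) = i ∷ tabulate (λ x → punchIn i (g $ x))

  grow-$ : ∀ i g x → grow (i , g) $ suc x ≡ punchIn i (g $ x)
  grow-$ i g x = lookup∘tabulate _ x

  perms-step : suc m * length (perms m) ≤ length (perms (suc m))
  perms-step = subst (_≤ length (perms (suc m))) (trans (length-cartesianProduct (allFin (suc m)) (perms m)) (cong (_* length (perms m)) (length-allFin (suc m))))
    (inj-length (Uniqueₚ.cartesianProduct⁺ (allFin⁺ (suc m)) (perms-unique m)) grow
      (λ {u} i → ∈-perms (isPerm⁺ (grow u) (λ {x} {y} → inj u (perms-isPerm (proj₂ (∈-cartesianProduct⁻ (allFin (suc m)) (perms m) i))) x y)))
      (λ {u} {v} _ _ → same u v))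
    where
    inj : ∀ u → isPerm (proj₂ u) ≡ true → ∀ x y → grow u $ x ≡ grow u $ y → x ≡ y
    inj (i , g) eg zero    zero    e = refl
    inj (i , g) eg zero    (suc y) e = ⊥-elim (Finₚ.punchInᵢ≢i i (g $ y) (sym (trans e (grow-$ i g y))))
    inj (i , g) eg (suc x) zero    e = ⊥-elim (Finₚ.punchInᵢ≢i i (g $ x) (trans (sym (grow-$ i g x)) e))
    inj (i , g) eg (suc x) (suc y) e = cong suc (isPerm⁻ g eg (Finₚ.punchIn-injective i _ _ (trans (sym (grow-$ i g x)) (trans e (grow-$ i g y)))))
    same : ∀ u v → grow u ≡ grow v → u ≡ v
    same (i , g) (j , h) e with cong (_$ zero) e
    ... | refl = cong (i ,_) (Tab-ext λ x → Finₚ.punchIn-injective i _ _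
        (trans (sym (grow-$ i g x)) (trans (cong (_$ suc x) e) (grow-$ i h x))))

-- With two more points the left side grows by at most (m + 1)², the right side by at least (m +
-- 2)(m + 1).
matchings²≤perms : ∀ n → length (mats (2 * n)) * length (mats (2 * n)) ≤ length (perms (2 * n))
matchings²≤perms n = subst (λ m → length (mats m) * length (mats m) ≤ length (perms m)) (sym (trans (cong (n +_) (ℕₚ.+-identityʳ n)) (twice n))) (go n)
  where
  -- Doubling by double successors, so that `mats-step` and `perms-step` apply to `D (suc n)` by
  -- computation; `2 * suc n` does not reduce to this form.
  D : ℕ → ℕ
  D zero    = zero
  D (suc n) = suc (suc (D n))
  twice : ∀ n → n + n ≡ D n
  twice zero    = refl
  twice (suc n) = cong suc (trans (ℕₚ.+-suc n n) (cong suc (twice n)))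
  go : ∀ n → length (mats (D n)) * length (mats (D n)) ≤ length (perms (D n))
  go zero    = s≤s z≤n
  go (suc n) = begin
    N₂ * N₂ ≤⟨ ℕₚ.*-mono-≤ (mats-step {m}) (mats-step {m}) ⟩
    suc m * N * (suc m * N) ≡⟨ square (suc m) N ⟩
    suc m * (suc m * (N * N)) ≤⟨ ℕₚ.*-mono-≤ (ℕₚ.n≤1+n (suc m)) (ℕₚ.*-monoʳ-≤ (suc m) (go n)) ⟩
    suc (suc m) * (suc m * length (perms m)) ≤⟨ ℕₚ.*-monoʳ-≤ (suc (suc m)) (perms-step {m}) ⟩
    suc (suc m) * length (perms (suc m)) ≤⟨ perms-step {suc m} ⟩
    length (perms (suc (suc m))) ∎
    where
    open ℕₚ.≤-Reasoning
    m = D n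
    N = length (mats m)
    N₂ = length (mats (suc (suc m)))
    square : ∀ a b → a * b * (a * b) ≡ a * (a * (b * b))
    square = ℕ-Ring.solve-∀

-- A pair of matchings with given cycle type

-- `cycleHalfLengths P Q` is by definition the case of `halfLen`, `isRep` and the identity
-- enumeration. With the enumeration as a parameter, it can be split over `a + b` points.
selected : ∀ {A : Set} {k} → (A → ℕ) → (A → Bool) → (Fin k → A) → List ℕ
selected h p f = map h (filterᵇ p (Data.List.tabulate f))

selected-cong : ∀ {A B : Set} {k} {h : A → ℕ} {h′ : B → ℕ} {p : A → Bool} {p′ : B → Bool} {f : Fin k → A} {f′ : Fin k → B} →
                (∀ i → h (f i) ≡ h′ (f′ i)) → (∀ i → p (f i) ≡ p′ (f′ i)) → selected h p f ≡ selected h′ p′ f′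
selected-cong {k = zero}  eh ep = refl
selected-cong {k = suc k} {h} {h′} {p} {p′} {f} {f′} eh ep with p (f zero) | p′ (f′ zero) | ep zero
... | true  | .true  | refl = cong₂ _∷_ (eh zero) (selected-cong {h = h} {h′} {p} {p′} (eh ∘ suc) (ep ∘ suc))
... | false | .false | refl = selected-cong {h = h} {h′} {p} {p′} (eh ∘ suc) (ep ∘ suc)

selected-none : ∀ {A : Set} {k} (h : A → ℕ) {p : A → Bool} {f : Fin k → A} → (∀ i → p (f i) ≡ false) → selected h p f ≡ []
selected-none {k = zero}  h e = refl
selected-none {k = suc k} h {p} {f} e rewrite e zero = selected-none h (e ∘ suc)

selected-++ : ∀ {A : Set} a b (h : A → ℕ) (p : A → Bool) (f : Fin (a + b) → A) →
              selected h p f ≡ selected h p (λ i → f (i ↑ˡ b)) ++ selected h p (λ j → f (a ↑ʳ j))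
selected-++ zero    b h p f = refl
selected-++ (suc a) b h p f with p (f zero)
... | true  = cong (h (f zero) ∷_) (selected-++ a b h p (f ∘ suc))
... | false = selected-++ a b h p (f ∘ suc)

module _ {a b : ℕ} where

  infixr 5 _⊕T_

  _⊕T_ : Tab a → Tab b → Tab (a + b)
  P ⊕T Q = tabulate (λ x → [ (λ i → (P $ i) ↑ˡ b) , (λ j → a ↑ʳ (Q $ j)) ]′ (splitAt a x))

  ⊕T-ˡ : ∀ P Q i → (P ⊕T Q) $ (i ↑ˡ b) ≡ (P $ i) ↑ˡ b
  ⊕T-ˡ P Q i = trans (lookup∘tabulate _ (i ↑ˡ b)) (cong [ (λ i → (P $ i) ↑ˡ b) , (λ j → a ↑ʳ (Q $ j)) ]′ (Finₚ.splitAt-↑ˡ a i b))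

  ⊕T-ʳ : ∀ P Q j → (P ⊕T Q) $ (a ↑ʳ j) ≡ a ↑ʳ (Q $ j)
  ⊕T-ʳ P Q j = trans (lookup∘tabulate _ (a ↑ʳ j)) (cong [ (λ i → (P $ i) ↑ˡ b) , (λ j → a ↑ʳ (Q $ j)) ]′ (Finₚ.splitAt-↑ʳ a b j))

  data Side : Fin (a + b) → Set where
    inˡ : ∀ i → Side (i ↑ˡ b)
    inʳ : ∀ j → Side (a ↑ʳ j)

  side : ∀ x → Side x
  side x with splitAt a x in e
  ... | inj₁ i = subst Side (Finₚ.splitAt⁻¹-↑ˡ e) (inˡ i)
  ... | inj₂ j = subst Side (Finₚ.splitAt⁻¹-↑ʳ {a} {b} e) (inʳ j)

  ⊕T-matching : ∀ {P Q} → Matching P → Matching Q → Matching (P ⊕T Q)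
  ⊕T-matching {P} {Q} M N .involutive x = go (side x)
    where
    go : ∀ {x} → Side x → (P ⊕T Q) $ ((P ⊕T Q) $ x) ≡ x
    go (inˡ i) = trans (cong ((P ⊕T Q) $_) (⊕T-ˡ P Q i)) (trans (⊕T-ˡ P Q (P $ i)) (cong (_↑ˡ b) (involutive M i)))
    go (inʳ j) = trans (cong ((P ⊕T Q) $_) (⊕T-ʳ P Q j)) (trans (⊕T-ʳ P Q (Q $ j)) (cong (a ↑ʳ_) (involutive N j)))
  ⊕T-matching {P} {Q} M N .irreflexive x = go (side x)
    where
    go : ∀ {x} → Side x → (P ⊕T Q) $ x ≢ x
    go (inˡ i) e = irreflexive M i (Finₚ.↑ˡ-injective b _ _ (trans (sym (⊕T-ˡ P Q i)) e))
    go (inʳ j) e = irreflexive N j (Finₚ.↑ʳ-injective a _ _ (trans (sym (⊕T-ʳ P Q j)) e))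

  module DirectSum {P₁ Q₁ : Tab a} {P₂ Q₂ : Tab b} (MP₁ : Matching P₁) (MQ₁ : Matching Q₁) (MP₂ : Matching P₂) (MQ₂ : Matching Q₂) where

    MP : Matching (P₁ ⊕T P₂)
    MP = ⊕T-matching MP₁ MP₂
    MQ : Matching (Q₁ ⊕T Q₂)
    MQ = ⊕T-matching MQ₁ MQ₂
    module C  = Cycles MP MQ
    module C₁ = Cycles MP₁ MQ₁
    module C₂ = Cycles MP₂ MQ₂

    iterT-ˡ : ∀ t i → iterT t C.f (i ↑ˡ b) ≡ iterT t C₁.f i ↑ˡ b
    iterT-ˡ zero    i = refl
    iterT-ˡ (suc t) i = trans (cong (C.f $_) (iterT-ˡ t i)) (trans (C.f-$ _) (trans (cong ((Q₁ ⊕T Q₂) $_) (⊕T-ˡ P₁ P₂ _))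
      (trans (⊕T-ˡ Q₁ Q₂ _) (cong (_↑ˡ b) (sym (C₁.f-$ _))))))

    iterT-ʳ : ∀ t j → iterT t C.f (a ↑ʳ j) ≡ a ↑ʳ iterT t C₂.f j
    iterT-ʳ zero    j = refl
    iterT-ʳ (suc t) j = trans (cong (C.f $_) (iterT-ʳ t j)) (trans (C.f-$ _) (trans (cong ((Q₁ ⊕T Q₂) $_) (⊕T-ʳ P₁ P₂ _))
      (trans (⊕T-ʳ Q₁ Q₂ _) (cong (a ↑ʳ_) (sym (C₂.f-$ _))))))

    halfLen-ˡ : ∀ i → halfLen (P₁ ⊕T P₂) (Q₁ ⊕T Q₂) (i ↑ˡ b) ≡ halfLen P₁ Q₁ i
    halfLen-ˡ i = period-unique (C.halfLen-period (i ↑ˡ b)) (C₁.halfLen-period i)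
      (λ s e → Finₚ.↑ˡ-injective b _ _ (trans (sym (iterT-ˡ s i)) e)) (λ s e → trans (iterT-ˡ s i) (cong (_↑ˡ b) e))

    halfLen-ʳ : ∀ j → halfLen (P₁ ⊕T P₂) (Q₁ ⊕T Q₂) (a ↑ʳ j) ≡ halfLen P₂ Q₂ j
    halfLen-ʳ j = period-unique (C.halfLen-period (a ↑ʳ j)) (C₂.halfLen-period j)
      (λ s e → Finₚ.↑ʳ-injective a _ _ (trans (sym (iterT-ʳ s j)) e)) (λ s e → trans (iterT-ʳ s j) (cong (a ↑ʳ_) e))

    Cyc-ˡ : ∀ {i j} → C₁.Cyc i j → C.Cyc (i ↑ˡ b) (j ↑ˡ b)
    Cyc-ˡ {i} (t , inj₁ refl) = t , inj₁ (iterT-ˡ t i)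
    Cyc-ˡ {i} (t , inj₂ refl) = t , inj₂ (trans (cong ((P₁ ⊕T P₂) $_) (iterT-ˡ t i)) (⊕T-ˡ P₁ P₂ _))

    Cyc-ʳ : ∀ {i j} → C₂.Cyc i j → C.Cyc (a ↑ʳ i) (a ↑ʳ j)
    Cyc-ʳ {i} (t , inj₁ refl) = t , inj₁ (iterT-ʳ t i)
    Cyc-ʳ {i} (t , inj₂ refl) = t , inj₂ (trans (cong ((P₁ ⊕T P₂) $_) (iterT-ʳ t i)) (⊕T-ʳ P₁ P₂ _))

    Cyc-ˡ⁻ : ∀ {i y} → C.Cyc (i ↑ˡ b) y → ∃[ j ] y ≡ j ↑ˡ b × C₁.Cyc i j
    Cyc-ˡ⁻ {i} (t , inj₁ refl) = _ , iterT-ˡ t i , t , inj₁ refl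
    Cyc-ˡ⁻ {i} (t , inj₂ refl) = _ , trans (cong ((P₁ ⊕T P₂) $_) (iterT-ˡ t i)) (⊕T-ˡ P₁ P₂ _) , t , inj₂ refl

    Cyc-ʳ⁻ : ∀ {i y} → C.Cyc (a ↑ʳ i) y → ∃[ j ] y ≡ a ↑ʳ j × C₂.Cyc i j
    Cyc-ʳ⁻ {i} (t , inj₁ refl) = _ , iterT-ʳ t i , t , inj₁ refl
    Cyc-ʳ⁻ {i} (t , inj₂ refl) = _ , trans (cong ((P₁ ⊕T P₂) $_) (iterT-ʳ t i)) (⊕T-ʳ P₁ P₂ _) , t , inj₂ refl

    isRep-ˡ : ∀ i → isRep (P₁ ⊕T P₂) (Q₁ ⊕T Q₂) (i ↑ˡ b) ≡ isRep P₁ Q₁ i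
    isRep-ˡ i = ≡-from-⇔
      (λ r → C₁.isRep⁺ λ j c → subst₂ _≤_ (toℕ-↑ˡ i b) (toℕ-↑ˡ j b) (C.isRep⁻ r (Cyc-ˡ c)))
      (λ r → C.isRep⁺ λ y c → case Cyc-ˡ⁻ c of λ where
        (j , refl , c₁) → subst₂ _≤_ (sym (toℕ-↑ˡ i b)) (sym (toℕ-↑ˡ j b)) (C₁.isRep⁻ r c₁))

    isRep-ʳ : ∀ i → isRep (P₁ ⊕T P₂) (Q₁ ⊕T Q₂) (a ↑ʳ i) ≡ isRep P₂ Q₂ i
    isRep-ʳ i = ≡-from-⇔
      (λ r → C₂.isRep⁺ λ j c → ℕₚ.+-cancelˡ-≤ a _ _ (subst₂ _≤_ (toℕ-↑ʳ a i) (toℕ-↑ʳ a j) (C.isRep⁻ r (Cyc-ʳ c))))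
      (λ r → C.isRep⁺ λ y c → case Cyc-ʳ⁻ c of λ where
        (j , refl , c₂) → subst₂ _≤_ (sym (toℕ-↑ʳ a i)) (sym (toℕ-↑ʳ a j)) (ℕₚ.+-monoʳ-≤ a (C₂.isRep⁻ r c₂)))

    -- Both embeddings preserve the order of labels, so least vertices of cycles stay least; the
    -- left labels come first, so the lists are concatenated exactly and not just up to order.
    cycleHalfLengths-⊕ : cycleHalfLengths (P₁ ⊕T P₂) (Q₁ ⊕T Q₂) ≡ cycleHalfLengths P₁ Q₁ ++ cycleHalfLengths P₂ Q₂
    cycleHalfLengths-⊕ = trans (selected-++ a b (halfLen (P₁ ⊕T P₂) (Q₁ ⊕T Q₂)) (isRep (P₁ ⊕T P₂) (Q₁ ⊕T Q₂)) (λ x → x))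
      (cong₂ _++_ (selected-cong {h′ = halfLen P₁ Q₁} {p′ = isRep P₁ Q₁} halfLen-ˡ isRep-ˡ)
                  (selected-cong {h′ = halfLen P₂ Q₂} {p′ = isRep P₂ Q₂} halfLen-ʳ isRep-ʳ))

module SingleCycle (p : ℕ) where

  prev : Fin (suc p) → Fin (suc p)
  prev zero    = fromℕ p
  prev (suc i) = inject₁ i

  prev-injective : ∀ {i j} → prev i ≡ prev j → i ≡ j
  prev-injective {zero}  {zero}  e = refl
  prev-injective {zero}  {suc j} e = ⊥-elim (Finₚ.fromℕ≢inject₁ e)
  prev-injective {suc i} {zero}  e = ⊥-elim (Finₚ.fromℕ≢inject₁ (sym e))
  prev-injective {suc i} {suc j} e = cong suc (Finₚ.inject₁-injective e)

  rotation : Permutation′ (suc p)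
  rotation = ofInjection prev prev-injective

  Vertex : Set
  Vertex = Fin 2 × Fin (suc p)

  encode : Vertex → Fin (2 * suc p)
  encode (s , i) = combine s i

  table : (Vertex → Vertex) → Tab (2 * suc p)
  table g = tabulate (encode ∘ g ∘ remQuot (suc p))

  table-$ : ∀ g u → table g $ encode u ≡ encode (g u)
  table-$ g (s , i) = trans (lookup∘tabulate (encode ∘ g ∘ remQuot (suc p)) (combine s i)) (cong (encode ∘ g) (remQuot-combine s i))

  encoded : ∀ x → ∃[ u ] encode u ≡ x
  encoded x = remQuot (suc p) x , combine-remQuot (suc p) x

  encode-injective : ∀ {u v} → encode u ≡ encode v → u ≡ v
  encode-injective {s , i} {s′ , i′} e with combine-injective s i s′ i′ e
  ... | refl , refl = refl

  table-matching : ∀ g → (∀ u → g (g u) ≡ u) → (∀ u → g u ≢ u) → Matching (table g)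
  table-matching g inv irr .involutive x with encoded x
  ... | u , refl = trans (cong (table g $_) (table-$ g u)) (trans (table-$ g (g u)) (cong encode (inv u)))
  table-matching g inv irr .irreflexive x e with encoded x
  ... | u , refl = irr u (encode-injective (trans (sym (table-$ g u)) e))

  -- Two layers of p + 1 points: P joins equal positions, Q joins positions shifted by one. On the
  -- layer `zero` the product QP is then the cyclic shift `prev`.
  stepP stepQ : Vertex → Vertex
  stepP (zero     , i) = suc zero , i
  stepP (suc zero , i) = zero , i
  stepQ (zero     , i) = suc zero , rotation ⟨$⟩ˡ i
  stepQ (suc zero , i) = zero , prev i

  P Q : Tab (2 * suc p)
  P = table stepP
  Q = table stepQ

  MP : Matching P
  MP = table-matching stepP (λ where (zero , i) → refl
                                     (suc zero , i) → refl)
                            (λ where (zero , i) ()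
                                     (suc zero , i) ())

  MQ : Matching Q
  MQ = table-matching stepQ (λ where (zero , i) → cong (zero ,_) (inverseʳ rotation)
                                     (suc zero , i) → cong (suc zero ,_) (inverseˡ rotation))
                            (λ where (zero , i) ()
                                     (suc zero , i) ())

  module C = Cycles MP MQ

  f-encode : ∀ i → C.f $ encode (zero , i) ≡ encode (zero , prev i)
  f-encode i = trans (C.f-$ (encode (zero , i))) (trans (cong (Q $_) (table-$ stepP (zero , i))) (table-$ stepQ (suc zero , i)))

  orbit : ℕ → Fin (suc p)
  orbit zero    = zero
  orbit (suc t) = prev (orbit t)

  iterT-orbit : ∀ t → iterT t C.f (encode (zero , zero)) ≡ encode (zero , orbit t)
  iterT-orbit zero    = refl
  iterT-orbit (suc t) = trans (cong (C.f $_) (iterT-orbit t)) (f-encode (orbit t))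

  -- The first step wraps from 0 to p and the following ones descend, so 0 is met again only after p
  -- + 1 steps.
  toℕ-orbit : ∀ t → t ≤ p → toℕ (orbit (suc t)) ≡ p ∸ t
  toℕ-orbit zero    _ = Finₚ.toℕ-fromℕ p
  toℕ-orbit (suc t) l with orbit (suc t) | toℕ-orbit t (ℕₚ.<⇒≤ l)
  ... | zero  | e = ⊥-elim (ℕₚ.<⇒≢ (ℕₚ.m<n⇒0<n∸m l) e)
  ... | suc i | e = trans (Finₚ.toℕ-inject₁ i) (ℕₚ.suc-injective (trans e (ℕₚ.+-∸-assoc 1 {p} {suc t} l)))

  halfLen-start : halfLen P Q (encode (zero , zero)) ≡ suc p
  halfLen-start = period-unique (C.halfLen-period _) (record { positive = s≤s z≤n ; returns = returns ; least = least }) (λ _ e → e) (λ _ e → e)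
    where
    returns : iterT (suc p) C.f (encode (zero , zero)) ≡ encode (zero , zero)
    returns = trans (iterT-orbit (suc p)) (cong (λ i → encode (zero , i)) (toℕ-injective (trans (toℕ-orbit p ℕₚ.≤-refl) (ℕₚ.n∸n≡0 p))))
    least : ∀ r → 1 ≤ r → r < suc p → iterT r C.f (encode (zero , zero)) ≢ encode (zero , zero)
    least (suc t) _ (s≤s l) e = ℕₚ.<⇒≢ (ℕₚ.m<n⇒0<n∸m l) (sym (trans (sym (toℕ-orbit t (ℕₚ.<⇒≤ l)))
      (cong (toℕ ∘ proj₂) (encode-injective {zero , orbit (suc t)} {zero , zero} (trans (sym (iterT-orbit (suc t))) e)))))

  connected : ∀ x → C.Cyc (encode (zero , zero)) x
  connected x with encoded x
  ... | (s , i) , refl = suc t , reach s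
    where
    t = p ∸ toℕ i
    at : iterT (suc t) C.f (encode (zero , zero)) ≡ encode (zero , i)
    at = trans (iterT-orbit (suc t)) (cong (λ i → encode (zero , i)) (toℕ-injective
      (trans (toℕ-orbit t (ℕₚ.m∸n≤m p (toℕ i))) (ℕₚ.m∸[m∸n]≡n (s≤s⁻¹ (toℕ<n i))))))
    reach : ∀ s → iterT (suc t) C.f (encode (zero , zero)) ≡ encode (s , i) ⊎ P $ iterT (suc t) C.f (encode (zero , zero)) ≡ encode (s , i)
    reach zero       = inj₁ at
    reach (suc zero) = inj₂ (trans (cong (P $_) at) (table-$ stepP (zero , i)))

  halfLen-all : ∀ x → halfLen P Q x ≡ suc p
  halfLen-all x = trans (C.halfLen-Cyc (connected x)) halfLen-start

  lengths : cycleHalfLengths P Q ≡ suc p ∷ []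
  lengths with isRep P Q zero in e
  ... | true  = cong₂ _∷_ halfLen-start (selected-none (halfLen P Q) {isRep P Q} {suc} not-rep)
    where
    not-rep : ∀ i → isRep P Q (suc i) ≡ false
    not-rep i with isRep P Q (suc i) in r
    ... | true  = ⊥-elim (ℕₚ.n≮0 (C.isRep⁻ r (C.Cyc-sym (connected (suc i)))))
    ... | false = refl
  ... | false = ⊥-elim (not-both (C.isRep⁺ (λ _ _ → z≤n)) e)

record Realization (μ : List ℕ) : Set where
  field
    P Q     : Tab (sum (double μ))
    MP      : Matching P
    MQ      : Matching Q
    lengths : cycleHalfLengths P Q ≡ μ

realize : ∀ μ → All (1 ≤_) μ → Realization μ
realize []           _        = record { P = [] ; Q = [] ; MP = record { involutive = λ () ; irreflexive = λ () }
                                       ; MQ = record { involutive = λ () ; irreflexive = λ () } ; lengths = refl }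
realize (suc p ∷ μ) (_ ∷ pos) = record { P = S.P ⊕T R.P ; Q = S.Q ⊕T R.Q ; MP = D.MP ; MQ = D.MQ
                                       ; lengths = trans D.cycleHalfLengths-⊕ (cong₂ _++_ S.lengths R.lengths) }
  where
  module S = SingleCycle p
  module R = Realization (realize μ pos)
  module D = DirectSum S.MP S.MQ R.MP R.MQ

-- The stabilizer of a pair of matchings

length-filterᵇ≤ : ∀ {A : Set} (p q : A → Bool) xs → length (filterᵇ p (filterᵇ q xs)) ≤ length (filterᵇ p xs)
length-filterᵇ≤ p q []       = z≤n
length-filterᵇ≤ p q (x ∷ xs) with q x
... | true  with p x
...   | true  = s≤s (length-filterᵇ≤ p q xs)
...   | false = length-filterᵇ≤ p q xs
length-filterᵇ≤ p q (x ∷ xs) | false with p x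
...   | true  = ℕₚ.m≤n⇒m≤1+n (length-filterᵇ≤ p q xs)
...   | false = length-filterᵇ≤ p q xs

length-split : ∀ {A : Set} (p : A → Bool) xs → length xs ≡ length (filterᵇ p xs) + length (filterᵇ (not ∘ p) xs)
length-split p []       = refl
length-split p (x ∷ xs) with p x
... | true  = cong suc (length-split p xs)
... | false = trans (cong suc (length-split p xs)) (sym (ℕₚ.+-suc _ _))

-- The elements with value y are split off. By reflexivity no remaining element has value y, so the
-- rest maps into ys, and its fibres have not grown.
length≤fibres : ∀ {A B : Set} (_==_ : B → B → Bool) → (∀ b → (b == b) ≡ true) → (f : A → B) (F : ℕ) →
  ∀ ys xs → (∀ {x} → x ∈ xs → f x ∈ ys) → (∀ y → length (filterᵇ (λ x → f x == y) xs) ≤ F) → length xs ≤ F * length ys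
length≤fibres _==_ eq f F []       []       _  _   = z≤n
length≤fibres _==_ eq f F []       (x ∷ xs) f∈ _   with () ← f∈ (here refl)
length≤fibres _==_ eq f F (y ∷ ys) xs       f∈ fib = begin
  length xs ≡⟨ length-split p xs ⟩
  length (filterᵇ p xs) + length (filterᵇ (not ∘ p) xs) ≤⟨ ℕₚ.+-mono-≤ (fib y) (length≤fibres _==_ eq f F ys (filterᵇ (not ∘ p) xs) rest
                                                                     (λ z → ℕₚ.≤-trans (length-filterᵇ≤ (λ x → f x == z) (not ∘ p) xs) (fib z))) ⟩
  F + F * length ys ≡⟨ ℕₚ.*-suc F (length ys) ⟨
  F * length (y ∷ ys) ∎
  where
  open ℕₚ.≤-Reasoning
  p : _ → Bool
  p x = f x == y
  rest : ∀ {x} → x ∈ filterᵇ (not ∘ p) xs → f x ∈ ys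
  rest i with ∈-filterᵇ⁻ (not ∘ p) {xs = xs} i
  ... | j , e with f∈ j
  ...   | here refl = ⊥-elim (not-both (eq y) (not-true e))
  ...   | there k   = k

eqTab : ∀ {m} → Tab m → Tab m → Bool
eqTab P Q = allB (λ x → P $ x ==F Q $ x)

eqPair : ∀ {m} → Tab m × Tab m → Tab m × Tab m → Bool
eqPair (P , Q) (P′ , Q′) = eqTab P P′ ∧ eqTab Q Q′

eqPair-refl : ∀ {m} (u : Tab m × Tab m) → eqPair u u ≡ true
eqPair-refl (P , Q) = cong₂ _∧_ (allB⁺ {p = λ x → P $ x ==F P $ x} (λ x → ≡⇒==F {x = P $ x} refl)) (allB⁺ {p = λ x → Q $ x ==F Q $ x} (λ x → ≡⇒==F {x = Q $ x} refl))

eqPair⇒≡ : ∀ {m} {u v : Tab m × Tab m} → eqPair u v ≡ true → u ≡ v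
eqPair⇒≡ {u = P , Q} {P′ , Q′} e = cong₂ _,_ (eqTab⇒≡ (proj₁ (∧-true {eqTab P P′} e))) (eqTab⇒≡ (proj₂ (∧-true {eqTab P P′} e)))
  where
  eqTab⇒≡ : ∀ {P Q} → eqTab P Q ≡ true → P ≡ Q
  eqTab⇒≡ h = Tab-ext λ x → ==F⇒≡ (allB⁻ h x)

module Rigidity {a b : ℕ} {P₁ Q₁ : Tab a} {P₂ Q₂ : Tab b} (MP₁ : Matching P₁) (MQ₁ : Matching Q₁) (MP₂ : Matching P₂) (MQ₂ : Matching Q₂)
                {start : Fin a} (connected : ∀ x → Cycles.Cyc MP₁ MQ₁ start x) (long : ∀ i → b < halfLen P₁ Q₁ i) where

  module D = DirectSum MP₁ MQ₁ MP₂ MQ₂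
  module C = D.C

  P₀ Q₀ : Tab (a + b)
  P₀ = P₁ ⊕T P₂
  Q₀ = Q₁ ⊕T Q₂

  z₀ : Fin (a + b)
  z₀ = start ↑ˡ b

  module _ (h : Permutation′ (a + b)) (hP : act h P₀ ≡ P₀) (hQ : act h Q₀ ≡ Q₀) where

    commutes : ∀ {P} → act h P ≡ P → ∀ x → P $ (h ⟨$⟩ʳ x) ≡ h ⟨$⟩ʳ (P $ x)
    commutes {P} e x = trans (cong (_$ (h ⟨$⟩ʳ x)) (sym e)) (act-$-ʳ h P x)

    iterT-commutes : ∀ t x → iterT t C.f (h ⟨$⟩ʳ x) ≡ h ⟨$⟩ʳ iterT t C.f x
    iterT-commutes zero    x = refl
    iterT-commutes (suc t) x = trans (cong (C.f $_) (iterT-commutes t x)) (trans (C.f-$ _)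
      (trans (cong (Q₀ $_) (commutes hP _)) (trans (commutes hQ _) (cong (h ⟨$⟩ʳ_) (sym (C.f-$ _))))))

    halfLen-commutes : ∀ x → halfLen P₀ Q₀ (h ⟨$⟩ʳ x) ≡ halfLen P₀ Q₀ x
    halfLen-commutes x = period-unique (C.halfLen-period (h ⟨$⟩ʳ x)) (C.halfLen-period x)
      (λ s e → perm-injective h (trans (sym (iterT-commutes s x)) e)) (λ s e → trans (iterT-commutes s x) (cong (h ⟨$⟩ʳ_) e))

    -- An automorphism of the pair preserves half-lengths. In the right summand these are at most
    -- the number b of its points, while on the left they exceed b.
    keeps-right : ∀ j → ∃[ j′ ] h ⟨$⟩ʳ (a ↑ʳ j) ≡ a ↑ʳ j′
    keeps-right j = go (side (h ⟨$⟩ʳ (a ↑ʳ j))) refl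
      where
      go : ∀ {x} → Side {a} {b} x → h ⟨$⟩ʳ (a ↑ʳ j) ≡ x → ∃[ j′ ] h ⟨$⟩ʳ (a ↑ʳ j) ≡ a ↑ʳ j′
      go (inʳ j′) e = j′ , e
      go (inˡ i)  e = ⊥-elim (ℕₚ.<⇒≱ (long i) (begin
        halfLen P₁ Q₁ i ≡⟨ D.halfLen-ˡ i ⟨
        halfLen P₀ Q₀ (i ↑ˡ b) ≡⟨ cong (halfLen P₀ Q₀) e ⟨
        halfLen P₀ Q₀ (h ⟨$⟩ʳ (a ↑ʳ j)) ≡⟨ halfLen-commutes (a ↑ʳ j) ⟩
        halfLen P₀ Q₀ (a ↑ʳ j) ≡⟨ D.halfLen-ʳ j ⟩
        halfLen P₂ Q₂ j ≤⟨ D.C₂.halfLen≤ j ⟩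
        b ∎))
        where open ℕₚ.≤-Reasoning

  -- An automorphism commutes with P₀ and Q₀, so its value at z₀ determines it on the cycle through
  -- z₀, which is the whole left summand.
  determined : ∀ {h h′} (hP : act h P₀ ≡ P₀) (hQ : act h Q₀ ≡ Q₀) (hP′ : act h′ P₀ ≡ P₀) (hQ′ : act h′ Q₀ ≡ Q₀) →
    h ⟨$⟩ʳ z₀ ≡ h′ ⟨$⟩ʳ z₀ → (∀ j → h ⟨$⟩ʳ (a ↑ʳ j) ≡ h′ ⟨$⟩ʳ (a ↑ʳ j)) → ∀ x → h ⟨$⟩ʳ x ≡ h′ ⟨$⟩ʳ x
  determined {h} {h′} hP hQ hP′ hQ′ ez er x = go (side x)
    where
    along : ∀ t → h ⟨$⟩ʳ iterT t C.f z₀ ≡ h′ ⟨$⟩ʳ iterT t C.f z₀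
    along t = trans (sym (iterT-commutes h hP hQ t z₀)) (trans (cong (iterT t C.f) ez) (iterT-commutes h′ hP′ hQ′ t z₀))
    go : ∀ {x} → Side {a} {b} x → h ⟨$⟩ʳ x ≡ h′ ⟨$⟩ʳ x
    go (inʳ j) = er j
    go (inˡ i) with D.Cyc-ˡ (connected i)
    ... | t , inj₁ e = subst (λ y → h ⟨$⟩ʳ y ≡ h′ ⟨$⟩ʳ y) e (along t)
    ... | t , inj₂ e = subst (λ y → h ⟨$⟩ʳ y ≡ h′ ⟨$⟩ʳ y) e
            (trans (sym (commutes h hP hQ hP (iterT t C.f z₀))) (trans (cong (P₀ $_) (along t)) (commutes h′ hP′ hQ′ hP′ (iterT t C.f z₀))))

  images : Tab (a + b) → Tab (a + b) × Tab (a + b)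
  images g = tact g P₀ , tact g Q₀

  -- Composing with the inverse of one member g₁ turns the members of the fibre into automorphisms
  -- of the pair. Such an automorphism is coded by the image of z₀, in a + b ways, and by its
  -- restriction to the right summand, in at most b^b ways.
  fibre≤ : ∀ u → length (filterᵇ (λ g → eqPair (images g) u) (perms (a + b))) ≤ (a + b) * b ^ b
  fibre≤ u = go (filterᵇ (λ g → eqPair (images g) u) (perms (a + b))) (filterᵇ-unique _ (perms-unique (a + b)))
    (λ i → let j , e = ∈-filterᵇ⁻ (λ g → eqPair (images g) u) {xs = perms (a + b)} i in perms-isPerm j , eqPair⇒≡ e)
    where
    go : ∀ L → Unique L → (∀ {g} → g ∈ L → isPerm g ≡ true × images g ≡ u) → length L ≤ (a + b) * b ^ b
    go []       _  _    = z≤n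
    go L@(g₁ ∷ _) uL good = subst (length L ≤_)
        (trans (length-cartesianProduct (allFin (a + b)) (allVecs b b)) (cong₂ _*_ (length-allFin (a + b)) (length-allVecs b b)))
        (inj-length {ys = cartesianProduct (allFin (a + b)) (allVecs b b)} uL code (λ _ → ∈-cartesianProduct⁺ (∈-allFin _) (∈-allVecs _)) code-injective)
      where
      e₁ : isPerm g₁ ≡ true
      e₁ = proj₁ (good (here refl))
      γ : Permutation′ (a + b)
      γ = ofTab g₁ e₁
      -- On members of the fibre the default j is never taken, because `keeps-right` places the
      -- argument in the right summand.
      toRight : Fin b → Fin (a + b) → Fin b
      toRight j x = [ (λ _ → j) , (λ y → y) ]′ (splitAt a x)
      code : Tab (a + b) → Fin (a + b) × Vec (Fin b) b
      code g = γ ⟨$⟩ˡ (g $ z₀) , tabulate (λ j → toRight j (γ ⟨$⟩ˡ (g $ (a ↑ʳ j))))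
      shift : ∀ g → isPerm g ≡ true → Permutation′ (a + b)
      shift g e = ofTab g e ∘ₚ flip γ
      shift-fixes : ∀ g (i : g ∈ L) → (pr : Tab (a + b) × Tab (a + b) → Tab (a + b)) (R : Tab (a + b)) →
                    (∀ g → pr (images g) ≡ tact g R) → act (shift g (proj₁ (good i))) R ≡ R
      shift-fixes g i pr R h = begin
        act (shift g e) R ≡⟨ act-∘ (ofTab g e) (flip γ) R ⟨
        act (flip γ) (act (ofTab g e) R) ≡⟨ cong (act (flip γ)) (tact-act g (ofTab g e) R (λ _ → refl)) ⟨
        act (flip γ) (tact g R) ≡⟨ cong (act (flip γ)) (trans (sym (h g)) (trans (cong pr (trans (proj₂ (good i)) (sym (proj₂ (good (here refl)))))) (h g₁))) ⟩
        act (flip γ) (tact g₁ R) ≡⟨ cong (act (flip γ)) (tact-act g₁ γ R (λ _ → refl)) ⟩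
        act (flip γ) (act γ R) ≡⟨ act-flip γ R ⟩
        R ∎
        where
        open ≡-Reasoning
        e = proj₁ (good i)
      code-injective : ∀ {g g′} → g ∈ L → g′ ∈ L → code g ≡ code g′ → g ≡ g′
      code-injective {g} {g′} i i′ ec = Tab-ext λ x → perm-injective (flip γ)
        (determined {shift g (proj₁ (good i))} {shift g′ (proj₁ (good i′))} (fixP g i) (fixQ g i) (fixP g′ i′) (fixQ g′ i′) (cong proj₁ ec) on-right x)
        where
        fixP : ∀ g (i : g ∈ L) → act (shift g (proj₁ (good i))) P₀ ≡ P₀
        fixP g i = shift-fixes g i proj₁ P₀ (λ _ → refl)
        fixQ : ∀ g (i : g ∈ L) → act (shift g (proj₁ (good i))) Q₀ ≡ Q₀
        fixQ g i = shift-fixes g i proj₂ Q₀ (λ _ → refl)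
        restore : ∀ g (i : g ∈ L) j → γ ⟨$⟩ˡ (g $ (a ↑ʳ j)) ≡ a ↑ʳ toRight j (γ ⟨$⟩ˡ (g $ (a ↑ʳ j)))
        restore g i j with keeps-right (shift g (proj₁ (good i))) (fixP g i) (fixQ g i) j
        ... | j′ , e = trans e (cong (a ↑ʳ_) (sym (trans (cong (toRight j) e) (cong [ (λ _ → j) , (λ y → y) ]′ (Finₚ.splitAt-↑ʳ a b j′)))))
        on-right : ∀ j → γ ⟨$⟩ˡ (g $ (a ↑ʳ j)) ≡ γ ⟨$⟩ˡ (g′ $ (a ↑ʳ j))
        on-right j = trans (restore g i j) (trans (cong (a ↑ʳ_) (trans (sym (lookup∘tabulate _ j)) (trans (cong (λ c → lookup (proj₂ c) j) ec) (lookup∘tabulate _ j)))) (sym (restore g′ i′ j)))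

  -- An orbit-stabilizer count: every permutation moves (P₀, Q₀) to a related pair, and each pair is
  -- reached at most as often as `fibre≤` allows.
  perms≤ : ∀ (rel : Tab (a + b) → Tab (a + b) → Bool) → (∀ π {P Q} → Matching P → Matching Q → rel (act π P) (act π Q) ≡ rel P Q) →
           rel P₀ Q₀ ≡ true →
           length (perms (a + b)) ≤ (a + b) * b ^ b * length (filterᵇ (λ (P , Q) → rel P Q) (cartesianProduct (mats (a + b)) (mats (a + b))))
  perms≤ rel rel-act r = length≤fibres eqPair eqPair-refl images ((a + b) * b ^ b) _ (perms (a + b)) member fibre≤
    where
    member : ∀ {g} → g ∈ perms (a + b) → images g ∈ filterᵇ (λ (P , Q) → rel P Q) (cartesianProduct (mats (a + b)) (mats (a + b)))
    member {g} i = ∈-filterᵇ⁺ (λ (P , Q) → rel P Q) (∈-cartesianProduct⁺ (∈-mats (tact-matching g D.MP)) (∈-mats (tact-matching g D.MQ)))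
      (trans (cong₂ rel (tact-act g γ P₀ (λ _ → refl)) (tact-act g γ Q₀ (λ _ → refl))) (trans (rel-act γ D.MP D.MQ) r))
      where
      γ = ofTab g (perms-isPerm i)

∑-cartesianProduct : ∀ {A B : Set} (f : A × B → ℚ) xs ys → ∑ (cartesianProduct xs ys) f ≡ ∑ xs (λ x → ∑ ys (λ y → f (x , y)))
∑-cartesianProduct f []       ys = refl
∑-cartesianProduct f (x ∷ xs) ys = trans (go ys) (cong (∑ ys (λ y → f (x , y)) +ℚ_) (∑-cartesianProduct f xs ys))
  where
  go : ∀ zs → ∑ (map (x ,_) zs ++ cartesianProduct xs ys) f ≡ ∑ zs (λ y → f (x , y)) +ℚ ∑ (cartesianProduct xs ys) f
  go []       = sym (ℚₚ.+-identityˡ _)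
  go (z ∷ zs) = trans (cong (f (x , z) +ℚ_) (go zs)) (sym (ℚₚ.+-assoc (f (x , z)) (∑ zs (λ y → f (x , y))) (∑ (cartesianProduct xs ys) f)))

ι-length-filterᵇ : ∀ {A : Set} (p : A → Bool) xs → ι (length (filterᵇ p xs)) ≡ ∑ xs (indic ∘ p)
ι-length-filterᵇ p []       = refl
ι-length-filterᵇ p (x ∷ xs) with p x
... | true  = cong (1ℚ +ℚ_) (ι-length-filterᵇ p xs)
... | false = trans (ι-length-filterᵇ p xs) (sym (ℚₚ.+-identityˡ _))

-- Comparison of the eigenvalues

∣∣-square : ∀ x → ∣ x ∣ *ℚ ∣ x ∣ ≡ x *ℚ x
∣∣-square x with ℚₚ.∣p∣≡p∨∣p∣≡-p x
... | inj₁ e rewrite e = refl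
... | inj₂ e rewrite e = solve 1 (λ a → (:- a) :* (:- a) := a :* a) refl x

*-mono-≤-nonNeg : ∀ {x y z w} → 0ℚ ≤ℚ x → x ≤ℚ y → 0ℚ ≤ℚ z → z ≤ℚ w → x *ℚ z ≤ℚ y *ℚ w
*-mono-≤-nonNeg {x} {y} {z} {w} 0≤x x≤y 0≤z z≤w = ℚₚ.≤-trans
  (ℚₚ.*-monoʳ-≤-nonNeg z {{ℚ.nonNegative 0≤z}} x≤y)
  (ℚₚ.*-monoˡ-≤-nonNeg y {{ℚ.nonNegative (ℚₚ.≤-trans 0≤x x≤y)}} z≤w)

-- From ν² ≤ D ν V one gets ν ≤ D V, hence V > 0 and B > 0. If B ≤ |a|, then K B² ≤ K a² ≤ ν V ≤ D
-- V² ≤ D M² B², against D M² < K.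
compare : ∀ {a b V T : ℚ} (K N D M : ℕ) → ι K *ℚ (a *ℚ a) ≤ℚ T → T ≡ ι (suc N) *ℚ V → V ≤ℚ ι M *ℚ ∣ b ∣ →
          ι (suc N) *ℚ ι (suc N) ≤ℚ ι D *ℚ T → D * (M * M) < K → ∣ a ∣ <ℚ ∣ b ∣
compare {a} {b} {V} K N D M h₁ refl h₃ h₄ h₅ with ∣ a ∣ ℚₚ.<? ∣ b ∣
... | yes p = p
... | no ¬p = ⊥-elim (ℚₚ.<-irrefl refl (ℚₚ.<-≤-trans strict weak))
  where
  ν B W : ℚ
  ν = ι (suc N)
  B = ∣ b ∣
  W = ι M *ℚ B
  instance
    ν-pos : ℚ.Positive ν
    ν-pos = ℚ.positive (0<ι N)
  ν≤DV : ν ≤ℚ ι D *ℚ V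
  ν≤DV = ℚₚ.*-cancelˡ-≤-pos ν (subst (ν *ℚ ν ≤ℚ_) (solve 3 (λ d n v → d :* (n :* v) := n :* (d :* v)) refl (ι D) ν V) h₄)
  0<V : 0ℚ <ℚ V
  0<V with 0ℚ ℚₚ.<? V
  ... | yes p = p
  ... | no n = ⊥-elim (ℚₚ.<-irrefl refl (ℚₚ.<-≤-trans (0<ι N) (ℚₚ.≤-trans ν≤DV
          (subst (ι D *ℚ V ≤ℚ_) (ℚₚ.*-zeroʳ (ι D)) (ℚₚ.*-monoˡ-≤-nonNeg (ι D) {{ℚ.nonNegative (0≤ι D)}} (ℚₚ.≮⇒≥ n))))))
  0≤V : 0ℚ ≤ℚ V
  0≤V = ℚₚ.<⇒≤ 0<V
  0<B : 0ℚ <ℚ B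
  0<B with 0ℚ ℚₚ.<? B
  ... | yes p = p
  ... | no n = ⊥-elim (ℚₚ.<-irrefl refl (ℚₚ.<-≤-trans 0<V (ℚₚ.≤-trans h₃
          (subst (ι M *ℚ B ≤ℚ_) (ℚₚ.*-zeroʳ (ι M)) (ℚₚ.*-monoˡ-≤-nonNeg (ι M) {{ℚ.nonNegative (0≤ι M)}} (ℚₚ.≮⇒≥ n))))))
  B≤A : B ≤ℚ ∣ a ∣
  B≤A = ℚₚ.≮⇒≥ ¬p
  instance
    B²-pos : ℚ.Positive (B *ℚ B)
    B²-pos = ℚ.positive (subst (_<ℚ B *ℚ B) (ℚₚ.*-zeroˡ B) (ℚₚ.*-monoˡ-<-pos B {{ℚ.positive 0<B}} 0<B))
  strict : ι (D * (M * M)) *ℚ (B *ℚ B) <ℚ ι K *ℚ (B *ℚ B)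
  strict = ℚₚ.*-monoˡ-<-pos (B *ℚ B) (ι-mono-< h₅)
  weak : ι K *ℚ (B *ℚ B) ≤ℚ ι (D * (M * M)) *ℚ (B *ℚ B)
  weak = begin
    ι K *ℚ (B *ℚ B) ≤⟨ ℚₚ.*-monoˡ-≤-nonNeg (ι K) {{ℚ.nonNegative (0≤ι K)}} (*-mono-≤-nonNeg (ℚₚ.<⇒≤ 0<B) B≤A (ℚₚ.<⇒≤ 0<B) B≤A) ⟩
    ι K *ℚ (∣ a ∣ *ℚ ∣ a ∣) ≡⟨ cong (ι K *ℚ_) (∣∣-square a) ⟩
    ι K *ℚ (a *ℚ a) ≤⟨ h₁ ⟩
    ν *ℚ V ≤⟨ *-mono-≤-nonNeg (0≤ι (suc N)) ν≤DV 0≤V ℚₚ.≤-refl ⟩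
    ι D *ℚ V *ℚ V ≡⟨ ℚₚ.*-assoc (ι D) V V ⟩
    ι D *ℚ (V *ℚ V) ≤⟨ ℚₚ.*-monoˡ-≤-nonNeg (ι D) {{ℚ.nonNegative (0≤ι D)}} (*-mono-≤-nonNeg 0≤V h₃ 0≤V h₃) ⟩
    ι D *ℚ (W *ℚ W) ≡⟨ solve 3 (λ d m b → d :* ((m :* b) :* (m :* b)) := (d :* (m :* m)) :* (b :* b)) refl (ι D) (ι M) B ⟩
    ι D *ℚ (ι M *ℚ ι M) *ℚ (B *ℚ B) ≡⟨ cong (_*ℚ (B *ℚ B)) (trans (cong (ι D *ℚ_) (sym (ι-* M M))) (sym (ι-* D (M * M)))) ⟩
    ι (D * (M * M)) *ℚ (B *ℚ B) ∎
    where open ℚₚ.≤-Reasoning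

PairCount : List ℕ → ℕ → ℕ
PairCount μ m = length (filterᵇ (λ (P , Q) → related μ P Q) (cartesianProduct (mats m) (mats m)))

-- The first part of the cycle type becomes the connected left summand of `Rigidity`. The strict
-- inequality says that its half-length exceeds the number of all points on the other cycles.
perms≤pairs : ∀ p {μ} (pos : All (1 ≤_) μ) → sum (double μ) < suc p → ∀ {m} → 2 * suc p + sum (double μ) ≡ m →
              length (perms m) ≤ m * sum (double μ) ^ sum (double μ) * PairCount (suc p ∷ μ) m
perms≤pairs p {μ} pos small refl = Rigidity.perms≤ S.MP S.MQ R.MP R.MQ S.connected (λ i → subst (sum (double μ) <_) (sym (S.halfLen-all i)) small)
    (related (suc p ∷ μ)) (λ π MP MQ → related-act π MP MQ (suc p ∷ μ)) (related⁺ (suc p ∷ μ) _ _ (Realization.lengths (realize (suc p ∷ μ) (s≤s z≤n ∷ pos))))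
  where
  module S = SingleCycle p
  module R = Realization (realize μ pos)

module Parameters (k : ℕ) where

  c : ℕ
  c = (2 * k) ^ (2 * k)

  -- From 4 s + 4 ≤ n ≤ 4 s + 7 ≤ 5 s one gets 8 n³ c ≤ 1000 c s³, which is below s⁴
  -- once s exceeds 1000 c.
  threshold : ℕ
  threshold = ((1000 * c + 7) * 4 + 7) + suc (3 * k)

  module _ {n : ℕ} (large : threshold ≤ n) where

    x s : ℕ
    x = n ∸ 4
    s = x / 4

    x≡ : x ≡ x % 4 + s * 4
    x≡ = m≡m%n+[m/n]*n x 4

    4≤n : 4 ≤ n
    4≤n = ℕₚ.≤-trans (ℕₚ.≤-trans (ℕₚ.m≤n+m 4 ((1000 * c + 7) * 4 + 3)) (ℕₚ.≤-trans (ℕₚ.≤-reflexive (ℕₚ.+-assoc ((1000 * c + 7) * 4) 3 4)) (ℕₚ.m≤m+n _ (suc (3 * k))))) large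

    n≡ : n ≡ 4 + x
    n≡ = sym (ℕₚ.m+[n∸m]≡n 4≤n)

    n≤ : n ≤ s * 4 + 7
    n≤ = begin
      n ≡⟨ n≡ ⟩
      4 + x ≡⟨ cong (4 +_) x≡ ⟩
      4 + (x % 4 + s * 4) ≤⟨ ℕₚ.+-monoʳ-≤ 4 (ℕₚ.+-monoˡ-≤ (s * 4) (s≤s⁻¹ (m%n<n x 4))) ⟩
      7 + s * 4 ≡⟨ ℕₚ.+-comm 7 (s * 4) ⟩
      s * 4 + 7 ∎
      where open ℕₚ.≤-Reasoning

    s≥ : 1000 * c + 7 ≤ s
    s≥ = ℕₚ.*-cancelʳ-≤ (1000 * c + 7) s 4 (ℕₚ.+-cancelʳ-≤ 7 _ _ (ℕₚ.≤-trans (ℕₚ.m≤m+n _ (suc (3 * k))) (ℕₚ.≤-trans large n≤)))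

    room : 4 + s * 4 ≤ n
    room = begin
      4 + s * 4 ≤⟨ ℕₚ.+-monoʳ-≤ 4 (ℕₚ.m≤n+m (s * 4) (x % 4)) ⟩
      4 + (x % 4 + s * 4) ≡⟨ cong (4 +_) x≡ ⟨
      4 + x ≡⟨ n≡ ⟨
      n ∎
      where open ℕₚ.≤-Reasoning

    3k<n : 3 * k < n
    3k<n = ℕₚ.≤-trans (ℕₚ.m≤n+m (suc (3 * k)) _) large

    n≤5s : n ≤ 5 * s
    n≤5s = begin
      n ≤⟨ n≤ ⟩
      s * 4 + 7 ≤⟨ ℕₚ.+-monoʳ-≤ (s * 4) (ℕₚ.≤-trans (ℕₚ.m≤n+m 7 (1000 * c)) s≥) ⟩
      s * 4 + s ≡⟨ fold s ⟩
      5 * s ∎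
      where
      open ℕₚ.≤-Reasoning
      fold : ∀ s → s * 4 + s ≡ 5 * s
      fold = ℕ-Ring.solve-∀

    growth : 2 * n * c * (2 * n * (2 * n)) < s ^ 4
    growth = begin-strict
      2 * n * c * (2 * n * (2 * n)) ≤⟨ ℕₚ.*-mono-≤ (ℕₚ.*-monoˡ-≤ c 2n≤) (ℕₚ.*-mono-≤ 2n≤ 2n≤) ⟩
      2 * (5 * s) * c * (2 * (5 * s) * (2 * (5 * s))) ≡⟨ expand s c ⟩
      1000 * c * (s * (s * (s * 1))) <⟨ ℕₚ.*-monoˡ-< (s * (s * (s * 1))) {{s³≢0}} (ℕₚ.<-≤-trans (ℕₚ.m<m+n (1000 * c) (s≤s z≤n)) s≥) ⟩
      s * (s * (s * (s * 1))) ∎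
      where
      open ℕₚ.≤-Reasoning
      2n≤ : 2 * n ≤ 2 * (5 * s)
      2n≤ = ℕₚ.*-monoʳ-≤ 2 n≤5s
      0<s : 0 < s
      0<s = ℕₚ.<-≤-trans (s≤s z≤n) (ℕₚ.≤-trans (ℕₚ.m≤n+m 7 (1000 * c)) s≥)
      s³≢0 : NonZero (s * (s * (s * 1)))
      s³≢0 = Data.Nat.>-nonZero (ℕₚ.*-mono-≤ 0<s (ℕₚ.*-mono-≤ 0<s (ℕₚ.*-mono-≤ 0<s (ℕₚ.≤-refl {1}))))
      expand : ∀ s c → 2 * (5 * s) * c * (2 * (5 * s) * (2 * (5 * s))) ≡ 1000 * c * (s * (s * (s * 1)))
      expand = ℕ-Ring.solve-∀

    -- Of the s blocks one is given and s - 1 are added, so 8 + 4q = 4 + 4s, which `room` bounds by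
    -- n.
    q : ℕ
    q = pred s

    s≡ : suc q ≡ s
    s≡ = ℕₚ.suc-pred s {{Data.Nat.>-nonZero (ℕₚ.<-≤-trans (s≤s z≤n) (ℕₚ.≤-trans (ℕₚ.m≤n+m 7 (1000 * c)) s≥))}}

    enough : 2 * (8 + q * 4) ≤ 2 * n
    enough = ℕₚ.*-monoʳ-≤ 2 (subst (λ s → 4 + s * 4 ≤ n) (sym s≡) room)

-- `growth` is D M² < K of `compare` with D = 2n (2k)^(2k), M = 2n and K = (q + 1)^4. `3k<n` says
-- that 2k < n - k, so that the long cycle outgrows the 2k remaining points.
record Admissible (k n : ℕ) : Set where
  field
    q      : ℕ
    enough : 2 * (8 + q * 4) ≤ 2 * n
    growth : 2 * n * (2 * k) ^ (2 * k) * (2 * n * (2 * n)) < suc q ^ 4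
    3k<n   : 3 * k < n
    4≤n    : 4 ≤ n

eventually-admissible : ∀ k → ∃[ N ] ∀ n → N ≤ n → Admissible k n
eventually-admissible k = threshold , λ n large → record
  { q = q large ; enough = enough large ; 3k<n = 3k<n large ; 4≤n = 4≤n large
  ; growth = subst (λ s → 2 * n * c * (2 * n * (2 * n)) < s ^ 4) (sym (s≡ large)) (growth large) }
  where open Parameters k

module _ {k n : ℕ} (admissible : Admissible k n) (μ′ : Partition k) where

  open Admissible admissible

  private
    ρ : List ℕ
    ρ = parts μ′

    p : ℕ
    p = pred (n ∸ k)

    m c : ℕ
    m = 2 * n
    c = (2 * k) ^ (2 * k)

    size : sum (double ρ) ≡ 2 * k
    size = trans (sum-double ρ) (cong (2 *_) (Partition.total μ′))

    k≤n : k ≤ n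
    k≤n = ℕₚ.≤-trans (ℕₚ.m≤m+n k (2 * k)) (ℕₚ.<⇒≤ 3k<n)

    2k<n∸k : 2 * k < n ∸ k
    2k<n∸k = ℕₚ.m+n≤o⇒m≤o∸n (suc (2 * k)) (subst (_≤ n) (cong suc (ℕₚ.+-comm k (2 * k))) 3k<n)

    p≡ : suc p ≡ n ∸ k
    p≡ = ℕₚ.suc-pred (n ∸ k) {{Data.Nat.>-nonZero (ℕₚ.≤-<-trans z≤n 2k<n∸k)}}

    μ : List ℕ
    μ = (n ∸ k) ∷ ρ

    rel : Tab m → Tab m → Bool
    rel = related μ

    rel-act : ∀ π {P Q} → Matching P → Matching Q → rel (act π P) (act π Q) ≡ rel P Q
    rel-act π MP MQ = related-act π MP MQ μ

    open Scheme rel rel-act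

    perms-bound : length (perms m) ≤ m * c * PairCount μ m
    perms-bound = subst₂ (λ a b → length (perms m) ≤ m * (a ^ a) * PairCount (b ∷ ρ) m) size p≡
      (perms≤pairs p (positive μ′) (subst₂ _<_ (sym size) (sym p≡) 2k<n∸k)
        (trans (cong₂ (λ a b → 2 * a + b) p≡ size) (trans (sym (ℕₚ.*-distribˡ-+ 2 (n ∸ k) k)) (cong (2 *_) (ℕₚ.m∸n+n≡m k≤n)))))

    relatedPairs≡ : ι (PairCount μ m) ≡ relatedPairs
    relatedPairs≡ = trans (ι-length-filterᵇ (λ (P , Q) → rel P Q) (cartesianProduct (mats m) (mats m)))
      (∑-cartesianProduct (λ (P , Q) → indic (rel P Q)) (mats m) (mats m))

    mats²≤ : ι (length (mats m)) *ℚ ι (length (mats m)) ≤ℚ ι (m * c) *ℚ relatedPairs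
    mats²≤ = subst₂ _≤ℚ_ (ι-* (length (mats m)) (length (mats m)))
      (trans (ι-* (m * c) (PairCount μ m)) (cong (ι (m * c) *ℚ_) relatedPairs≡))
      (ι-mono-≤ (ℕₚ.≤-trans (matchings²≤perms n) perms-bound))

    common-edges : CommonEdges rel rel-act
    common-edges with DecMembership._∈?_ Data.Nat._≟_ 1 μ
    ... | yes i = inj₁ λ {P} {Q} MP MQ r → Cycles.1∈lengths⇒common-edge MP MQ (∈-resp-↭ (↭-sym (related⁻ μ P Q r)) i)
    ... | no  i = inj₂ λ {P} {Q} MP MQ r x e → i (∈-resp-↭ (related⁻ μ P Q r) (Cycles.common-edge⇒1∈lengths MP MQ x e))

    toEig : ∀ {a v} → (∀ P → IsMatching P → applyA {n} μ v P ≡ a *ℚ v P) → Eig a v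
    toEig h = eig λ {P} M → h P (isMatching⁺ M)

    second : ∀ j → n ≡ suc (suc j) → ∀ (ν : Partition n) → parts ν ≡ (n ∸ 1) ∷ 1 ∷ [] → ∀ {w b} → IsEigenpair n μ ν w b →
             ∃[ P ] Matching P × Second.valency rel rel-act P ≤ℚ ι m *ℚ ∣ b ∣
    second j e ν eν {w} (I , (P , M , nz) , h) = hook-eigenvalue rel rel-act j (cong (2 *_) e) common-edges (toEig h)
      (subst (λ ps → Pairing (double ps) w) (trans eν (cong (λ n → (n ∸ 1) ∷ 1 ∷ []) e)) (eigenspace-pairing n ν w I M nz))

  compare-eigenvalues : ∀ (λp ν : Partition n) → ¬ (parts λp ≡ n ∷ []) → ¬ (parts λp ≡ (n ∸ 1) ∷ 1 ∷ []) → parts ν ≡ (n ∸ 1) ∷ 1 ∷ [] →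
    ∀ {v w a b} → IsEigenpair n μ λp v a → IsEigenpair n μ ν w b → ∣ a ∣ <ℚ ∣ b ∣
  compare-eigenvalues λp ν ¬n ¬n-1 eν {v = v} {a = a} {b} (I , (P , M , nz) , h) W =
    conclude (second (n ∸ 2) (sym (ℕₚ.m+[n∸m]≡n (ℕₚ.≤-trans (s≤s (s≤s z≤n)) 4≤n))) ν eν W)
    where
    first-bound : ι (suc q ^ 4) *ℚ (a *ℚ a) ≤ℚ relatedPairs
    first-bound = eigenvalue-bound n rel rel-act q enough λp ¬n ¬n-1 {a} {v} (toEig h) I M nz
    conclude : (∃[ P ] Matching P × Second.valency rel rel-act P ≤ℚ ι m *ℚ ∣ b ∣) → ∣ a ∣ <ℚ ∣ b ∣
    conclude (P′ , M′ , l) = go (length (mats m)) (∈-length (∈-mats M′)) mats²≤ (Second.relatedPairs-valency rel rel-act M′)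
      where
      -- The number of matchings is positive since P′ is one; abstracting it as N lets it be matched
      -- with the `suc N` of `compare`.
      go : ∀ N → 0 < N → ι N *ℚ ι N ≤ℚ ι (m * c) *ℚ relatedPairs → relatedPairs ≡ ι N *ℚ Second.valency rel rel-act P′ → ∣ a ∣ <ℚ ∣ b ∣
      go (suc N) _ h₄ h₂ = compare {a} {b} (suc q ^ 4) N (m * c) m first-bound h₂ l h₄ growth

theorem3p1 : (k : ℕ) → 1 ≤ k →
    ∃[ N ] ∀ (n : ℕ) → N ≤ n → (μ' : Partition k) →
    ∀ (λp ν : Partition n) →
    ¬ (parts λp ≡ n ∷ []) → ¬ (parts λp ≡ (n ∸ 1) ∷ 1 ∷ []) →
    parts ν ≡ (n ∸ 1) ∷ 1 ∷ [] →
    ∀ (v w : QVec n) (a b : ℚ) →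
    IsEigenpair n ((n ∸ k) ∷ parts μ') λp v a →
    IsEigenpair n ((n ∸ k) ∷ parts μ') ν w b →
    ∣ a ∣ <ℚ ∣ b ∣
theorem3p1 k _ = let N , admissible = eventually-admissible k in
  N , λ n large μ′ λp ν ¬n ¬n-1 eν v w a b → compare-eigenvalues (admissible n large) μ′ λp ν ¬n ¬n-1 eν
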